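{- There is an algorithm that, given any finite simple undirected graph $G=(V,E)$ and two distinct vertices $s,t\in V$, enumerates all chordless $s$-$t$ paths of $G$ (outputting each of them exactly once and nothing else) in $O(|V|+|E|)$ time per chordless $s$-$t$ path; in particular, the algorithm has polynomial time delay.
   Context: Graphs are finite and undirected, with neither self-loops nor multi-edges. An $s$-$t$ path in $G$ is a path $(v_1,\ldots,v_k)$ with pairwise distinct vertices, consecutive vertices adjacent in $G$, and $v_1=s$, $v_k=t$. A chord of a path $P$ of $G$ is an edge of $G$ that connects two vertices of $P$ and is not an edge of $P$; $P$ is chordless if $G$ contains no chord of $P$. The computational model is the standard RAM model. "Enumerated in $O(|V|+|E|)$ time per chordless path" means that the total running time is $O((|V|+|E|)\cdot\max(N,1))$, where $N$ is the number of chordless $s$-$t$ paths of $G$. "Polynomial time delay" means that the time before the first output, between any two consecutive outputs, and from the last output to termination is bounded by a polynomial in $|V|+|E|$. -}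

module Defs where

open import Data.Bool.Base using (if_then_else_)
open import Data.Fin.Base using (Fin; toℕ)
import Data.Fin.Base as Fin
import Data.Fin.Properties as Fin
open import Data.List.Base using
  (List; []; _∷_; _++_; [_]; map; head; last; drop; length; filter; concatMap;
   allFin; cartesianProduct)
open import Data.List.Membership.Propositional using (_∈_)
open import Data.List.Relation.Unary.Linked using (Linked)
open import Data.List.Relation.Unary.Unique.Propositional using (Unique)
open import Data.Maybe.Base using (Maybe; just; nothing; fromMaybe)
open import Data.Nat.Base using (ℕ; zero; suc; _+_; _∸_)
open import Data.Nat.Properties using (_≟_; _≤?_)
open import Data.Product.Base using (_×_; _,_; ∃₂)
open import Data.Sum.Base using (_⊎_)
open import Function.Bundles using (_⇔_)
open import Relation.Binary.Core using (Rel)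
open import Relation.Binary.Definitions using (Symmetric; Irreflexive; Decidable)
open import Relation.Binary.PropositionalEquality.Core using (_≡_)
open import Relation.Nullary.Decidable.Core using (does; _×-dec_)
open import Relation.Nullary.Negation.Core using (¬_)
open import Level using (0ℓ)

record Graph : Set₁ where
  infix 4 _~_ _~?_
  field
    order    : ℕ
    _~_      : Rel (Fin order) 0ℓ
    ~-sym    : Symmetric _~_
    ~-irrefl : Irreflexive _≡_ _~_
    _~?_     : Decidable _~_

  Vertex : Set
  Vertex = Fin order

  -- Each undirected edge is listed once, as the pair with increasing endpoints.
  edges : List (Vertex × Vertex)
  edges = filter (λ (u , v) → (u Fin.<? v) ×-dec (u ~? v))
                 (cartesianProduct (allFin order) (allFin order))

  size : ℕ
  size = order + length edges

open Graph public using (Vertex; size)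

module _ (G : Graph) where
  open Graph G using (_~_)

  record IsPath (s t : Vertex G) (p : List (Vertex G)) : Set where
    field
      distinct : Unique p
      adjacent : Linked _~_ p
      starts   : head p ≡ just s
      ends     : last p ≡ just t

  Consecutive : List (Vertex G) → Rel (Vertex G) 0ℓ
  Consecutive p u v = ∃₂ λ xs ys → p ≡ xs ++ u ∷ v ∷ ys

  EdgeOf : List (Vertex G) → Rel (Vertex G) 0ℓ
  EdgeOf p u v = Consecutive p u v ⊎ Consecutive p v u

  Chord : List (Vertex G) → Rel (Vertex G) 0ℓ
  Chord p u v = u ~ v × u ∈ p × v ∈ p × ¬ EdgeOf p u v

  Chordless : List (Vertex G) → Set
  Chordless p = ∀ u v → ¬ Chord p u v

  IsChordlessPath : (s t : Vertex G) → List (Vertex G) → Set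
  IsChordlessPath s t p = IsPath s t p × Chordless p

  record IsEnumeration (s t : Vertex G) (ps : List (List (Vertex G))) : Set where
    field
      once  : Unique ps
      exact : ∀ p → p ∈ ps ⇔ IsChordlessPath s t p

  -- The neighbours of a vertex may be listed in any order.
  record AdjacencyLists : Set where
    field
      neighbours : Vertex G → List (Vertex G)
      once       : ∀ v → Unique (neighbours v)
      exact      : ∀ v u → u ∈ neighbours v ⇔ v ~ u

  -- n, s, t, followed for each vertex by its degree and its neighbours.
  encode : AdjacencyLists → (s t : Vertex G) → List ℕ
  encode A s t =
    Graph.order G ∷ toℕ s ∷ toℕ t ∷
    concatMap (λ v → length (neighbours v) ∷ map toℕ (neighbours v))
              (allFin (Graph.order G))
    where open AdjacencyLists A

-- A unit-cost random access machine with registers, a word-addressed memory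
-- and a write-only output on which finished solutions are delimited.

Reg Label : Set
Reg   = ℕ
Label = ℕ

data Instr : Set where
  const  : Reg → ℕ → Instr          -- r ← k
  add    : Reg → Reg → Reg → Instr  -- r ← a + b
  sub    : Reg → Reg → Reg → Instr  -- r ← a ∸ b
  load   : Reg → Reg → Instr        -- r ← M[a]
  store  : Reg → Reg → Instr        -- M[a] ← r, for  store a r
  jump   : Label → Instr
  jumpIf : Reg → Label → Instr      -- taken when the register is positive
  print  : Reg → Instr              -- append a word to the current solution
  finish : Instr                    -- end the current solution
  halt   : Instr

Program : Set
Program = List Instr

record State : Set where
  constructor ⟨_,_,_⟩
  field
    pc  : Label
    reg : Reg → ℕ
    mem : ℕ → ℕ

data Event : Set where
  silent   : Event
  printed  : ℕ → Event
  finished : Event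

data Outcome : Set where
  next   : Event → State → Outcome
  halted : Outcome
  fault  : Outcome

at : {A : Set} → List A → ℕ → Maybe A
at xs i = head (drop i xs)

_[_≔_] : (ℕ → ℕ) → ℕ → ℕ → (ℕ → ℕ)
(f [ i ≔ x ]) j = if does (j ≟ i) then x else f j

-- W is the largest machine word; computing a larger value is a fault, and so
-- is running off the program.
module _ (W : ℕ) where

  assign : State → Reg → ℕ → Outcome
  assign ⟨ pc , reg , mem ⟩ r x =
    if does (x ≤? W) then next silent ⟨ suc pc , reg [ r ≔ x ] , mem ⟩ else fault

  exec : Instr → State → Outcome
  exec (const r k)  σ = assign σ r k
  exec (add r a b)  σ = assign σ r (State.reg σ a + State.reg σ b)
  exec (sub r a b)  σ = assign σ r (State.reg σ a ∸ State.reg σ b)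
  exec (load r a)   σ = assign σ r (State.mem σ (State.reg σ a))
  exec (store a r)  ⟨ pc , reg , mem ⟩ =
    next silent ⟨ suc pc , reg , mem [ reg a ≔ reg r ] ⟩
  exec (jump l)     ⟨ pc , reg , mem ⟩ = next silent ⟨ l , reg , mem ⟩
  exec (jumpIf r l) ⟨ pc , reg , mem ⟩ with reg r
  ... | zero  = next silent ⟨ suc pc , reg , mem ⟩
  ... | suc _ = next silent ⟨ l , reg , mem ⟩
  exec (print r)    ⟨ pc , reg , mem ⟩ = next (printed (reg r)) ⟨ suc pc , reg , mem ⟩
  exec finish       ⟨ pc , reg , mem ⟩ = next finished ⟨ suc pc , reg , mem ⟩
  exec halt         σ = halted

  step : Program → State → Outcome
  step P σ with at P (State.pc σ)
  ... | nothing    = fault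
  ... | just instr = exec instr σ

  -- A fault-free terminating computation, with one event per executed
  -- instruction (including the final halt).
  data Run (P : Program) : State → List Event → Set where
    stop : ∀ {σ} → step P σ ≡ halted → Run P σ [ silent ]
    tick : ∀ {σ σ′ e es} → step P σ ≡ next e σ′ → Run P σ′ es → Run P σ (e ∷ es)

initial : List ℕ → State
initial input = ⟨ 0 , (λ _ → 0) , (λ i → fromMaybe 0 (at input i)) ⟩

time : List Event → ℕ
time = length

-- The first argument holds the words printed since the last finished solution;
-- words left over at the end count as one more solution.
outputsFrom : List ℕ → List Event → List (List ℕ)
outputsFrom []       []               = []
outputsFrom (w ∷ ws) []               = (w ∷ ws) ∷ []
outputsFrom ws       (silent ∷ es)    = outputsFrom ws es
outputsFrom ws       (printed w ∷ es) = outputsFrom (ws ++ [ w ]) es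
outputsFrom ws       (finished ∷ es)  = ws ∷ outputsFrom [] es

outputs : List Event → List (List ℕ)
outputs = outputsFrom []

-- The first argument is the time elapsed since the last finished solution.
delaysFrom : ℕ → List Event → List ℕ
delaysFrom d []               = [ d ]
delaysFrom d (silent ∷ es)    = delaysFrom (suc d) es
delaysFrom d (printed _ ∷ es) = delaysFrom (suc d) es
delaysFrom d (finished ∷ es)  = suc d ∷ delaysFrom 0 es

-- Times before the first solution, between successive solutions, and from the
-- last solution to termination.
delays : List Event → List ℕ
delays = delaysFrom 0

{-# OPTIONS --safe #-}

-- Fix a chordless path q₀ … q₍ₗ₋₁₎ from s to t, and let the rank of a vertex be
-- the only position at which it can occur on a chordless path along a prefix
-- of it: one more than the index of its first neighbour among the q's, and 0
-- for s.  A chordless path that leaves this one at position i continues with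
-- a vertex x of rank i, followed by vertices of rank more than i.  So the
-- branches at position i are the vertices x ≠ qᵢ of rank i with a neighbour
-- from which t is reachable through vertices of rank more than i, and one
-- search from t that admits lower and lower ranks finds them for all i in
-- linear time.  The parent of a vertex is its first processed neighbour;
-- hence, whatever the order of the search, the chain of parents from x to t
-- is chordless and gives a solution for the branch.  The solutions that branch
-- off at different (i, x) are disjoint, so every expansion and every entry
-- pushed on the stack is paid for by a solution of its own.

module Submission where

open import Data.Bool.Base using (Bool; T; _∧_; _∨_; false; if_then_else_; not; true)
open import Data.Empty using (⊥-elim)
open import Data.Fin.Base using (Fin; suc; toℕ; zero)
import Data.Fin.Properties as Fin
open import Data.List.Base using
  (List; []; [_]; _++_; _ʳ++_; _∷_; allFin; concatMap; drop; head; last; length; map; replicate; reverse; tabulate)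
open import Data.List.Membership.Propositional using (_∈_; _∉_)
open import Data.List.Membership.Propositional.Properties using
  (∈-++⁺ʳ; ∈-++⁺ˡ; ∈-++⁻; ∈-allFin; ∈-cartesianProduct⁺; ∈-filter⁺; ∈-map⁺; ∈-map⁻; ∈-∃++)
open import Data.List.Properties using
  (++-assoc; ++-identityʳ; ++-ʳ++; length-++; length-map; length-replicate; length-tabulate; length-ʳ++; map-++; map-ʳ++; reverse-involutive; ʳ++-defn; ∷-injectiveʳ; ∷-injectiveˡ)
open import Data.List.Relation.Unary.All using (All; []; _∷_)
import Data.List.Relation.Unary.All as All
import Data.List.Relation.Unary.All.Properties as All
open import Data.List.Relation.Unary.AllPairs using (AllPairs; []; _∷_)
open import Data.List.Relation.Unary.Any using (Any; here; there)
import Data.List.Relation.Unary.Any as Any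
open import Data.List.Relation.Unary.Linked using (Linked; [-]; []; _∷_)
open import Data.List.Relation.Unary.Unique.Propositional using (Unique)
import Data.List.Relation.Unary.Unique.Propositional.Properties as Unique
open import Data.Maybe.Base using (fromMaybe; just)
open import Data.Nat.Base using
  (>-nonZero; _*_; _+_; _<_; _^_; _∸_; _≡ᵇ_; _≤_; _≤ᵇ_; _⊔_; suc; s≤s; zero; z≤n; ℕ)
open import Data.Nat.DivMod using ([m+kn]%n≡m%n; _%_; m<n⇒m%n≡m)
open import Data.Nat.ListAction using (sum)
open import Data.Nat.ListAction.Properties using (sum-++)
open import Data.Nat.Properties
open import Data.Nat.Solver using (module +-*-Solver)
open import Data.Product.Base using (_,_; _×_; proj₁; proj₂; swap; ∃; ∃₂)
open import Data.Sum.Base using ([_,_]′; _⊎_; inj₁; inj₂)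
open import Data.Unit.Base using (tt; ⊤)
open import Defs
open import Function.Base using (_$_; _∘_; case_of_; id)
open import Function.Bundles using (Equivalence; _⇔_; mk⇔)
open import Relation.Binary.Definitions using (tri<; tri>; tri≈)
open import Relation.Binary.PropositionalEquality hiding ([_])
open import Relation.Nullary.Decidable using (Dec; _×-dec_; dec-false; dec-true; does; no; yes)
open import Relation.Nullary.Negation.Core using (¬_)

-- A structured language on top of the machine

-- Comparing ranks with the current level replaces deletion of vertices: once the prefix up to
-- position `i` is fixed, its closed neighbourhood consists of vertices of rank at most `i`, so one
-- flag array, never reset within an expansion, serves all positions. The machine has no recursion,
-- so solutions still to be expanded lie on a stack, each written out in full: it can then be
-- printed right after it is popped, without another search. Printing precedes expansion, so a delay
-- spans at most two iterations. One iteration may push linearly many paths of linear length, whence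
-- a quadratic delay although the time per solution is linear. Prefixes grow with every generation,
-- so at most `n` generations of siblings wait on the stack at once. This bounds the stack by a
-- cubic number of words, and the word size `W` follows from it. Time is counted in machine
-- instructions. To reason above that level, the algorithm is written in a small structured language
-- whose semantics records one event for each compiled instruction.

upd-same : ∀ f i x → (f [ i ≔ x ]) i ≡ x
upd-same f i x = cong (λ b → if b then x else f i) (dec-true (i ≟ i) refl)

upd-other : ∀ f {i j} x → j ≢ i → (f [ i ≔ x ]) j ≡ f j
upd-other f {i} {j} x j≢i = cong (λ b → if b then x else f j) (dec-false (j ≟ i) j≢i)

-- Cell `i` of array `k` lies at `base + 8 i + k`. Interleaving lets every array grow without a
-- length fixed in advance, and with a power of two the index is scaled by three doublings, as the
-- machine cannot multiply.
Array : Set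
Array = Fin 8

record Store : Set where
  constructor store
  field
    var : ℕ → ℕ
    arr : Array → ℕ → ℕ
open Store public

setVar : Store → ℕ → ℕ → Store
setVar σ x n = store (var σ [ x ≔ n ]) (arr σ)

setArr : Store → Array → ℕ → ℕ → Store
setArr σ k i n = store (var σ) (λ k′ → if does (k′ Fin.≟ k) then arr σ k [ i ≔ n ] else arr σ k′)

infixl 6 _⊕_ _⊖_
data Exp : Set where
  ! lit   : ℕ → Exp
  _⊕_ _⊖_ : Exp → Exp → Exp
  input   : Exp → Exp
  _‹_›    : Array → Exp → Exp

infix  5 _←_ _‹_›←_
infixr 4 _⨾_
data Cmd : Set where
  skip      : Cmd
  _←_       : ℕ → Exp → Cmd
  _‹_›←_   : Array → Exp → Exp → Cmd
  _⨾_       : Cmd → Cmd → Cmd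
  when      : Exp → Cmd → Cmd
  while     : Exp → Cmd → Cmd
  output    : Exp → Cmd
  endOutput : Cmd

-- Register 0 always holds 0 and register 1 the base address of the arrays.
varReg tmpReg : ℕ → ℕ
varReg zero    = 2
varReg (suc x) = 2 + varReg x
tmpReg zero    = 3
tmpReg (suc d) = 2 + tmpReg d

varReg-injective : ∀ x y → varReg x ≡ varReg y → x ≡ y
varReg-injective zero    zero    _ = refl
varReg-injective zero    (suc zero) ()
varReg-injective zero    (suc (suc y)) ()
varReg-injective (suc zero) zero ()
varReg-injective (suc (suc x)) zero ()
varReg-injective (suc x) (suc y) e = cong suc (varReg-injective x y (suc-injective (suc-injective e)))

tmpReg-injective : ∀ x y → tmpReg x ≡ tmpReg y → x ≡ y
tmpReg-injective zero    zero    _ = refl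
tmpReg-injective zero    (suc zero) ()
tmpReg-injective zero    (suc (suc y)) ()
tmpReg-injective (suc zero) zero ()
tmpReg-injective (suc (suc x)) zero ()
tmpReg-injective (suc x) (suc y) e = cong suc (tmpReg-injective x y (suc-injective (suc-injective e)))

varReg≢tmpReg : ∀ x d → varReg x ≢ tmpReg d
varReg≢tmpReg (suc x) (suc d) e = varReg≢tmpReg x d (suc-injective (suc-injective e))
varReg≢tmpReg zero zero ()
varReg≢tmpReg zero (suc zero) ()
varReg≢tmpReg zero (suc (suc d)) ()
varReg≢tmpReg (suc zero) zero ()
varReg≢tmpReg (suc (suc x)) zero ()

2≤varReg : ∀ x → 2 ≤ varReg x
2≤varReg zero    = s≤s (s≤s z≤n)
2≤varReg (suc x) = s≤s (s≤s z≤n)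

3≤tmpReg : ∀ x → 3 ≤ tmpReg x
3≤tmpReg zero    = s≤s (s≤s (s≤s z≤n))
3≤tmpReg (suc x) = ≤-trans (3≤tmpReg x) (m≤n+m _ 2)

-- Compilation to machine code.

address : ℕ → Array → ℕ → List Instr
address d k t = add t t t ∷ add t t t ∷ add t t t ∷ add t t 1
              ∷ const (tmpReg (suc d)) (toℕ k) ∷ add t t (tmpReg (suc d)) ∷ []

-- `d` is the depth of an evaluation stack kept in the temporaries: the value ends in `tmpReg d`,
-- and those below it stay intact. Subtracting register 0 serves as a move.
compileExp : Exp → ℕ → List Instr
compileExp (! x)     d = [ sub (tmpReg d) (varReg x) 0 ]
compileExp (lit n)   d = [ const (tmpReg d) n ]
compileExp (e ⊕ f)   d = compileExp e d ++ compileExp f (suc d) ++ [ add (tmpReg d) (tmpReg d) (tmpReg (suc d)) ]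
compileExp (e ⊖ f)   d = compileExp e d ++ compileExp f (suc d) ++ [ sub (tmpReg d) (tmpReg d) (tmpReg (suc d)) ]
compileExp (input e) d = compileExp e d ++ [ load (tmpReg d) (tmpReg d) ]
compileExp (k ‹ e ›) d = compileExp e d ++ address d k (tmpReg d) ++ [ load (tmpReg d) (tmpReg d) ]

-- Expressions compile to straight-line code, so the length of the code is also its running time.
cost : Exp → ℕ
cost (! x)     = 1
cost (lit n)   = 1
cost (e ⊕ f)   = cost e + (cost f + 1)
cost (e ⊖ f)   = cost e + (cost f + 1)
cost (input e) = cost e + 1
cost (k ‹ e ›) = cost e + 7

codeSize : Cmd → ℕ
codeSize skip             = 0
codeSize (x ← e)         = cost e + 1
codeSize (k ‹ e ›← f)    = cost e + (6 + (cost f + 1))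
codeSize (c ⨾ d)          = codeSize c + codeSize d
codeSize (when g c)       = cost g + (2 + codeSize c)
codeSize (while g c)      = cost g + (2 + (codeSize c + 1))
codeSize (output e)       = cost e + 1
codeSize endOutput        = 1

-- Jumps are absolute, hence the parameter `pc`. The only conditional jump is taken on positive
-- registers, so a guard is followed by `jumpIf` across a `jump` to the exit, and the body begins
-- two instructions after the guard.
compile : ℕ → Cmd → List Instr
compile pc skip          = []
compile pc (x ← e)      = compileExp e 0 ++ [ sub (varReg x) (tmpReg 0) 0 ]
compile pc (k ‹ e ›← f) = compileExp e 0 ++ address 0 k (tmpReg 0) ++ compileExp f 1 ++ [ store (tmpReg 0) (tmpReg 1) ]
compile pc (c ⨾ d)       = compile pc c ++ compile (pc + codeSize c) d
compile pc (when g c)    = compileExp g 0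
                           ++ jumpIf (tmpReg 0) (pc + cost g + 2)
                            ∷ jump (pc + cost g + 2 + codeSize c)
                            ∷ compile (pc + cost g + 2) c
compile pc (while g c)   = compileExp g 0
                           ++ jumpIf (tmpReg 0) (pc + cost g + 2)
                            ∷ jump (pc + cost g + 2 + codeSize c + 1)
                            ∷ compile (pc + cost g + 2) c ++ [ jump pc ]
compile pc (output e)    = compileExp e 0 ++ [ print (tmpReg 0) ]
compile pc endOutput     = [ finish ]

length-++-≡ : ∀ {A : Set} (xs : List A) {ys m n} → length xs ≡ m → length ys ≡ n → length (xs ++ ys) ≡ m + n
length-++-≡ xs refl refl = length-++ xs

length-compileExp : ∀ e d → length (compileExp e d) ≡ cost e
length-compileExp (! x)     d = refl
length-compileExp (lit n)   d = refl
length-compileExp (e ⊕ f)   d = length-++-≡ (compileExp e d) (length-compileExp e d)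
                                  (length-++-≡ (compileExp f (suc d)) (length-compileExp f (suc d)) refl)
length-compileExp (e ⊖ f)   d = length-++-≡ (compileExp e d) (length-compileExp e d)
                                  (length-++-≡ (compileExp f (suc d)) (length-compileExp f (suc d)) refl)
length-compileExp (input e) d = length-++-≡ (compileExp e d) (length-compileExp e d) refl
length-compileExp (k ‹ e ›) d = length-++-≡ (compileExp e d) (length-compileExp e d) refl

length-compile : ∀ pc c → length (compile pc c) ≡ codeSize c
length-compile pc skip          = refl
length-compile pc (x ← e)       = length-++-≡ (compileExp e 0) (length-compileExp e 0) refl
length-compile pc (k ‹ e ›← f)  = length-++-≡ (compileExp e 0) (length-compileExp e 0)
                                    (cong (6 +_) (length-++-≡ (compileExp f 1) (length-compileExp f 1) refl))
length-compile pc (c ⨾ d)       = length-++-≡ (compile pc c) (length-compile pc c) (length-compile _ d)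
length-compile pc (when g c)    = length-++-≡ (compileExp g 0) (length-compileExp g 0) (cong (2 +_) (length-compile _ c))
length-compile pc (while g c)   = length-++-≡ (compileExp g 0) (length-compileExp g 0)
                                    (cong (2 +_) (length-++-≡ (compile _ c) (length-compile _ c) refl))
length-compile pc (output e)    = length-++-≡ (compileExp e 0) (length-compileExp e 0) refl
length-compile pc endOutput     = refl

silents : ℕ → List Event
silents n = replicate n silent

silents-+ : ∀ m {n} → silents m ++ silents n ≡ silents (m + n)
silents-+ zero    = refl
silents-+ (suc m) = cong (silent ∷_) (silents-+ m)

octuple : ℕ → ℕ
octuple i = let a = i + i; b = a + a in b + b

octuple≡ : ∀ i → octuple i ≡ i * 8
octuple≡ = solve 1 (λ i → ((i :+ i) :+ (i :+ i)) :+ ((i :+ i) :+ (i :+ i)) := i :* con 8) refl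
  where open +-*-Solver using (solve; _:=_; _:+_; _:*_; con)

cell : ℕ → ℕ → Array → ℕ
cell base i k = octuple i + base + toℕ k

-- After cancelling `base`, `k` is the remainder modulo 8 and `i` the quotient.
cell-injective : ∀ base i k i′ k′ → cell base i k ≡ cell base i′ k′ → i ≡ i′ × k ≡ k′
cell-injective base i k i′ k′ e = i≡ , k≡
  where
  regroup : ∀ i k → cell base i k ≡ (toℕ k + i * 8) + base
  regroup i k rewrite octuple≡ i = solve 3 (λ x b k → x :+ b :+ k := (k :+ x) :+ b) refl (i * 8) base (toℕ k)
    where open +-*-Solver using (solve; _:=_; _:+_)
  e′ : toℕ k + i * 8 ≡ toℕ k′ + i′ * 8
  e′ = +-cancelʳ-≡ base _ _ (trans (sym (regroup i k)) (trans e (regroup i′ k′)))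
  k≡ : k ≡ k′
  k≡ = Fin.toℕ-injective
    (trans (sym (m<n⇒m%n≡m (Fin.toℕ<n k)))
    (trans (sym ([m+kn]%n≡m%n (toℕ k) i 8))
    (trans (cong (_% 8) e′)
    (trans ([m+kn]%n≡m%n (toℕ k′) i′ 8) (m<n⇒m%n≡m (Fin.toℕ<n k′))))))
  i≡ : i ≡ i′
  i≡ = *-cancelʳ-≡ i i′ 8 (+-cancelˡ-≡ (toℕ k) _ _ (trans e′ (cong (λ k → toℕ k + i′ * 8) (sym k≡))))

-- Code in place and single steps of the machine.

CodeAt : Program → ℕ → List Instr → Set
CodeAt P pc []       = ⊤
CodeAt P pc (i ∷ is) = at P pc ≡ just i × CodeAt P (suc pc) is

codeAt-++ : ∀ P pc xs {ys n} → length xs ≡ n → CodeAt P pc (xs ++ ys) →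
            CodeAt P pc xs × CodeAt P (pc + n) ys
codeAt-++ P pc [] refl c rewrite +-identityʳ pc = tt , c
codeAt-++ P pc (x ∷ xs) refl (i , c) with codeAt-++ P (suc pc) xs refl c
... | c₁ , c₂ rewrite +-suc pc (length xs) = (i , c₁) , c₂

at-++ : ∀ {A : Set} (xs : List A) {y ys} → at (xs ++ y ∷ ys) (length xs) ≡ just y
at-++ []       = refl
at-++ (x ∷ xs) = at-++ xs

codeAt-middle : ∀ xs ys zs → CodeAt (xs ++ ys ++ zs) (length xs) ys
codeAt-middle xs []       zs = tt
codeAt-middle xs (y ∷ ys) zs =
  at-++ xs , subst₂ (λ P n → CodeAt P n ys) (++-assoc xs [ y ] (ys ++ zs))
               (trans (length-++ xs) (+-comm _ 1)) (codeAt-middle (xs ++ [ y ]) ys zs)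

module _ (W : ℕ) (P : Program) where

  record Moves (σ : State) (e : Event) (σ′ : State) : Set where
    constructor moves
    field move : step W P σ ≡ next e σ′

  data Steps : State → List Event → State → Set where
    done : ∀ {σ} → Steps σ [] σ
    _then_ : ∀ {σ σ′ σ″ e es} → Moves σ e σ′ → Steps σ′ es σ″ → Steps σ (e ∷ es) σ″
  infixr 5 _then_

module _ {W : ℕ} {P : Program} where

  infixr 5 _followedBy_
  _followedBy_ : ∀ {σ σ′ σ″ es es′} → Steps W P σ es σ′ → Steps W P σ′ es′ σ″ → Steps W P σ (es ++ es′) σ″
  done       followedBy ss′ = ss′
  (s then ss) followedBy ss′ = s then (ss followedBy ss′)

  run-steps : ∀ {σ σ′ es es′} → Steps W P σ es σ′ → Run W P σ′ es′ → Run W P σ (es ++ es′)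
  run-steps done              r = r
  run-steps (moves s then ss) r = tick s (run-steps ss r)

  retarget : ∀ {σ es es′ pc pc′ r m} → es ≡ es′ → pc ≡ pc′ →
             Steps W P σ es ⟨ pc , r , m ⟩ → Steps W P σ es′ ⟨ pc′ , r , m ⟩
  retarget refl refl s = s

module _ {W : ℕ} {P : Program} {pc : ℕ} {reg mem : ℕ → ℕ} where

  private
    σ₀ : State
    σ₀ = ⟨ pc , reg , mem ⟩

    fetch : ∀ {i} → at P pc ≡ just i → step W P σ₀ ≡ exec W i σ₀
    fetch eq with at P pc | eq
    ... | _ | refl = refl

    assign-ok : ∀ r {x y} → x ≡ y → y ≤ W → assign W σ₀ r x ≡ next silent ⟨ suc pc , reg [ r ≔ y ] , mem ⟩
    assign-ok r {x} refl x≤W = cong (λ b → if b then next silent ⟨ suc pc , reg [ r ≔ x ] , mem ⟩ else fault)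
                               (dec-true (x ≤? W) x≤W)

  step-const : ∀ {r k} → at P pc ≡ just (const r k) → k ≤ W →
               Moves W P σ₀ silent ⟨ suc pc , reg [ r ≔ k ] , mem ⟩
  step-const {r} i le = moves (trans (fetch i) (assign-ok r refl le))

  -- The result is given up to an equation, so that later states name the intended values and not
  -- expressions in the registers.
  step-add : ∀ {r a b x} → at P pc ≡ just (add r a b) → reg a + reg b ≡ x → x ≤ W →
             Moves W P σ₀ silent ⟨ suc pc , reg [ r ≔ x ] , mem ⟩
  step-add {r} i e le = moves (trans (fetch i) (assign-ok r e le))

  step-sub : ∀ {r a b x} → at P pc ≡ just (sub r a b) → reg a ∸ reg b ≡ x → x ≤ W →
             Moves W P σ₀ silent ⟨ suc pc , reg [ r ≔ x ] , mem ⟩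
  step-sub {r} i e le = moves (trans (fetch i) (assign-ok r e le))

  step-load : ∀ {r a x} → at P pc ≡ just (load r a) → mem (reg a) ≡ x → x ≤ W →
              Moves W P σ₀ silent ⟨ suc pc , reg [ r ≔ x ] , mem ⟩
  step-load {r} i e le = moves (trans (fetch i) (assign-ok r e le))

  step-store : ∀ {a r} → at P pc ≡ just (store a r) →
               Moves W P σ₀ silent ⟨ suc pc , reg , mem [ reg a ≔ reg r ] ⟩
  step-store i = moves (fetch i)

  step-jump : ∀ {l} → at P pc ≡ just (jump l) → Moves W P σ₀ silent ⟨ l , reg , mem ⟩
  step-jump i = moves (fetch i)

  step-jumpIf : ∀ {r l} → at P pc ≡ just (jumpIf r l) → reg r ≢ 0 →
                Moves W P σ₀ silent ⟨ l , reg , mem ⟩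
  step-jumpIf {r} {l} i ne = moves (trans (fetch i) taken)
    where
    taken : exec W (jumpIf r l) σ₀ ≡ next silent ⟨ l , reg , mem ⟩
    taken with reg r
    ... | zero  = ⊥-elim (ne refl)
    ... | suc _ = refl

  step-fallthrough : ∀ {r l} → at P pc ≡ just (jumpIf r l) → reg r ≡ 0 →
                     Moves W P σ₀ silent ⟨ suc pc , reg , mem ⟩
  step-fallthrough {r} {l} i z = moves (trans (fetch i) notTaken)
    where
    notTaken : exec W (jumpIf r l) σ₀ ≡ next silent ⟨ suc pc , reg , mem ⟩
    notTaken rewrite z = refl

  step-print : ∀ {r x} → at P pc ≡ just (print r) → reg r ≡ x →
               Moves W P σ₀ (printed x) ⟨ suc pc , reg , mem ⟩
  step-print i refl = moves (fetch i)

  step-finish : at P pc ≡ just finish → Moves W P σ₀ finished ⟨ suc pc , reg , mem ⟩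
  step-finish i = moves (fetch i)

  step-halt : at P pc ≡ just halt → step W P σ₀ ≡ halted
  step-halt i = fetch i

-- Big-step semantics and correctness of the compiler.

module Semantics (base Bd : ℕ) (inp : ℕ → ℕ) where

  eval : Store → Exp → ℕ
  eval σ (! x)     = var σ x
  eval σ (lit n)   = n
  eval σ (e ⊕ f)   = eval σ e + eval σ f
  eval σ (e ⊖ f)   = eval σ e ∸ eval σ f
  eval σ (input e) = inp (eval σ e)
  eval σ (k ‹ e ›) = arr σ k (eval σ e)

  -- Every value of a safe expression is at most Bd in a store bounded by Bd.
  Safe : Store → Exp → Set
  Safe σ (! x)     = ⊤
  Safe σ (lit n)   = T (n ≤ᵇ 8)
  Safe σ (e ⊕ f)   = Safe σ e × Safe σ f × eval σ e + eval σ f ≤ Bd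
  Safe σ (e ⊖ f)   = Safe σ e × Safe σ f
  Safe σ (input e) = Safe σ e × eval σ e < base
  Safe σ (k ‹ e ›) = Safe σ e

  -- There is one event per executed instruction, so the length of the trace is the exact running
  -- time. Entering a body costs the guard and one jump, leaving costs two, and the extra silent
  -- event after the body of a loop is the jump back.
  data Exec : Cmd → Store → List Event → Store → Set where
    skip       : ∀ {σ} → Exec skip σ [] σ
    assigned   : ∀ {σ x e} → Safe σ e → Exec (x ← e) σ (silents (cost e + 1)) (setVar σ x (eval σ e))
    stored     : ∀ {σ k e f} → Safe σ e → Safe σ f →
                 Exec (k ‹ e ›← f) σ (silents (cost e + (6 + (cost f + 1)))) (setArr σ k (eval σ e) (eval σ f))
    _⨾_        : ∀ {σ σ′ σ″ c d es es′} → Exec c σ es σ′ → Exec d σ′ es′ σ″ → Exec (c ⨾ d) σ (es ++ es′) σ″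
    when-true  : ∀ {σ σ′ g c es} → Safe σ g → eval σ g ≢ 0 → Exec c σ es σ′ →
                 Exec (when g c) σ (silents (cost g + 1) ++ es) σ′
    when-false : ∀ {σ g c} → Safe σ g → eval σ g ≡ 0 → Exec (when g c) σ (silents (cost g + 2)) σ
    while-stop : ∀ {σ g c} → Safe σ g → eval σ g ≡ 0 → Exec (while g c) σ (silents (cost g + 2)) σ
    while-step : ∀ {σ σ′ σ″ g c es es′} → Safe σ g → eval σ g ≢ 0 → Exec c σ es σ′ →
                 Exec (while g c) σ′ es′ σ″ → Exec (while g c) σ ((silents (cost g + 1) ++ es ++ [ silent ]) ++ es′) σ″
    output     : ∀ {σ e} → Safe σ e → Exec (output e) σ (silents (cost e) ++ [ printed (eval σ e) ]) σ
    endOutput  : ∀ {σ} → Exec endOutput σ [ finished ] σ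

  -- Two bounds are kept apart: `Bd` limits the values of the program and `W` the machine words,
  -- which must also hold addresses. `big` covers the largest address, and `8≤Bd` covers the
  -- literals.
  module Correctness (W : ℕ) (inp≤Bd : ∀ i → inp i ≤ Bd) (8≤Bd : 8 ≤ Bd)
                     (big : octuple Bd + base + 8 ≤ W) (P : Program) where

    -- The input survives only below `base`, where no array cell lies. The bounds on values belong
    -- to the invariant because an assignment of a word above `W` is a fault.
    record Represents (σ : Store) (reg mem : ℕ → ℕ) : Set where
      field
        zero-reg  : reg 0 ≡ 0
        base-reg  : reg 1 ≡ base
        vars      : ∀ x → reg (varReg x) ≡ var σ x
        arrs      : ∀ k i → mem (cell base i k) ≡ arr σ k i
        inps      : ∀ i → i < base → mem i ≡ inp i
        var-bound : ∀ x → var σ x ≤ Bd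
        arr-bound : ∀ k i → arr σ k i ≤ Bd
    open Represents

    Bd≤octuple : ∀ n → n ≤ octuple n
    Bd≤octuple n = ≤-trans (m≤m+n n n) (≤-trans (m≤m+n _ _) (m≤m+n _ _))

    Bd≤W : Bd ≤ W
    Bd≤W = ≤-trans (Bd≤octuple Bd) (≤-trans (m≤m+n _ _) (≤-trans (m≤m+n _ _) big))

    -- Evaluation at depth `d` may overwrite the temporaries from depth `d` on and nothing else;
    -- this protects a left operand, or an address, while the next expression is evaluated.
    record Frame (d : ℕ) (reg reg′ : ℕ → ℕ) : Set where
      constructor frame
      field unchanged : ∀ r → (∀ j → d ≤ j → r ≢ tmpReg j) → reg′ r ≡ reg r
    open Frame

    frame-trans : ∀ {d r₁ r₂ r₃} → Frame d r₁ r₂ → Frame d r₂ r₃ → Frame d r₁ r₃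
    frame-trans (frame f) (frame g) = frame λ r p → trans (g r p) (f r p)

    frame-weaken : ∀ {d d′ r₁ r₂} → d ≤ d′ → Frame d′ r₁ r₂ → Frame d r₁ r₂
    frame-weaken d≤d′ (frame f) = frame λ r p → f r (λ j d′≤j → p j (≤-trans d≤d′ d′≤j))

    frame-set : ∀ {d reg} d′ x → d ≤ d′ → Frame d reg (reg [ tmpReg d′ ≔ x ])
    frame-set {reg = reg} d′ x d≤d′ = frame λ r p → upd-other reg x (p d′ d≤d′)

    frame-low : ∀ {d reg reg′ r} → Frame d reg reg′ → r ≤ 1 → reg′ r ≡ reg r
    frame-low {r = r} (frame f) r≤1 = f r λ { j _ refl → <⇒≱ (s≤s r≤1) (≤-trans (n≤1+n 2) (3≤tmpReg j)) }

    frame-tmp : ∀ {d reg reg′} → Frame (suc d) reg reg′ → reg′ (tmpReg d) ≡ reg (tmpReg d)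
    frame-tmp {d} (frame f) = f (tmpReg d) λ j d<j e → <⇒≢ d<j (tmpReg-injective d j e)

    represents-frame : ∀ {d σ reg reg′ mem} → Frame d reg reg′ → Represents σ reg mem → Represents σ reg′ mem
    represents-frame f R = record
      { zero-reg = trans (frame-low f z≤n) (zero-reg R)
      ; base-reg = trans (frame-low f (s≤s z≤n)) (base-reg R)
      ; vars = λ x → trans (unchanged f (varReg x) (λ j _ → varReg≢tmpReg x j)) (vars R x)
      ; arrs = arrs R ; inps = inps R ; var-bound = var-bound R ; arr-bound = arr-bound R }

    safe-bound : ∀ {σ reg mem} → Represents σ reg mem → ∀ e → Safe σ e → eval σ e ≤ Bd
    safe-bound R (! x)     _ = var-bound R x
    safe-bound R (lit n)   s = ≤-trans (≤ᵇ⇒≤ n 8 s) 8≤Bd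
    safe-bound R (e ⊕ f)   (_ , _ , le) = le
    safe-bound R (e ⊖ f)   (s , _) = ≤-trans (m∸n≤m _ (eval _ f)) (safe-bound R e s)
    safe-bound R (input e) _ = inp≤Bd _
    safe-bound R (k ‹ e ›) _ = arr-bound R k _

    Loaded : ℕ → ℕ → (reg mem : ℕ → ℕ) → ℕ → (ℕ → ℕ) → ℕ → List Event → Set
    Loaded pc d reg mem n reg′ pc′ es =
      Steps W P ⟨ pc , reg , mem ⟩ es ⟨ pc′ , reg′ , mem ⟩ × reg′ (tmpReg d) ≡ n × Frame d reg reg′

    octuple-mono : ∀ {m n} → m ≤ n → octuple m ≤ octuple n
    octuple-mono le = +-mono-≤ (+-mono-≤ (+-mono-≤ le le) (+-mono-≤ le le)) (+-mono-≤ (+-mono-≤ le le) (+-mono-≤ le le))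

    address-correct : ∀ {σ reg mem pc} d k i → Represents σ reg mem → i ≤ Bd → reg (tmpReg d) ≡ i →
      CodeAt P pc (address d k (tmpReg d)) →
      ∃ λ reg′ → Loaded pc d reg mem (cell base i k) reg′ (pc + 6) (silents 6)
    address-correct {σ} {reg} {mem} {pc} d k i R i≤Bd ri (c₁ , c₂ , c₃ , c₄ , c₅ , c₆ , _) = reg₆ , steps , upd-same reg₅ t _ , fr
      where
      t u : ℕ
      t = tmpReg d
      u = tmpReg (suc d)
      reg₁ reg₂ reg₃ reg₄ reg₅ reg₆ : ℕ → ℕ
      reg₁ = reg [ t ≔ i + i ]
      reg₂ = reg₁ [ t ≔ (i + i) + (i + i) ]
      reg₃ = reg₂ [ t ≔ octuple i ]
      reg₄ = reg₃ [ t ≔ octuple i + base ]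
      reg₅ = reg₄ [ u ≔ toℕ k ]
      reg₆ = reg₅ [ t ≔ cell base i k ]
      e₁ : reg₁ t ≡ i + i
      e₁ = upd-same reg t _
      e₂ : reg₂ t ≡ (i + i) + (i + i)
      e₂ = upd-same reg₁ t _
      e₃ : reg₃ t ≡ octuple i
      e₃ = upd-same reg₂ t _
      f₃ : Frame d reg reg₃
      f₃ = frame-trans (frame-set d _ ≤-refl) (frame-trans (frame-set d _ ≤-refl) (frame-set d _ ≤-refl))
      b₃ : reg₃ 1 ≡ base
      b₃ = trans (frame-low f₃ (s≤s z≤n)) (base-reg R)
      e₅ : reg₅ t ≡ octuple i + base
      e₅ = trans (frame-tmp {d} {reg₄} {reg₅} (frame-set (suc d) _ ≤-refl)) (upd-same reg₃ t _)
      fr : Frame d reg reg₆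
      fr = frame-trans f₃ (frame-trans (frame-set d _ ≤-refl) (frame-trans (frame-set (suc d) _ (n≤1+n d)) (frame-set d _ ≤-refl)))
      le : octuple i + base + toℕ k ≤ W
      le = ≤-trans (+-mono-≤ (+-monoˡ-≤ base (octuple-mono i≤Bd)) (<⇒≤ (Fin.toℕ<n k))) big
      le₄ : octuple i + base ≤ W
      le₄ = ≤-trans (m≤m+n _ _) le
      le₃ : octuple i ≤ W
      le₃ = ≤-trans (m≤m+n _ _) le₄
      le₂ : (i + i) + (i + i) ≤ W
      le₂ = ≤-trans (m≤m+n _ _) le₃
      le₁ : i + i ≤ W
      le₁ = ≤-trans (m≤m+n _ _) le₂
      steps : Steps W P ⟨ pc , reg , mem ⟩ (silents 6) ⟨ pc + 6 , reg₆ , mem ⟩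
      steps = retarget refl (+-comm 6 pc)
        (    step-add c₁ (cong₂ _+_ ri ri) le₁
        then step-add c₂ (cong₂ _+_ e₁ e₁) le₂
        then step-add c₃ (cong₂ _+_ e₂ e₂) le₃
        then step-add c₄ (cong₂ _+_ e₃ b₃) le₄
        then step-const c₅ (≤-trans (m≤n+m (toℕ k) _) le)
        then step-add c₆ (cong₂ _+_ e₅ (upd-same reg₄ u _)) le
        then done)

    exp-correct : ∀ {σ reg mem pc} e d → Represents σ reg mem → Safe σ e → CodeAt P pc (compileExp e d) →
      ∃ λ reg′ → Loaded pc d reg mem (eval σ e) reg′ (pc + cost e) (silents (cost e))

    operands-correct : ∀ {σ reg mem pc is} e f d → Represents σ reg mem → Safe σ e → Safe σ f →
        CodeAt P pc (compileExp e d ++ compileExp f (suc d) ++ is) →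
        ∃ λ reg′ → Loaded pc d reg mem (eval σ e) reg′ (pc + cost e + cost f) (silents (cost e + cost f))
                   × reg′ (tmpReg (suc d)) ≡ eval σ f × CodeAt P (pc + cost e + cost f) is
    operands-correct {pc = pc} e f d R se sf code
      with codeAt-++ P pc (compileExp e d) (length-compileExp e d) code
    ... | code₁ , code₂₃ with codeAt-++ P _ (compileExp f (suc d)) (length-compileExp f (suc d)) code₂₃
    ... | code₂ , code₃ with exp-correct e d R se code₁
    ... | reg₁ , s₁ , v₁ , f₁ with exp-correct f (suc d) (represents-frame f₁ R) sf code₂
    ... | reg₂ , s₂ , v₂ , f₂ =
      reg₂ ,
      (retarget (silents-+ (cost e)) refl (s₁ followedBy s₂)
        , trans (frame-tmp f₂) v₁ , frame-trans f₁ (frame-weaken (n≤1+n d) f₂)) ,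
      v₂ , code₃

    finishing : ∀ {pc d reg mem n x reg₁ pc₁} c → Loaded pc d reg mem x reg₁ pc₁ (silents c) → pc₁ ≡ pc + c →
        Moves W P ⟨ pc₁ , reg₁ , mem ⟩ silent ⟨ suc pc₁ , reg₁ [ tmpReg d ≔ n ] , mem ⟩ →
        ∃ λ reg′ → Loaded pc d reg mem n reg′ (pc + (c + 1)) (silents (c + 1))
    finishing {pc} {d} {reg₁ = reg₁} c (s , _ , f) refl st =
        _ , retarget (silents-+ c) (trans (+-comm 1 (pc + c)) (+-assoc pc c 1)) (s followedBy st then done)
          , upd-same reg₁ (tmpReg d) _ , frame-trans f (frame-set d _ ≤-refl)

    regroup : ∀ {pc d reg mem n} a b c → (∃ λ reg′ → Loaded pc d reg mem n reg′ (pc + (a + b + c)) (silents (a + b + c))) →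
              ∃ λ reg′ → Loaded pc d reg mem n reg′ (pc + (a + (b + c))) (silents (a + (b + c)))
    regroup a b c p rewrite +-assoc a b c = p

    exp-correct {reg = reg} {pc = pc} (! x) d R s (c , _) =
      _ , retarget refl (+-comm 1 pc) (step-sub c (cong₂ _∸_ (vars R x) (zero-reg R)) (≤-trans (var-bound R x) Bd≤W) then done)
        , upd-same reg (tmpReg d) _ , frame-set d _ ≤-refl
    exp-correct {reg = reg} {pc = pc} (lit n) d R s (c , _) =
      _ , retarget refl (+-comm 1 pc) (step-const c (≤-trans (safe-bound R (lit n) s) Bd≤W) then done)
        , upd-same reg (tmpReg d) _ , frame-set d _ ≤-refl
    exp-correct {pc = pc} (e ⊕ f) d R s@(se , sf , le) code with operands-correct e f d R se sf code
    ... | reg₁ , L@(_ , v₁ , _) , v₂ , c , _ =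
      regroup (cost e) (cost f) 1 (finishing _ L (+-assoc pc _ _)
        (step-add c (cong₂ _+_ v₁ v₂) (≤-trans le Bd≤W)))
    exp-correct {pc = pc} (e ⊖ f) d R s@(se , sf) code with operands-correct e f d R se sf code
    ... | reg₁ , L@(_ , v₁ , _) , v₂ , c , _ =
      regroup (cost e) (cost f) 1 (finishing _ L (+-assoc pc _ _)
        (step-sub c (cong₂ _∸_ v₁ v₂) (≤-trans (safe-bound R (e ⊖ f) s) Bd≤W)))
    exp-correct {mem = mem} {pc = pc} (input e) d R s@(se , lt) code
      with codeAt-++ P pc (compileExp e d) (length-compileExp e d) code
    ... | code₁ , (c , _) with exp-correct e d R se code₁
    ... | reg₁ , L@(_ , v₁ , _) =
      finishing _ L refl (step-load c (trans (cong mem v₁) (inps R _ lt)) (≤-trans (safe-bound R (input e) s) Bd≤W))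
    exp-correct {mem = mem} {pc = pc} (k ‹ e ›) d R s code
      with codeAt-++ P pc (compileExp e d) (length-compileExp e d) code
    ... | code₁ , code₂₃ with codeAt-++ P _ (address d k (tmpReg d)) refl code₂₃
    ... | code₂ , (c , _) with exp-correct e d R s code₁
    ... | reg₁ , s₁ , v₁ , f₁ with address-correct d k _ (represents-frame f₁ R) (safe-bound R e s) v₁ code₂
    ... | reg₂ , s₂ , v₂ , f₂ =
      regroup (cost e) 6 1 (finishing _
        (retarget (silents-+ (cost e)) refl (s₁ followedBy s₂) , v₂ , frame-trans f₁ f₂) (+-assoc pc _ 6)
        (step-load c (trans (cong mem v₂) (arrs R k _)) (≤-trans (safe-bound R (k ‹ e ›) s) Bd≤W)))

    represents-setVar : ∀ {σ reg mem n} x → n ≤ Bd → Represents σ reg mem →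
      Represents (setVar σ x n) (reg [ varReg x ≔ n ]) mem
    represents-setVar {σ} {reg} {mem} {n} x n≤Bd R = record
      { zero-reg = trans (upd-other reg n (<⇒≢ (≤-trans (n≤1+n 1) (2≤varReg x)))) (zero-reg R)
      ; base-reg = trans (upd-other reg n (<⇒≢ (2≤varReg x))) (base-reg R)
      ; vars = vars′ ; arrs = arrs R ; inps = inps R ; var-bound = bound ; arr-bound = arr-bound R }
      where
      vars′ : ∀ y → (reg [ varReg x ≔ n ]) (varReg y) ≡ (var σ [ x ≔ n ]) y
      vars′ y with y ≟ x
      ... | yes refl = trans (upd-same reg _ n) (sym (upd-same (var σ) x n))
      ... | no y≢x   = trans (upd-other reg n (y≢x ∘ varReg-injective y x)) (trans (vars R y) (sym (upd-other (var σ) n y≢x)))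
      bound : ∀ y → (var σ [ x ≔ n ]) y ≤ Bd
      bound y with y ≟ x
      ... | yes refl = subst (_≤ Bd) (sym (upd-same (var σ) x n)) n≤Bd
      ... | no y≢x   = subst (_≤ Bd) (sym (upd-other (var σ) n y≢x)) (var-bound R y)

    represents-setArr : ∀ {σ reg mem n} k i → n ≤ Bd → Represents σ reg mem →
      Represents (setArr σ k i n) reg (mem [ cell base i k ≔ n ])
    represents-setArr {σ} {reg} {mem} {n} k i n≤Bd R = record
      { zero-reg = zero-reg R ; base-reg = base-reg R ; vars = vars R ; arrs = arrs′ ; inps = inps′
      ; var-bound = var-bound R ; arr-bound = bound }
      where
      arrs′ : ∀ l j → (mem [ cell base i k ≔ n ]) (cell base j l) ≡ arr (setArr σ k i n) l j
      arrs′ l j with l Fin.≟ k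
      ... | no l≢k = trans (upd-other mem n (l≢k ∘ proj₂ ∘ cell-injective base j l i k)) (arrs R l j)
      ... | yes refl with j ≟ i
      ...   | yes refl = trans (upd-same mem _ n) (sym (upd-same (arr σ k) i n))
      ...   | no j≢i = trans (upd-other mem n (j≢i ∘ proj₁ ∘ cell-injective base j l i k))
                             (trans (arrs R l j) (sym (upd-other (arr σ k) n j≢i)))
      inps′ : ∀ j → j < base → (mem [ cell base i k ≔ n ]) j ≡ inp j
      inps′ j j<base = trans (upd-other mem n (<⇒≢ (<-≤-trans j<base (≤-trans (m≤n+m base (octuple i)) (m≤m+n (octuple i + base) (toℕ k)))))) (inps R j j<base)
      bound : ∀ l j → arr (setArr σ k i n) l j ≤ Bd
      bound l j with l Fin.≟ k
      ... | no _ = arr-bound R l j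
      ... | yes refl with j ≟ i
      ...   | yes refl = subst (_≤ Bd) (sym (upd-same (arr σ k) i n)) n≤Bd
      ...   | no j≢i = subst (_≤ Bd) (sym (upd-other (arr σ k) n j≢i)) (arr-bound R l j)

    Simulates : ℕ → (reg mem : ℕ → ℕ) → List Event → ℕ → Store → Set
    Simulates pc reg mem es pc′ σ′ = ∃₂ λ reg′ mem′ →
      Steps W P ⟨ pc , reg , mem ⟩ es ⟨ pc′ , reg′ , mem′ ⟩ × Represents σ′ reg′ mem′

    guard-true : ∀ {σ reg mem pc is l} g → Represents σ reg mem → Safe σ g → eval σ g ≢ 0 →
      CodeAt P pc (compileExp g 0 ++ jumpIf (tmpReg 0) l ∷ is) →
      Simulates pc reg mem (silents (cost g + 1)) l σ × CodeAt P (suc (pc + cost g)) is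
    guard-true {pc = pc} g R sg ne code with codeAt-++ P pc (compileExp g 0) (length-compileExp g 0) code
    ... | code₁ , (c , rest) with exp-correct g 0 R sg code₁
    ... | reg₁ , s₁ , v₁ , f₁ =
      (reg₁ , _ , retarget (silents-+ (cost g)) refl (s₁ followedBy step-jumpIf c (λ z → ne (trans (sym v₁) z)) then done)
            , represents-frame f₁ R) , rest

    guard-false : ∀ {σ reg mem pc is l l′} g → Represents σ reg mem → Safe σ g → eval σ g ≡ 0 →
      CodeAt P pc (compileExp g 0 ++ jumpIf (tmpReg 0) l ∷ jump l′ ∷ is) →
      Simulates pc reg mem (silents (cost g + 2)) l′ σ
    guard-false {pc = pc} g R sg z code with codeAt-++ P pc (compileExp g 0) (length-compileExp g 0) code
    ... | code₁ , (c , c′ , _) with exp-correct g 0 R sg code₁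
    ... | reg₁ , s₁ , v₁ , f₁ =
      reg₁ , _ , retarget (silents-+ (cost g)) refl (s₁ followedBy step-fallthrough c (trans v₁ z) then step-jump c′ then done)
           , represents-frame f₁ R

    +-assoc-4 : ∀ a b c d → a + b + c + d ≡ a + (b + (c + d))
    +-assoc-4 a b c d = trans (+-assoc (a + b) c d) (+-assoc a b (c + d))

    -- Induction on the execution and not on the command, so that an iteration of a loop appeals to
    -- the shorter execution of the same loop at the same place in the code.
    correct : ∀ {c σ es σ′ reg mem pc} → Exec c σ es σ′ → CodeAt P pc (compile pc c) → Represents σ reg mem →
              Simulates pc reg mem es (pc + codeSize c) σ′
    correct {pc = pc} skip _ R = _ , _ , retarget refl (sym (+-identityʳ pc)) done , R
    correct {pc = pc} (assigned {x = x} {e} s) code R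
      with codeAt-++ P pc (compileExp e 0) (length-compileExp e 0) code
    ... | code₁ , (c , _) with exp-correct e 0 R s code₁
    ... | reg₁ , s₁ , v₁ , f₁ = _ , _ ,
      retarget (silents-+ (cost e)) (trans (+-comm 1 _) (+-assoc pc _ 1))
        (s₁ followedBy step-sub c (cong₂ _∸_ v₁ (zero-reg R₁)) (≤-trans le Bd≤W) then done) ,
      represents-setVar x le R₁
      where
      R₁ = represents-frame f₁ R
      le = safe-bound R e s
    correct {σ = σ} {mem = mem} {pc = pc} (stored {k = k} {e} {f} se sf) code R
      with codeAt-++ P pc (compileExp e 0) (length-compileExp e 0) code
    ... | code₁ , code₂₃₄ with codeAt-++ P _ (address 0 k (tmpReg 0)) refl code₂₃₄
    ... | code₂ , code₃₄ with codeAt-++ P _ (compileExp f 1) (length-compileExp f 1) code₃₄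
    ... | code₃ , (c , _) with exp-correct e 0 R se code₁
    ... | reg₁ , s₁ , v₁ , f₁ with address-correct 0 k _ (represents-frame f₁ R) (safe-bound R e se) v₁ code₂
    ... | reg₂ , s₂ , v₂ , f₂ with exp-correct f 1 (represents-frame (frame-trans f₁ f₂) R) sf code₃
    ... | reg₃ , s₃ , v₃ , f₃ = _ , _ ,
      retarget (trans (cong (silents (cost e) ++_) (trans (cong (silents 6 ++_) (silents-+ (cost f))) (silents-+ 6 {cost f + 1}))) (silents-+ (cost e)))
        (trans (+-comm 1 _) (trans (+-assoc-4 (pc + cost e) 6 (cost f) 1) (+-assoc pc _ _)))
        (s₁ followedBy s₂ followedBy s₃ followedBy step-store c then done) ,
      subst₂ (λ a x → Represents (setArr σ k (eval σ e) (eval σ f)) reg₃ (mem [ a ≔ x ]))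
        (sym (trans (frame-tmp f₃) v₂)) (sym v₃)
        (represents-setArr k (eval σ e) (safe-bound R f sf) (represents-frame (frame-trans f₁ (frame-trans f₂ (frame-weaken z≤n f₃))) R))
    correct {pc = pc} (_⨾_ {c = c} {d} x y) code R
      with codeAt-++ P pc (compile pc c) (length-compile pc c) code
    ... | code₁ , code₂ with correct x code₁ R
    ... | _ , _ , s₁ , R₁ with correct y code₂ R₁
    ... | _ , _ , s₂ , R₂ = _ , _ , retarget refl (+-assoc pc _ _) (s₁ followedBy s₂) , R₂
    correct {pc = pc} (when-true {g = g} {c} sg ne x) code R with guard-true g R sg ne code
    ... | (_ , _ , s₁ , R₁) , (_ , rest)
      with correct x (subst (λ n → CodeAt P n (compile (pc + cost g + 2) c)) (+-comm 2 _) rest) R₁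
    ... | _ , _ , s₂ , R₂ = _ , _ , retarget refl (+-assoc-4 pc (cost g) 2 _) (s₁ followedBy s₂) , R₂
    correct {pc = pc} (when-false {g = g} sg z) code R with guard-false g R sg z code
    ... | _ , _ , s , R₁ = _ , _ , retarget refl (+-assoc-4 pc (cost g) 2 _) s , R₁
    correct {pc = pc} (while-stop {g = g} {c} sg z) code R with guard-false g R sg z code
    ... | _ , _ , s , R₁ = _ , _ , retarget refl
      (trans (cong (_+ 1) (+-assoc-4 pc (cost g) 2 (codeSize c))) (trans (+-assoc pc _ 1) (cong (pc +_)
        (trans (+-assoc (cost g) _ 1) (cong (cost g +_) (+-assoc 2 (codeSize c) 1)))))) s , R₁
    correct {pc = pc} (while-step {g = g} {c} sg ne x y) code R with guard-true g R sg ne code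
    ... | (_ , _ , s₁ , R₁) , (_ , rest)
      with codeAt-++ P _ (compile (pc + cost g + 2) c) (length-compile _ c)
             (subst (λ n → CodeAt P n (compile (pc + cost g + 2) c ++ [ jump pc ])) (+-comm 2 _) rest)
    ... | code₂ , (j , _) with correct x code₂ R₁
    ... | _ , _ , s₂ , R₂ with correct y code R₂
    ... | _ , _ , s₃ , R₃ = _ , _ , (s₁ followedBy s₂ followedBy step-jump j then done) followedBy s₃ , R₃
    correct {pc = pc} (output {e = e} s) code R with codeAt-++ P pc (compileExp e 0) (length-compileExp e 0) code
    ... | code₁ , (c , _) with exp-correct e 0 R s code₁
    ... | reg₁ , s₁ , v₁ , f₁ = _ , _ ,
      retarget refl (trans (+-comm 1 _) (+-assoc pc _ 1)) (s₁ followedBy step-print c v₁ then done) , represents-frame f₁ R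
    correct {pc = pc} endOutput (c , _) R = _ , _ , retarget refl (+-comm 1 pc) (step-finish c then done) , R

-- An inequality that is a nonnegative combination of hypotheses is checked by
-- comparing coefficients.

infixl 6 _∔_
infixl 7 _·_
data Lin : Set where
  #    : ℕ → Lin
  κ  : ℕ → Lin
  _∔_ : Lin → Lin → Lin
  _·_ : ℕ → Lin → Lin

lookup₀ : List ℕ → ℕ → ℕ
lookup₀ []       _       = 0
lookup₀ (x ∷ xs) zero    = x
lookup₀ (x ∷ xs) (suc i) = lookup₀ xs i

⟦_⟧ : Lin → List ℕ → ℕ
⟦ # i ⟧    ρ = lookup₀ ρ i
⟦ κ n ⟧  ρ = n
⟦ a ∔ b ⟧ ρ = ⟦ a ⟧ ρ + ⟦ b ⟧ ρ
⟦ n · a ⟧ ρ = n * ⟦ a ⟧ ρ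

dot : List ℕ → List ℕ → ℕ
dot (c ∷ cs) (x ∷ xs) = c * x + dot cs xs
dot _        _        = 0

unit : ℕ → List ℕ
unit zero    = [ 1 ]
unit (suc i) = 0 ∷ unit i

addCoeffs : List ℕ → List ℕ → List ℕ
addCoeffs []       ds       = ds
addCoeffs (c ∷ cs) []       = c ∷ cs
addCoeffs (c ∷ cs) (d ∷ ds) = c + d ∷ addCoeffs cs ds

scaleCoeffs : ℕ → List ℕ → List ℕ
scaleCoeffs n []       = []
scaleCoeffs n (c ∷ cs) = n * c ∷ scaleCoeffs n cs

-- The constant term comes first and is evaluated by putting 1 in front of the valuation.
coeffs : Lin → List ℕ
coeffs (# i)    = 0 ∷ unit i
coeffs (κ n)  = [ n ]
coeffs (a ∔ b) = addCoeffs (coeffs a) (coeffs b)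
coeffs (n · a) = scaleCoeffs n (coeffs a)

dot-unit : ∀ i ρ → dot (unit i) ρ ≡ lookup₀ ρ i
dot-unit zero    []      = refl
dot-unit zero    (x ∷ ρ) = trans (+-identityʳ (x + 0)) (+-identityʳ x)
dot-unit (suc i) []      = refl
dot-unit (suc i) (x ∷ ρ) = dot-unit i ρ

dot-add : ∀ cs ds ρ → dot (addCoeffs cs ds) ρ ≡ dot cs ρ + dot ds ρ
dot-add []       ds       ρ       = refl
dot-add (c ∷ cs) []       ρ       = sym (+-identityʳ _)
dot-add (c ∷ cs) (d ∷ ds) []      = refl
dot-add (c ∷ cs) (d ∷ ds) (x ∷ ρ) rewrite dot-add cs ds ρ =
  solve 5 (λ c d x p q → (c :+ d) :* x :+ (p :+ q) := (c :* x :+ p) :+ (d :* x :+ q)) refl c d x (dot cs ρ) (dot ds ρ)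
  where open +-*-Solver using (solve; _:=_; _:+_; _:*_)

dot-scale : ∀ n cs ρ → dot (scaleCoeffs n cs) ρ ≡ n * dot cs ρ
dot-scale n []       ρ       = sym (*-zeroʳ n)
dot-scale n (c ∷ cs) []      = sym (*-zeroʳ n)
dot-scale n (c ∷ cs) (x ∷ ρ) rewrite dot-scale n cs ρ =
  trans (cong (_+ n * dot cs ρ) (*-assoc n c x)) (sym (*-distribˡ-+ n (c * x) (dot cs ρ)))

coeffs-correct : ∀ a ρ → dot (coeffs a) (1 ∷ ρ) ≡ ⟦ a ⟧ ρ
coeffs-correct (# i)    ρ = dot-unit i ρ
coeffs-correct (κ n)  ρ = trans (+-identityʳ (n * 1)) (*-identityʳ n)
coeffs-correct (a ∔ b) ρ = trans (dot-add (coeffs a) (coeffs b) (1 ∷ ρ)) (cong₂ _+_ (coeffs-correct a ρ) (coeffs-correct b ρ))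
coeffs-correct (n · a) ρ = trans (dot-scale n (coeffs a) (1 ∷ ρ)) (cong (n *_) (coeffs-correct a ρ))

dominated : List ℕ → List ℕ → Bool
dominated []       ds       = true
dominated (c ∷ cs) []       = (c ≤ᵇ 0) ∧ dominated cs []
dominated (c ∷ cs) (d ∷ ds) = (c ≤ᵇ d) ∧ dominated cs ds

T-∧ : ∀ {a b} → T (a ∧ b) → T a × T b
T-∧ {true} t = _ , t

dominated-sound : ∀ cs ds ρ → T (dominated cs ds) → dot cs ρ ≤ dot ds ρ
dominated-sound []       ds       ρ       _ = z≤n
dominated-sound (c ∷ cs) ds       []      _ = z≤n
dominated-sound (c ∷ cs) []       (x ∷ ρ) t with T-∧ t
... | tc , ts with ≤ᵇ⇒≤ c 0 tc
... | z≤n = dominated-sound cs [] ρ ts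
dominated-sound (c ∷ cs) (d ∷ ds) (x ∷ ρ) t with T-∧ t
... | tc , ts = +-mono-≤ (*-monoˡ-≤ x (≤ᵇ⇒≤ c d tc)) (dominated-sound cs ds ρ ts)

data Hypotheses (ρ : List ℕ) : Set where
  none : Hypotheses ρ
  hyp  : (n : ℕ) (l r : Lin) → ⟦ l ⟧ ρ ≤ ⟦ r ⟧ ρ → Hypotheses ρ → Hypotheses ρ

lefts rights : ∀ {ρ} → Hypotheses ρ → Lin
lefts  none = κ 0
lefts  (hyp n l r _ hs) = n · l ∔ lefts hs
rights none = κ 0
rights (hyp n l r _ hs) = n · r ∔ rights hs

lefts≤rights : ∀ {ρ} (hs : Hypotheses ρ) → ⟦ lefts hs ⟧ ρ ≤ ⟦ rights hs ⟧ ρ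
lefts≤rights none             = z≤n
lefts≤rights (hyp n l r h hs) = +-mono-≤ (*-monoʳ-≤ n h) (lefts≤rights hs)

abstract
  -- Let `L ≤ R` be the weighted sum of the hypotheses. If `a + R ≤ b + L` holds coefficient by
  -- coefficient, then `a + R ≤ b + R`, and `R` cancels. Products of variables are passed in `ρ` as
  -- atoms; the comparison is an implicit argument settled by evaluation.
  linear : ∀ ρ (hs : Hypotheses ρ) a b → {_ : T (dominated (coeffs (a ∔ rights hs)) (coeffs (b ∔ lefts hs)))} →
           ⟦ a ⟧ ρ ≤ ⟦ b ⟧ ρ
  linear ρ hs a b {t} = +-cancelʳ-≤ (⟦ rights hs ⟧ ρ) _ _ (begin
    ⟦ a ∔ rights hs ⟧ ρ               ≡⟨ coeffs-correct (a ∔ rights hs) ρ ⟨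
    dot (coeffs (a ∔ rights hs)) (1 ∷ ρ) ≤⟨ dominated-sound (coeffs (a ∔ rights hs)) (coeffs (b ∔ lefts hs)) (1 ∷ ρ) t ⟩
    dot (coeffs (b ∔ lefts hs)) (1 ∷ ρ)  ≡⟨ coeffs-correct (b ∔ lefts hs) ρ ⟩
    ⟦ b ∔ lefts hs ⟧ ρ                ≤⟨ +-monoʳ-≤ (⟦ b ⟧ ρ) (lefts≤rights hs) ⟩
    ⟦ b ⟧ ρ + ⟦ rights hs ⟧ ρ           ∎)
    where open ≤-Reasoning

-- Frame rules and executions without output.

writesVar : Cmd → ℕ → Bool
writesVar skip         y = false
writesVar (x ← e)      y = y ≡ᵇ x
writesVar (k ‹ e ›← f) y = false
writesVar (c ⨾ d)      y = writesVar c y ∨ writesVar d y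
writesVar (when g c)   y = writesVar c y
writesVar (while g c)  y = writesVar c y
writesVar (output e)   y = false
writesVar endOutput    y = false

writesArr : Cmd → Array → Bool
writesArr skip         l = false
writesArr (x ← e)      l = false
writesArr (k ‹ e ›← f) l = does (l Fin.≟ k)
writesArr (c ⨾ d)      l = writesArr c l ∨ writesArr d l
writesArr (when g c)   l = writesArr c l
writesArr (while g c)  l = writesArr c l
writesArr (output e)   l = false
writesArr endOutput    l = false

not-∨ : ∀ {a b} → T (not (a ∨ b)) → T (not a) × T (not b)
not-∨ {false} t = _ , t

module Hoare (base Bd : ℕ) (inp : ℕ → ℕ) where
  open Semantics base Bd inp public

  var-kept : ∀ {c σ es σ′} → Exec c σ es σ′ → ∀ y → T (not (writesVar c y)) → var σ′ y ≡ var σ y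
  var-kept skip y _ = refl
  var-kept {σ = σ} (assigned {x = x} {e} _) y t = cong (λ b → if b then eval σ e else var σ y) (not-true t)
    where
    not-true : ∀ {b} → T (not b) → b ≡ false
    not-true {false} _ = refl
  var-kept (stored _ _) y _ = refl
  var-kept (_⨾_ {c = c} p q) y t with not-∨ {writesVar c y} t
  ... | t₁ , t₂ = trans (var-kept q y t₂) (var-kept p y t₁)
  var-kept (when-true _ _ p) y t = var-kept p y t
  var-kept (when-false _ _) y _ = refl
  var-kept (while-stop _ _) y _ = refl
  var-kept (while-step _ _ p q) y t = trans (var-kept q y t) (var-kept p y t)
  var-kept (output _) y _ = refl
  var-kept endOutput y _ = refl

  arr-kept : ∀ {c σ es σ′} → Exec c σ es σ′ → ∀ l → T (not (writesArr c l)) → arr σ′ l ≡ arr σ l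
  arr-kept skip l _ = refl
  arr-kept (assigned _) l _ = refl
  arr-kept {σ = σ} (stored {k = k} {e} {f} _ _) l t =
    cong (λ b → if b then arr σ k [ eval σ e ≔ eval σ f ] else arr σ l) (not-true t)
    where
    not-true : ∀ {b} → T (not b) → b ≡ false
    not-true {false} _ = refl
  arr-kept (_⨾_ {c = c} p q) l t with not-∨ {writesArr c l} t
  ... | t₁ , t₂ = trans (arr-kept q l t₂) (arr-kept p l t₁)
  arr-kept (when-true _ _ p) l t = arr-kept p l t
  arr-kept (when-false _ _) l _ = refl
  arr-kept (while-stop _ _) l _ = refl
  arr-kept (while-step _ _ p q) l t = trans (arr-kept q l t) (arr-kept p l t)
  arr-kept (output _) l _ = refl
  arr-kept endOutput l _ = refl

  record Silently (c : Cmd) (σ : Store) (t : ℕ) (σ′ : Store) : Set where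
    constructor silently
    field execution : Exec c σ (silents t) σ′
  open Silently public

  -- The side condition is a syntactic test that evaluates to true for concrete commands, so uses of
  -- the frame rule need no proof of it.
  kept : ∀ {c σ t σ′} → Silently c σ t σ′ → ∀ y {_ : T (not (writesVar c y))} → var σ′ y ≡ var σ y
  kept (silently p) y {t} = var-kept p y t

  keptArr : ∀ {c σ t σ′} → Silently c σ t σ′ → ∀ l {_ : T (not (writesArr c l))} → arr σ′ l ≡ arr σ l
  keptArr (silently p) l {t} = arr-kept p l t

  exact : ∀ {c σ es es′ σ′} → es ≡ es′ → Exec c σ es σ′ → Exec c σ es′ σ′
  exact refl p = p

  assign-s : ∀ {σ x e} → Safe σ e → Silently (x ← e) σ (cost e + 1) (setVar σ x (eval σ e))
  assign-s s = silently (assigned s)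

  store-s : ∀ {σ k e f} → Safe σ e → Safe σ f →
            Silently (k ‹ e ›← f) σ (cost e + (6 + (cost f + 1))) (setArr σ k (eval σ e) (eval σ f))
  store-s s s′ = silently (stored s s′)

  infixr 4 _⨾ₛ_
  _⨾ₛ_ : ∀ {c d σ σ′ σ″ t t′} → Silently c σ t σ′ → Silently d σ′ t′ σ″ → Silently (c ⨾ d) σ (t + t′) σ″
  _⨾ₛ_ {t = t} (silently p) (silently q) = silently (exact (silents-+ t) (p ⨾ q))

  when-s : ∀ {g c σ σ′ t} → Safe σ g → eval σ g ≢ 0 → Silently c σ t σ′ → Silently (when g c) σ (cost g + 1 + t) σ′
  when-s {g} s ne (silently p) = silently (exact (silents-+ (cost g + 1)) (when-true s ne p))

  unless-s : ∀ {g c σ} → Safe σ g → eval σ g ≡ 0 → Silently (when g c) σ (cost g + 2) σ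
  unless-s s z = silently (when-false s z)

  stop-s : ∀ {g c σ} → Safe σ g → eval σ g ≡ 0 → Silently (while g c) σ (cost g + 2) σ
  stop-s s z = silently (while-stop s z)

  loop-s : ∀ {g c σ σ′ σ″ t t′} → Safe σ g → eval σ g ≢ 0 → Silently c σ t σ′ → Silently (while g c) σ′ t′ σ″ →
           Silently (while g c) σ (cost g + 2 + t + t′) σ″
  loop-s {g} {t = t} {t′} s ne (silently p) (silently q) = silently (exact eq (while-step s ne p q))
    where
    open ≡-Reasoning
    eq : (silents (cost g + 1) ++ silents t ++ silents 1) ++ silents t′ ≡ silents (cost g + 2 + t + t′)
    eq = begin
      (silents (cost g + 1) ++ silents t ++ silents 1) ++ silents t′
        ≡⟨ cong (λ e → (silents (cost g + 1) ++ e) ++ silents t′) (silents-+ t) ⟩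
      (silents (cost g + 1) ++ silents (t + 1)) ++ silents t′
        ≡⟨ cong (_++ silents t′) (silents-+ (cost g + 1)) ⟩
      silents (cost g + 1 + (t + 1)) ++ silents t′
        ≡⟨ silents-+ (cost g + 1 + (t + 1)) ⟩
      silents (cost g + 1 + (t + 1) + t′)
        ≡⟨ cong silents (solve 3 (λ g t t′ → g :+ con 1 :+ (t :+ con 1) :+ t′ := g :+ con 2 :+ t :+ t′) refl (cost g) t t′) ⟩
      silents (cost g + 2 + t + t′) ∎
      where open +-*-Solver using (solve; _:=_; _:+_; con)

-- Chordless paths

total : {A : Set} → (A → ℕ) → List A → ℕ
total w xs = sum (map w xs)

total-++ : ∀ {A : Set} (w : A → ℕ) xs ys → total w (xs ++ ys) ≡ total w xs + total w ys
total-++ w xs ys = trans (cong sum (map-++ w xs ys)) (sum-++ (map w xs) (map w ys))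

-- Each element of `xs` is cancelled against one occurrence in `ys`. With weight 1 this is the
-- pigeonhole principle; with one plus the degree it turns distinctness of processed vertices into a
-- linear time bound.
total-⊆ : ∀ {A : Set} (w : A → ℕ) {xs ys} → Unique xs → (∀ {x} → x ∈ xs → x ∈ ys) → total w xs ≤ total w ys
total-⊆ w []        _ = z≤n
total-⊆ w {x ∷ xs} (x∉ ∷ u) ⊆ys with ∈-∃++ (⊆ys (here refl))
... | as , bs , refl = begin
  w x + total w xs             ≤⟨ +-monoʳ-≤ (w x) (total-⊆ w u xs⊆) ⟩
  w x + total w (as ++ bs)     ≡⟨ cong (w x +_) (total-++ w as bs) ⟩
  w x + (total w as + total w bs) ≡⟨ +-assoc (w x) _ _ ⟨
  w x + total w as + total w bs   ≡⟨ cong (_+ total w bs) (+-comm (w x) _) ⟩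
  total w as + w x + total w bs   ≡⟨ +-assoc (total w as) _ _ ⟩
  total w as + (w x + total w bs) ≡⟨ total-++ w as (x ∷ bs) ⟨
  total w (as ++ x ∷ bs)       ∎
  where
  open ≤-Reasoning
  xs⊆ : ∀ {y} → y ∈ xs → y ∈ as ++ bs
  xs⊆ y∈ with ∈-++⁻ as (⊆ys (there y∈))
  ... | inj₁ p = ∈-++⁺ˡ p
  ... | inj₂ (here refl) = ⊥-elim (All.lookup x∉ y∈ refl)
  ... | inj₂ (there p) = ∈-++⁺ʳ as p

total-1 : {A : Set} (xs : List A) → total (λ _ → 1) xs ≡ length xs
total-1 []       = refl
total-1 (x ∷ xs) = cong suc (total-1 xs)

unique-length : ∀ {n} {xs : List (Fin n)} → Unique xs → length xs ≤ n
unique-length {n} {xs} u = subst₂ _≤_ (total-1 xs) (trans (total-1 (allFin n)) (length-tabulate {n = n} (λ i → i)))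
  (total-⊆ (λ _ → 1) u (λ {x} _ → ∈-allFin x))

module ChordlessPaths (G : Graph) (s t : Vertex G) where
  open Graph G using (_~_; ~-sym; ~-irrefl; _~?_)

  V : Set
  V = Vertex G

  Apart : V → V → Set
  Apart u v = u ≢ v × ¬ u ~ v

  -- Such paths grow at the front, as chains of parents in a search from `t` do. `Apart` includes
  -- inequality, so distinctness is built in.
  data ChordlessTo : List V → Set where
    [t]  : ChordlessTo (t ∷ [])
    prepend : ∀ {v u c} → v ~ u → All (Apart v) c → ChordlessTo (u ∷ c) → ChordlessTo (v ∷ u ∷ c)

  ∉-head : ∀ {v u c} → ChordlessTo (v ∷ u ∷ c) → v ∉ u ∷ c
  ∉-head (prepend v~u ap _) (here refl) = ~-irrefl refl v~u
  ∉-head (prepend v~u ap _) (there v∈)  = proj₁ (All.lookup ap v∈) refl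

  ends-at-t : ∀ {v c} → ChordlessTo (v ∷ c) → t ∈ v ∷ c
  ends-at-t [t] = here refl
  ends-at-t (prepend _ _ p) = there (ends-at-t p)

  not-t : ∀ {v u c} → ChordlessTo (v ∷ u ∷ c) → v ≢ t
  not-t p@(prepend _ _ q) refl = ∉-head p (ends-at-t q)

  unique : ∀ {p} → ChordlessTo p → Unique p
  unique [t] = [] ∷ []
  unique p@(prepend {v = v} _ _ q) = All.tabulate (λ {w} w∈ v≡w → ∉-head p (subst (_∈ _) (sym v≡w) w∈)) ∷ unique q

  private
    consecutive-tail : ∀ {v c x y} → x ≢ v → Consecutive G (v ∷ c) x y → Consecutive G c x y
    consecutive-tail ne ([] , ys , eq)     = ⊥-elim (ne (sym (∷-injectiveˡ eq)))
    consecutive-tail ne (_ ∷ xs , ys , eq) = xs , ys , ∷-injectiveʳ eq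

    consecutive-there : ∀ {v c x y} → Consecutive G c x y → Consecutive G (v ∷ c) x y
    consecutive-there (xs , ys , eq) = _ ∷ xs , ys , cong (_ ∷_) eq

    edge-there : ∀ {v c x y} → EdgeOf G c x y → EdgeOf G (v ∷ c) x y
    edge-there = [ inj₁ ∘ consecutive-there , inj₂ ∘ consecutive-there ]′

    consecutive-∈ : ∀ {c x y} → Consecutive G c x y → x ∈ c × y ∈ c
    consecutive-∈ (xs , ys , refl) = ∈-++⁺ʳ xs (here refl) , ∈-++⁺ʳ xs (there (here refl))

    chordless-tail : ∀ {v c} → v ∉ c → Chordless G (v ∷ c) → Chordless G c
    chordless-tail {v} {c} v∉ cl x y (x~y , x∈ , y∈ , ne) =
      cl x y (x~y , there x∈ , there y∈ , [ ne ∘ inj₁ ∘ consecutive-tail (ne-v x∈) , ne ∘ inj₂ ∘ consecutive-tail (ne-v y∈) ]′)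
      where
      ne-v : ∀ {z} → z ∈ c → z ≢ v
      ne-v z∈ refl = v∉ z∈

  to-chordless : ∀ {p} → Unique p → Linked _~_ p → last p ≡ just t → Chordless G p → ChordlessTo p
  to-chordless {v ∷ []} _ _ refl _ = [t]
  to-chordless {v ∷ u ∷ c} (v∉ ∷ uq@(u∉ ∷ _)) (v~u ∷ l) e cl =
    prepend v~u (All.tabulate ap) (to-chordless uq l e (chordless-tail (λ v∈ → All.lookup v∉ v∈ refl) cl))
    where
    ap : ∀ {w} → w ∈ c → Apart v w
    ap {w} w∈ = (λ { refl → All.lookup v∉ (there w∈) refl }) , λ v~w → cl v w (v~w , here refl , there (there w∈) , not-edge)
      where
      not-edge : ¬ EdgeOf G (v ∷ u ∷ c) v w
      -- `v` occurs only in front, so the only edge of the path at `v` leads to `u`, and `w` lies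
      -- behind `u`.
      not-edge (inj₁ ([] , ys , eq)) = All.lookup u∉ w∈ (∷-injectiveˡ (∷-injectiveʳ eq))
      not-edge (inj₁ (_ ∷ xs , ys , eq)) = All.lookup v∉ (proj₁ (consecutive-∈ (xs , ys , ∷-injectiveʳ eq))) refl
      not-edge (inj₂ ([] , ys , eq)) = All.lookup v∉ (there w∈) (∷-injectiveˡ eq)
      not-edge (inj₂ (_ ∷ xs , ys , eq)) = All.lookup v∉ (proj₂ (consecutive-∈ (xs , ys , ∷-injectiveʳ eq))) refl

  linked : ∀ {p} → ChordlessTo p → Linked _~_ p
  linked [t] = [-]
  linked (prepend v~u _ p) = v~u ∷ linked p

  last-t : ∀ {p} → ChordlessTo p → last p ≡ just t
  last-t [t] = refl
  last-t (prepend _ _ p) = last-t p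

  chordless : ∀ {p} → ChordlessTo p → Chordless G p
  chordless [t] x y (x~y , here refl , here refl , _) = ~-irrefl refl x~y
  chordless (prepend v~u ap p) x y (x~y , here refl , here refl , _) = ~-irrefl refl x~y
  chordless (prepend v~u ap p) x y (x~y , here refl , there (here refl) , ne) = ne (inj₁ ([] , _ , refl))
  chordless (prepend v~u ap p) x y (x~y , here refl , there (there y∈) , ne) = proj₂ (All.lookup ap y∈) x~y
  chordless (prepend v~u ap p) x y (x~y , there (here refl) , here refl , ne) = ne (inj₂ ([] , _ , refl))
  chordless (prepend v~u ap p) x y (x~y , there (there x∈) , here refl , ne) = proj₂ (All.lookup ap x∈) (~-sym x~y)
  chordless (prepend v~u ap p) x y (x~y , there x∈ , there y∈ , ne) = chordless p x y (x~y , x∈ , y∈ , ne ∘ edge-there)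

  Solution : List V → Set
  Solution p = head p ≡ just s × ChordlessTo p

  solution⇔ : ∀ p → Solution p ⇔ IsChordlessPath G s t p
  solution⇔ p = mk⇔
    (λ (h , c) → record { distinct = unique c ; adjacent = linked c ; starts = h ; ends = last-t c } , chordless c)
    (λ (ip , cl) → IsPath.starts ip , to-chordless (IsPath.distinct ip) (IsPath.adjacent ip) (IsPath.ends ip) cl)

  -- Prefixes of paths are kept in reverse, so that r ʳ++ c is the path that
  -- follows the prefix and then c.

  suffix : ∀ r {x c} → ChordlessTo (r ʳ++ (x ∷ c)) → ChordlessTo (x ∷ c)
  suffix []      p = p
  suffix (q ∷ r) p with suffix r p
  ... | prepend _ _ p′ = p′

  prefix-apart : ∀ {q} r {x c} → ChordlessTo ((q ∷ r) ʳ++ (x ∷ c)) → All (λ v → All (Apart v) (x ∷ c)) r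
  prefix-apart []      _ = []
  prefix-apart (v ∷ r) p with suffix r p
  ... | prepend _ ap _ = ap ∷ All.map All.tail (prefix-apart r p)

  -- Induction along the prefix, from its end to its start: the old path supplies the edge to the
  -- preceding vertex and the apartness within the prefix, and the hypothesis supplies the apartness
  -- from the new tail. Only the last vertex `q` may touch the new tail, as the premise on
  -- `q ∷ x′ ∷ c′` describes.
  replace-tail : ∀ {q} r {x c x′ c′} → ChordlessTo ((q ∷ r) ʳ++ (x ∷ c)) → ChordlessTo (q ∷ x′ ∷ c′) →
                 All (λ v → All (Apart v) (x′ ∷ c′)) r → ChordlessTo ((q ∷ r) ʳ++ (x′ ∷ c′))
  replace-tail []      p p′ _ = p′
  replace-tail (v ∷ r) p p′ (ap ∷ aps) with suffix r p
  ... | prepend v~q _ _ = replace-tail r p (prepend v~q ap p′)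
                         (All.zipWith (λ (a , b) → All.head a ∷ b) (prefix-apart r p , aps))

  head-ʳ++ : ∀ q r {c c′ : List V} → head ((q ∷ r) ʳ++ c) ≡ head ((q ∷ r) ʳ++ c′)
  head-ʳ++ q []      = refl
  head-ʳ++ q (v ∷ r) = head-ʳ++ v r

  head-∈ : ∀ {q v} r {c : List V} → head ((q ∷ r) ʳ++ c) ≡ just v → v ∈ q ∷ r
  head-∈ []      refl = here refl
  head-∈ (u ∷ r) e    = there (head-∈ r e)

  ʳ++-cancel : ∀ r {c c′ : List V} → r ʳ++ c ≡ r ʳ++ c′ → c ≡ c′
  ʳ++-cancel []      e = e
  ʳ++-cancel (q ∷ r) e = ∷-injectiveʳ (ʳ++-cancel r e)

  record Extends (r p : List V) : Set where
    constructor continued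
    field
      {continuation} : List V
      extends-≡      : p ≡ r ʳ++ continuation

  extends-shorter : ∀ {q r p} → Extends (q ∷ r) p → Extends r p
  extends-shorter (continued e) = continued e

  extends-unique : ∀ {x y r p} → Extends (x ∷ r) p → Extends (y ∷ r) p → x ≡ y
  extends-unique {r = r} (continued e) (continued e′) = ∷-injectiveˡ (ʳ++-cancel r (trans (sym e) e′))

  predecessor : ∀ {q} r {c} → Solution ((q ∷ r) ʳ++ c) → Any (_~ q) r ⊎ q ≡ s
  predecessor []      (refl , p) = inj₂ refl
  predecessor (v ∷ r) (_ , p) with suffix r p
  ... | prepend v~q _ _ = inj₁ (here v~q)

  -- Any vertex of the prefix but `s` is preceded by a neighbour, which therefore is not the last
  -- vertex `q`. So ranks on the prefix stay below its length.
  dominated-prefix : ∀ {q} r {c v} → Solution ((q ∷ r) ʳ++ c) → v ∈ q ∷ r → Any (_~ v) r ⊎ v ≡ s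
  dominated-prefix r p (here refl) = predecessor r p
  dominated-prefix (u ∷ r) p (there v∈) = [ inj₁ ∘ there , inj₂ ]′ (dominated-prefix r p v∈)

  -- A threshold form of the rank: one more than the index of the first neighbour is at most
  -- `length r` exactly when a neighbour occurs among the first `length r` vertices. The vertex `s`
  -- is exempt, since it has rank 0 without a neighbour before it.
  record Ranks (F : V → ℕ) (r : List V) : Set where
    field
      rank-s : F s ≡ 0
      rank⇒  : ∀ {v} → v ≢ s → F v ≤ length r → Any (_~ v) r
      rank⇐  : ∀ {v} → v ≢ s → Any (_~ v) r → F v ≤ length r
  open Ranks public

  -- F v is the only position at which v can occur on a path along the given prefix.
  AllRanks : (V → ℕ) → List V → Set
  AllRanks F []      = Ranks F []
  AllRanks F (q ∷ r) = Ranks F (q ∷ r) × AllRanks F r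

  allRanks-head : ∀ {F} r → AllRanks F r → Ranks F r
  allRanks-head []      R = R
  allRanks-head (q ∷ r) R = proj₁ R

  -- Mirrors the ranking loop: the path is traversed from its end, each vertex overwrites the ranks
  -- of its neighbours, and so the earliest neighbour has the last word. `suc (length r)` is one
  -- more than the index of `q`.
  first : List V → (V → ℕ) → V → ℕ
  first []      f = f
  first (q ∷ r) f = first r (λ v → if does (q ~? v) then suc (length r) else f v)

  first-any : ∀ r f {v} → Any (_~ v) r → first r f v ≤ length r
  first-none : ∀ r f {v} → ¬ Any (_~ v) r → first r f v ≡ f v
  first-none []      f ¬a = refl
  first-none (q ∷ r) f {v} ¬a with first-none r (λ v → if does (q ~? v) then suc (length r) else f v) (¬a ∘ there)
  ... | eq with q ~? v
  ...   | yes q~v = ⊥-elim (¬a (here q~v))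
  ...   | no _    = eq
  first-any (q ∷ r) f {v} a with Any.any? (_~? v) r
  ... | yes a′ = m≤n⇒m≤1+n (first-any r _ a′)
  first-any (q ∷ r) f {v} (there a) | no ¬a = ⊥-elim (¬a a)
  first-any (q ∷ r) f {v} (here q~v) | no ¬a with first-none r (λ v → if does (q ~? v) then suc (length r) else f v) ¬a
  ... | eq with q ~? v
  ...   | yes _ = ≤-reflexive eq
  ...   | no ¬q~v = ⊥-elim (¬q~v q~v)

  -- The default `f` lies above every value set by `r`, so a rank of at most `length r` must have
  -- been set by a neighbour.
  ranks-first : ∀ {F} r f → F s ≡ 0 → (∀ {v} → v ≢ s → F v ≡ first r f v) → (∀ v → length r < f v) → Ranks F r
  ranks-first {F} r f Fs Fv low = record
    { rank-s = Fs ; rank⇒ = has-neighbour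
    ; rank⇐ = λ ne a → subst (_≤ length r) (sym (Fv ne)) (first-any r f a) }
    where
    has-neighbour : ∀ {v} → v ≢ s → F v ≤ length r → Any (_~ v) r
    has-neighbour {v} ne le with Any.any? (_~? v) r
    ... | yes a = a
    ... | no ¬a = ⊥-elim (<⇒≱ (low v) (subst (_≤ length r) (trans (Fv ne) (first-none r f ¬a)) le))

  allRanks-first : ∀ {F} r f → F s ≡ 0 → (∀ {v} → v ≢ s → F v ≡ first r f v) → (∀ v → length r < f v) → AllRanks F r
  allRanks-first []      f Fs Fv low = ranks-first [] f Fs Fv low
  allRanks-first (q ∷ r) f Fs Fv low = ranks-first (q ∷ r) f Fs Fv low , allRanks-first r _ Fs Fv low′
    where
    low′ : ∀ v → length r < (if does (q ~? v) then suc (length r) else f v)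
    low′ v with q ~? v
    ... | yes _ = ≤-refl
    ... | no _  = ≤-trans (n≤1+n _) (low v)

-- Graph search

module Searching (G : Graph) (s t : Vertex G) where
  open Graph G using (_~_; ~-sym; ~-irrefl; _~?_)
  open ChordlessPaths G s t public

  Flagged : (ℕ → ℕ) → V → Set
  Flagged P v = P (toℕ v) ≢ 0

  flag : (ℕ → ℕ) → V → V → ℕ → ℕ
  flag P x u = P [ toℕ x ≔ suc (toℕ u) ]

  Follows : (ℕ → ℕ) → List V → Set
  Follows P []          = ⊤
  Follows P (v ∷ [])    = ⊤
  Follows P (v ∷ u ∷ c) = P (toℕ v) ≡ suc (toℕ u) × Follows P (u ∷ c)

  flag-other : ∀ P {x} u {v} → v ≢ x → flag P x u (toℕ v) ≡ P (toℕ v)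
  flag-other P u ne = upd-other P _ (ne ∘ Fin.toℕ-injective)

  flag-same : ∀ P x u → flag P x u (toℕ x) ≡ suc (toℕ u)
  flag-same P x u = upd-same P _ _

  flagged-flag : ∀ P {x u v} → Flagged P v → Flagged (flag P x u) v
  flagged-flag P {x} {u} {v} fv z with v Fin.≟ x
  ... | yes refl with trans (sym (flag-same P x u)) z
  ...   | ()
  flagged-flag P {x} {u} {v} fv z | no ne = fv (trans (sym (flag-other P u ne)) z)

  flagged-new : ∀ P x u → Flagged (flag P x u) x
  flagged-new P x u z with trans (sym (flag-same P x u)) z
  ... | ()

  flagged-old : ∀ P {x u v} → v ≢ x → Flagged (flag P x u) v → Flagged P v
  flagged-old P {u = u} ne f z = f (trans (flag-other P u ne) z)

  follows-flag : ∀ P {x u} c → ¬ Flagged P x → Follows P c → Follows (flag P x u) c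
  follows-flag P []           _  _ = _
  follows-flag P (v ∷ [])     _  _ = _
  follows-flag P {x} {u} (v ∷ w ∷ c) ¬f (e , fs) = trans (flag-other P u v≢x) e , follows-flag P (w ∷ c) ¬f fs
    where
    v≢x : v ≢ x
    v≢x refl = ¬f λ z → case trans (sym e) z of λ ()

  -- D: vertices whose neighbours are all flagged; C: the vertex being
  -- processed, with neighbours in todo still to be visited; W: the waiting ones.
  record Search (F : V → ℕ) (lev : ℕ) (P : ℕ → ℕ) (D C todo W : List V) : Set where
    field
      unique-L  : Unique (C ++ D)
      unique-W  : Unique W
      apart     : All (_∉ C ++ D) W
      high-L    : All (λ v → lev ≤ F v) (C ++ D)
      high-W    : All (λ v → lev ≤ F v) W
      flagged-L : All (Flagged P) (C ++ D)
      flagged-W : All (Flagged P) W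
      flagged-t : Flagged P t
      closed    : ∀ {d v} → d ∈ D → d ~ v → Flagged P v
      closing   : ∀ {d v} → d ∈ C → d ~ v → Flagged P v ⊎ v ∈ todo
      chain     : ∀ {v} → Flagged P v → ∃ λ c → ChordlessTo (v ∷ c) × Follows P (v ∷ c) × All (_∈ C ++ D) c
      complete  : ∀ {v} → Flagged P v → lev ≤ F v → v ∈ W ⊎ v ∈ C ++ D
  open Search public

  begin-visit : ∀ {F lev P D u W todo} → (∀ {v} → u ~ v → v ∈ todo) →
                Search F lev P D [] [] (u ∷ W) → Search F lev P D [ u ] todo W
  begin-visit {P = P} {D} {u} {W} nb S with unique-W S | apart S | high-W S | flagged-W S
  ... | u∉W ∷ uW | u∉D ∷ ap | hu ∷ hW | fu ∷ fW = record
    { unique-L = All.tabulate (λ { d∈ refl → u∉D d∈ }) ∷ unique-L S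
    ; unique-W = uW
    ; apart = All.zipWith (λ { (u≢w , w∉) (here refl) → u≢w refl ; (u≢w , w∉) (there w∈) → w∉ w∈ }) (u∉W , ap)
    ; high-L = hu ∷ high-L S ; high-W = hW
    ; flagged-L = fu ∷ flagged-L S ; flagged-W = fW ; flagged-t = flagged-t S
    ; closed = closed S
    ; closing = λ { (here refl) u~v → inj₂ (nb u~v) }
    ; chain = λ f → let c , p , fo , al = chain S f in c , p , fo , All.map there al
    ; complete = λ f le → cases (complete S f le) }
    where
    cases : ∀ {v} → v ∈ u ∷ W ⊎ v ∈ D → v ∈ W ⊎ v ∈ u ∷ D
    cases (inj₁ (here refl)) = inj₂ (here refl)
    cases (inj₁ (there v∈))  = inj₁ v∈
    cases (inj₂ v∈)          = inj₂ (there v∈)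

  end-visit : ∀ {F lev P D u W} → Search F lev P D [ u ] [] W → Search F lev P (u ∷ D) [] [] W
  end-visit {P = P} {D} {u} S = record
    { unique-L = unique-L S ; unique-W = unique-W S ; apart = apart S ; high-L = high-L S ; high-W = high-W S
    ; flagged-L = flagged-L S ; flagged-W = flagged-W S ; flagged-t = flagged-t S
    ; closed = λ { (here refl) u~v → [ (λ f → f) , (λ ()) ]′ (closing S (here refl) u~v) ; (there d∈) → closed S d∈ }
    ; closing = λ () ; chain = chain S ; complete = complete S }

  skip-flagged : ∀ {F lev P D C x todo W} → Flagged P x → Search F lev P D C (x ∷ todo) W → Search F lev P D C todo W
  skip-flagged {P = P} {x = x} {todo} fx S = record
    { unique-L = unique-L S ; unique-W = unique-W S ; apart = apart S ; high-L = high-L S ; high-W = high-W S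
    ; flagged-L = flagged-L S ; flagged-W = flagged-W S ; flagged-t = flagged-t S
    ; closed = closed S ; closing = λ c∈ c~v → cases (closing S c∈ c~v) ; chain = chain S ; complete = complete S }
    where
    cases : ∀ {v} → Flagged P v ⊎ v ∈ x ∷ todo → Flagged P v ⊎ v ∈ todo
    cases (inj₁ f) = inj₁ f
    cases (inj₂ (here refl)) = inj₁ fx
    cases (inj₂ (there v∈)) = inj₂ v∈

  module _ {F : V → ℕ} {lev : ℕ} {P : ℕ → ℕ} {D : List V} {u : V} {x : V} {todo W : List V}
           (u~x : u ~ x) (¬fx : ¬ Flagged P x) (S : Search F lev P D [ u ] (x ∷ todo) W) where
    private
      P′ = flag P x u

      x∉L : x ∉ u ∷ D
      x∉L x∈ = ¬fx (All.lookup (flagged-L S) x∈)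

      x∉W : x ∉ W
      x∉W x∈ = ¬fx (All.lookup (flagged-W S) x∈)

      -- The new vertex `x` is put in front of the chain of its parent `u`. All later vertices of
      -- that chain lie in `D`, whose neighbours were all flagged before `x` was; hence none of them
      -- is adjacent to `x`, and the chain stays chordless.
      chain′ : ∀ {v} → Flagged P′ v → ∃ λ c → ChordlessTo (v ∷ c) × Follows P′ (v ∷ c) × All (_∈ u ∷ D) c
      chain′ {v} f with v Fin.≟ x
      ... | no ne = let c , p , fo , al = chain S (flagged-old P ne f) in c , p , follows-flag P (v ∷ c) ¬fx fo , al
      ... | yes refl with chain S (All.head (flagged-L S))
      ...   | c , p , fo , al = u ∷ c , prepend (~-sym u~x) (All.tabulate ap) p
                                  , (flag-same P x u , follows-flag P (u ∷ c) ¬fx fo) , here refl ∷ al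
        where
        ap : ∀ {w} → w ∈ c → Apart x w
        ap {w} w∈ = (λ { refl → x∉L (All.lookup al w∈) }) , no-edge (All.lookup al w∈)
          where
          no-edge : w ∈ u ∷ D → ¬ x ~ w
          no-edge (here refl) _   = u∉c p w∈
            where
            u∉c : ∀ {c} → ChordlessTo (u ∷ c) → u ∉ c
            u∉c [t] ()
            u∉c p@(prepend _ _ _) = ∉-head p
          no-edge (there w∈D) x~w = ¬fx (closed S w∈D (~-sym x~w))

      closing′ : ∀ {d v} → d ∈ [ u ] → d ~ v → Flagged P′ v ⊎ v ∈ todo
      closing′ d∈ d~v with closing S d∈ d~v
      ... | inj₁ f = inj₁ (flagged-flag P f)
      ... | inj₂ (here refl) = inj₁ (flagged-new P x u)
      ... | inj₂ (there v∈) = inj₂ v∈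

    -- A vertex of rank below the level gets a parent but is not passed through: it may begin a
    -- branch at the level of its own rank, where the scan finds it by its flag.
    visit-low : F x < lev → Search F lev P′ D [ u ] todo W
    visit-low low = record
      { unique-L = unique-L S ; unique-W = unique-W S ; apart = apart S ; high-L = high-L S ; high-W = high-W S
      ; flagged-L = All.map (flagged-flag P) (flagged-L S) ; flagged-W = All.map (flagged-flag P) (flagged-W S)
      ; flagged-t = flagged-flag P (flagged-t S)
      ; closed = λ d∈ d~v → flagged-flag P (closed S d∈ d~v) ; closing = closing′ ; chain = chain′
      ; complete = complete′ }
      where
      complete′ : ∀ {v} → Flagged P′ v → lev ≤ F v → v ∈ W ⊎ v ∈ u ∷ D
      complete′ {v} f le with v Fin.≟ x
      ... | yes refl = ⊥-elim (<⇒≱ low le)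
      ... | no ne    = complete S (flagged-old P ne f) le

    visit-high : lev ≤ F x → Search F lev P′ D [ u ] todo (x ∷ W)
    visit-high high = record
      { unique-L = unique-L S
      ; unique-W = All.tabulate (λ { w∈ refl → x∉W w∈ }) ∷ unique-W S
      ; apart = x∉L ∷ apart S ; high-L = high-L S ; high-W = high ∷ high-W S
      ; flagged-L = All.map (flagged-flag P) (flagged-L S)
      ; flagged-W = flagged-new P x u ∷ All.map (flagged-flag P) (flagged-W S)
      ; flagged-t = flagged-flag P (flagged-t S)
      ; closed = λ d∈ d~v → flagged-flag P (closed S d∈ d~v) ; closing = closing′ ; chain = chain′
      ; complete = complete′ }
      where
      complete′ : ∀ {v} → Flagged P′ v → lev ≤ F v → v ∈ x ∷ W ⊎ v ∈ u ∷ D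
      complete′ {v} f le with v Fin.≟ x
      ... | yes refl = inj₁ (here refl)
      ... | no ne    = [ inj₁ ∘ there , inj₂ ]′ (complete S (flagged-old P ne f) le)

  -- Induction from `t` backwards: a flagged vertex of sufficient rank has been processed, as
  -- nothing waits, so its predecessor is flagged. The start `v` itself may have any rank.
  reachable-flagged : ∀ {F lev P D v c} → Search F lev P D [] [] [] → All (λ w → lev ≤ F w) c → ChordlessTo (v ∷ c) → Flagged P v
  reachable-flagged S _ [t] = flagged-t S
  reachable-flagged S (hu ∷ hs) (prepend v~u _ p) with complete S (reachable-flagged S hs p) hu
  ... | inj₂ u∈D = closed S u∈D (~-sym v~u)

  module _ {F : V → ℕ} {P : ℕ → ℕ} (lev : ℕ) (ft : Flagged P t) (¬f : ∀ {v} → v ≢ t → ¬ Flagged P v) where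
    private
      only-t : ∀ {v} → Flagged P v → v ≡ t
      only-t {v} f with v Fin.≟ t
      ... | yes e = e
      ... | no ne = ⊥-elim (¬f ne f)

      trivial-chain : ∀ {v} → Flagged P v → ∃ λ c → ChordlessTo (v ∷ c) × Follows P (v ∷ c) × All (_∈ []) c
      trivial-chain f with only-t f
      ... | refl = [] , [t] , _ , []

    start-search : lev ≤ F t → Search F lev P [] [] [] [ t ]
    start-search le = record
      { unique-L = [] ; unique-W = [] ∷ [] ; apart = (λ ()) ∷ [] ; high-L = [] ; high-W = le ∷ []
      ; flagged-L = [] ; flagged-W = ft ∷ [] ; flagged-t = ft ; closed = λ () ; closing = λ ()
      ; chain = trivial-chain ; complete = λ f _ → inj₁ (here (only-t f)) }

    -- At a level above the rank of t nothing is to be reached.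
    idle-search : F t < lev → Search F lev P [] [] [] []
    idle-search low = record
      { unique-L = [] ; unique-W = [] ; apart = [] ; high-L = [] ; high-W = []
      ; flagged-L = [] ; flagged-W = [] ; flagged-t = ft ; closed = λ () ; closing = λ ()
      ; chain = trivial-chain ; complete = λ f le → ⊥-elim (<⇒≱ low (subst (λ v → lev ≤ F v) (only-t f) le)) }

  -- The vertices waiting after the level has been lowered to i are the
  -- flagged ones of rank i.
  record Scan (F : V → ℕ) (i : ℕ) (P : ℕ → ℕ) (todo W : List V) : Set where
    field
      scan-unique   : Unique W
      scanned       : All (λ w → F w ≡ i × Flagged P w) W
      scan-apart    : All (_∉ todo) W
      scan-complete : ∀ {v} → Flagged P v → F v ≡ i → v ∈ W ⊎ v ∈ todo
  open Scan public

  -- Flags, chains and the closure of `D` do not mention the level. Only completeness asks for more,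
  -- namely for the flagged vertices of rank `i`, and these are the ones collected in `W`; their
  -- rank keeps them out of `D`.
  end-scan : ∀ {F i P D W} → Search F (suc i) P D [] [] [] → Scan F i P [] W → Search F i P D [] [] W
  end-scan {F} {i} {P} {D} {W} S C = record
    { unique-L = unique-L S ; unique-W = scan-unique C
    ; apart = All.map (λ { (Fw , _) w∈ → <⇒≢ (All.lookup (high-L S) w∈) (sym Fw) }) (scanned C)
    ; high-L = All.map <⇒≤ (high-L S) ; high-W = All.map (≤-reflexive ∘ sym ∘ proj₁) (scanned C)
    ; flagged-L = flagged-L S ; flagged-W = All.map proj₂ (scanned C) ; flagged-t = flagged-t S
    ; closed = closed S ; closing = λ () ; chain = chain S ; complete = complete′ }
    where
    complete′ : ∀ {v} → Flagged P v → i ≤ F v → v ∈ W ⊎ v ∈ D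
    complete′ {v} f le with m≤n⇒m<n∨m≡n le
    ... | inj₁ lt = [ (λ ()) , inj₂ ]′ (complete S f lt)
    ... | inj₂ eq with scan-complete C f (sym eq)
    ...   | inj₁ w∈ = inj₁ w∈

  scan-skip : ∀ {F i P x todo W} → ¬ (Flagged P x × F x ≡ i) → Scan F i P (x ∷ todo) W → Scan F i P todo W
  scan-skip {F} {i} {P} {x} {todo} {W} unfit C = record
    { scan-unique = scan-unique C ; scanned = scanned C ; scan-apart = All.map (_∘ there) (scan-apart C)
    ; scan-complete = λ f e → cases f e (scan-complete C f e) }
    where
    cases : ∀ {v} → Flagged P v → F v ≡ i → v ∈ W ⊎ v ∈ x ∷ todo → v ∈ W ⊎ v ∈ todo
    cases f e (inj₁ v∈) = inj₁ v∈
    cases f e (inj₂ (here refl)) = ⊥-elim (unfit (f , e))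
    cases f e (inj₂ (there v∈)) = inj₂ v∈

  scan-take : ∀ {F i P x todo W} → Flagged P x → F x ≡ i → x ∉ todo → Scan F i P (x ∷ todo) W → Scan F i P todo (x ∷ W)
  scan-take {F} {i} {P} {x} {todo} {W} fx Fx x∉ C = record
    { scan-unique = All.map (λ { w∉ refl → w∉ (here refl) }) (scan-apart C) ∷ scan-unique C
    ; scanned = (Fx , fx) ∷ scanned C ; scan-apart = x∉ ∷ All.map (_∘ there) (scan-apart C)
    ; scan-complete = λ f e → cases (scan-complete C f e) }
    where
    cases : ∀ {v} → v ∈ W ⊎ v ∈ x ∷ todo → v ∈ x ∷ W ⊎ v ∈ todo
    cases (inj₁ v∈) = inj₁ (there v∈)
    cases (inj₂ (here refl)) = inj₁ (here refl)
    cases (inj₂ (there v∈)) = inj₂ v∈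

  -- An entry stands for the solutions with the given reversed prefix, and
  -- carries one of them.
  record Entry : Set where
    constructor entry
    field
      prefix : List V
      rest   : List V

    path : List V
    path = prefix ʳ++ rest
  open Entry public

  -- Branches along a prefix.

  Covers : Entry → List V → Set
  Covers b p = Solution p × Extends (prefix b) p

  record Inside (r : List V) (b : Entry) : Set where
    constructor contained
    field extends-prefix : ∀ {p} → Extends (prefix b) p → Extends r p

  record Separate (b b′ : Entry) : Set where
    constructor separated
    field not-both : ∀ {p} → Extends (prefix b) p → ¬ Extends (prefix b′) p

  -- `Q` and the solutions along the branches partition the solutions along `r`. That prefixes get
  -- longer is what bounds the nesting of expansions.
  record Branches (r : List V) (Q : List V) (bs : List Entry) : Set where
    field
      solutions : All (Solution ∘ path) bs
      longer    : All (λ b → length r < length (prefix b)) bs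
      inside    : All (Inside r) bs
      separate  : AllPairs Separate bs
      not-Q     : All (λ b → ¬ Extends (prefix b) Q) bs
      cover     : ∀ {p} → Solution p → Extends r p → p ≡ Q ⊎ Any (λ b → Extends (prefix b) p) bs
  open Branches public

  -- When `r` is all of `Q` it ends in `t`, and a chordless path to `t` cannot continue after `t`.
  no-branches : ∀ {r Q} → Solution Q → Q ≡ r ʳ++ [] → 0 < length r → Branches r Q []
  no-branches {x ∷ r} {Q} SQ refl _ = record
    { solutions = [] ; longer = [] ; inside = [] ; separate = [] ; not-Q = []
    ; cover = λ { Sp (continued {c} refl) → inj₁ (cong ((x ∷ r) ʳ++_) (nothing-after c Sp)) } }
    where
    suffix₁ : ∀ r {x c} → ChordlessTo ((x ∷ r) ʳ++ c) → ChordlessTo (x ∷ c)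
    suffix₁ r p = suffix r p
    x≡t : ChordlessTo (x ∷ []) → x ≡ t
    x≡t [t] = refl
    nothing-after : ∀ c → Solution ((x ∷ r) ʳ++ c) → c ≡ []
    nothing-after []      _ = refl
    nothing-after (y ∷ c) (_ , p) = ⊥-elim (not-t (suffix₁ r p) (x≡t (suffix₁ r (proj₂ SQ))))

  -- One step back along the path, from the branches along `q ∷ r` to those along `r`. The
  -- thresholds for `r` and for `r₁` together pin a rank to exactly `length r`.
  module Level {F : V → ℕ} {P : ℕ → ℕ} {D : List V} {r₀ : V} {r₁ : List V} {q : V} {c₀ : List V}
               (SQ : Solution ((r₀ ∷ r₁) ʳ++ (q ∷ c₀))) (R : Ranks F (r₀ ∷ r₁)) (R₁ : Ranks F r₁)
               (S : Search F (suc (length (r₀ ∷ r₁))) P D [] [] []) where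

    private
      r = r₀ ∷ r₁
      Q = r ʳ++ (q ∷ c₀)
      i = length r

      s∈r : s ∈ r
      s∈r = head-∈ r₁ (proj₁ SQ)

      rank-adjacent : ∀ {v} → F v ≡ i → r₀ ~ v × All (λ w → ¬ w ~ v) r₁
      rank-adjacent {v} e with v Fin.≟ s
      ... | yes refl = ⊥-elim (case trans (sym (rank-s R)) e of λ ())
      ... | no v≢s = cases (rank⇒ R v≢s (≤-reflexive e))
        where
        ¬any : ¬ Any (_~ v) r₁
        ¬any a = <⇒≱ ≤-refl (subst (_≤ length r₁) e (rank⇐ R₁ v≢s a))
        cases : Any (_~ v) r → r₀ ~ v × All (λ w → ¬ w ~ v) r₁
        cases (here r₀~v) = r₀~v , All.¬Any⇒All¬ r₁ ¬any
        cases (there a)   = ⊥-elim (¬any a)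

      low : ∀ {v} → v ∈ r → F v < i
      low {v} v∈ with v Fin.≟ s
      ... | yes refl = subst (_< i) (sym (rank-s R)) (s≤s z≤n)
      ... | no v≢s with dominated-prefix r₁ {q ∷ c₀} SQ v∈
      ...   | inj₁ a = s≤s (rank⇐ R₁ v≢s a)
      ...   | inj₂ e = ⊥-elim (v≢s e)

      -- Vertices on the prefix have rank below `i` and neighbours of the prefix have rank at most
      -- `i`, so a vertex of higher rank is neither.
      free : ∀ {w} → i < F w → ∀ {v} → v ∈ r → Apart v w
      free {w} lt {v} v∈ = (λ { refl → <-asym lt (low v∈) }) , λ v~w → <⇒≱ lt (rank⇐ R w≢s (Any.map (λ { refl → v~w }) v∈))
        where
        w≢s : w ≢ s
        w≢s refl = <⇒≱ lt (subst (_≤ i) (sym (rank-s R)) z≤n)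

    scan-start : ∀ {todo} → (∀ {v} → r₀ ~ v → v ∈ todo) → Scan F i P todo []
    scan-start nb = record { scan-unique = [] ; scanned = [] ; scan-apart = []
                           ; scan-complete = λ _ e → inj₂ (nb (proj₁ (rank-adjacent e))) }

    branch-solution : ∀ {x c} → Flagged P x → F x ≡ i → ChordlessTo (x ∷ c) → All (_∈ D) c → Solution (r ʳ++ (x ∷ c))
    branch-solution {x} {c} fx Fx p al =
      trans (head-ʳ++ r₀ r₁ {x ∷ c} {q ∷ c₀}) (proj₁ SQ) ,
      replace-tail r₁ (proj₂ SQ) (prepend (proj₁ (rank-adjacent Fx)) (All.map (λ w∈ → free (All.lookup (high-L S) w∈) (here refl)) al) p)
        (All.tabulate λ {v} v∈ → apart-x v∈ ∷ All.map (λ w∈ → free (All.lookup (high-L S) w∈) (there v∈)) al)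
      where
      apart-x : ∀ {v} → v ∈ r₁ → Apart v x
      apart-x v∈ = (λ { refl → <⇒≢ (low (there v∈)) Fx }) , All.lookup (proj₂ (rank-adjacent Fx)) v∈

    -- Completeness of a level, the converse of `branch-solution`. Everything after `y` is apart
    -- from the whole of `r`, hence of rank above `i`, so the search has come from `t` along `c` to
    -- a neighbour of `y`. The neighbour `r₀` and apartness from `r₁` fix the rank of `y`.
    deviation : ∀ {y c} → Solution (r ʳ++ (y ∷ c)) → Flagged P y × F y ≡ i
    deviation {y} {c} (h , p) with suffix r₁ p
    ... | prepend r₀~y ap p′ = reachable-flagged S (All.tabulate high) p′ , ≤-antisym (rank⇐ R y≢s (here r₀~y)) (≰⇒> not-low)
      where
      aps : All (λ v → All (Apart v) (y ∷ c)) r₁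
      aps = prefix-apart r₁ p
      outside : ∀ {w} → w ∈ y ∷ c → w ≢ s
      outside w∈ refl with s∈r
      ... | here refl = ∉-head (suffix r₁ p) w∈
      ... | there s∈  = proj₁ (All.lookup (All.lookup aps s∈) w∈) refl
      y≢s : y ≢ s
      y≢s = outside (here refl)
      not-low : ¬ F y ≤ length r₁
      not-low le = All.All¬⇒¬Any (All.map (λ a → proj₂ (All.head a)) aps) (rank⇒ R₁ y≢s le)
      high : ∀ {w} → w ∈ c → suc i ≤ F w
      high w∈ = ≰⇒> λ le → All.All¬⇒¬Any (proj₂ (All.lookup ap w∈) ∷ All.map (λ a → proj₂ (All.lookup a (there w∈))) aps)
                              (rank⇒ R (outside (there w∈)) le)

    record Within (todo : List V) (b : Entry) : Set where
      constructor within
      field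
        {next-vertex} : V
        visited       : next-vertex ≡ q ⊎ next-vertex ∉ todo
        extends-next  : ∀ {p} → Extends (prefix b) p → Extends (next-vertex ∷ r) p

    within-tail : ∀ {x todo b} → Within (x ∷ todo) b → Within todo b
    within-tail (within d w) = within ([ inj₁ , (λ y∉ → inj₂ (y∉ ∘ there)) ]′ d) w

    record Scanned (todo : List V) (bs : List Entry) : Set where
      field
        sc-solutions : All (Solution ∘ path) bs
        sc-longer    : All (λ b → i < length (prefix b)) bs
        sc-within    : All (Within todo) bs
        sc-separate  : AllPairs Separate bs
        sc-not-Q     : All (λ b → ¬ Extends (prefix b) Q) bs
        sc-cover     : ∀ {p y c} → Solution p → p ≡ r ʳ++ (y ∷ c) → p ≡ Q ⊎ Any (λ b → Extends (prefix b) p) bs ⊎ (y ∈ todo × y ≢ q)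
    open Scanned public

    scanned-start : ∀ {todo bs} → (∀ {v} → r₀ ~ v → v ∈ todo) → Branches (q ∷ r) Q bs → Scanned todo bs
    scanned-start {todo} {bs} nb B = record
      { sc-solutions = solutions B ; sc-longer = All.map (≤-trans (n≤1+n _)) (longer B)
      ; sc-within = All.map (λ (contained w) → within (inj₁ refl) w) (inside B)
      ; sc-separate = separate B ; sc-not-Q = not-Q B ; sc-cover = cover′ }
      where
      cover′ : ∀ {p y c} → Solution p → p ≡ r ʳ++ (y ∷ c) → p ≡ Q ⊎ Any (λ b → Extends (prefix b) p) bs ⊎ (y ∈ todo × y ≢ q)
      cover′ {p} {y} {c} Sp refl with y Fin.≟ q
      ... | yes refl = [ inj₁ , inj₂ ∘ inj₁ ]′ (cover B Sp (continued refl))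
      ... | no y≢q   = inj₂ (inj₂ (nb (proj₁ (rank-adjacent (proj₂ (deviation Sp)))) , y≢q))

    scanned-end : ∀ {bs} → Scanned [] bs → Branches r Q bs
    scanned-end {bs} C = record
      { solutions = sc-solutions C ; longer = sc-longer C
      ; inside = All.map (λ { (within _ w) → contained λ e → extends-shorter (w e) }) (sc-within C)
      ; separate = sc-separate C ; not-Q = sc-not-Q C ; cover = cover′ }
      where
      cover′ : ∀ {p} → Solution p → Extends r p → p ≡ Q ⊎ Any (λ b → Extends (prefix b) p) bs
      cover′ Sp (continued {[]} refl) = ⊥-elim (absurd (suffix r₁ (proj₂ Sp)) (suffix r₁ (proj₂ SQ)))
        where
        absurd : ∀ {y c} → ChordlessTo (r₀ ∷ []) → ¬ ChordlessTo (r₀ ∷ y ∷ c)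
        absurd [t] p = not-t p refl
      cover′ Sp (continued {y ∷ c} e) with sc-cover C Sp e
      ... | inj₁ pQ = inj₁ pQ
      ... | inj₂ (inj₁ a) = inj₂ a

    scanned-skip : ∀ {x todo bs} → x ≡ q ⊎ ¬ (Flagged P x × F x ≡ i) → Scanned (x ∷ todo) bs → Scanned todo bs
    scanned-skip {x} {todo} {bs} unfit C = record
      { sc-solutions = sc-solutions C ; sc-longer = sc-longer C
      ; sc-within = All.map within-tail (sc-within C)
      ; sc-separate = sc-separate C ; sc-not-Q = sc-not-Q C ; sc-cover = cover′ }
      where
      cover′ : ∀ {p y c} → Solution p → p ≡ r ʳ++ (y ∷ c) → p ≡ Q ⊎ Any (λ b → Extends (prefix b) p) bs ⊎ (y ∈ todo × y ≢ q)
      cover′ Sp refl with sc-cover C Sp refl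
      ... | inj₁ e = inj₁ e
      ... | inj₂ (inj₁ a) = inj₂ (inj₁ a)
      ... | inj₂ (inj₂ (there y∈ , ne)) = inj₂ (inj₂ (y∈ , ne))
      ... | inj₂ (inj₂ (here refl , ne)) = ⊥-elim ([ ne , (λ ¬b → ¬b (deviation Sp)) ]′ unfit)

    scanned-take : ∀ {x c todo bs} → x ≢ q → x ∉ todo → Solution (r ʳ++ (x ∷ c)) → Scanned (x ∷ todo) bs →
                   Scanned todo (entry (x ∷ r) c ∷ bs)
    scanned-take {x} {c} {todo} {bs} x≢q x∉ Sx C = record
      { sc-solutions = Sx ∷ sc-solutions C ; sc-longer = ≤-refl ∷ sc-longer C
      ; sc-within = within (inj₂ x∉) (λ e → e) ∷ All.map within-tail (sc-within C)
      ; sc-separate = All.map (λ { (within d w) → separated λ e e′ → differ d (extends-unique e (w e′)) }) (sc-within C) ∷ sc-separate C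
      ; sc-not-Q = (λ e → x≢q (extends-unique e (continued refl))) ∷ sc-not-Q C
      ; sc-cover = cover′ }
      where
      differ : ∀ {y} → y ≡ q ⊎ y ∉ x ∷ todo → x ≢ y
      differ (inj₁ refl) x≡q  = x≢q x≡q
      differ (inj₂ y∉)   refl = y∉ (here refl)
      cover′ : ∀ {p y d} → Solution p → p ≡ r ʳ++ (y ∷ d) → p ≡ Q ⊎ Any (λ b → Extends (prefix b) p) (entry (x ∷ r) c ∷ bs) ⊎ (y ∈ todo × y ≢ q)
      cover′ {d = d} Sp refl with sc-cover C Sp refl
      ... | inj₁ e = inj₁ e
      ... | inj₂ (inj₁ a) = inj₂ (inj₁ (there a))
      ... | inj₂ (inj₂ (there y∈ , ne)) = inj₂ (inj₂ (y∈ , ne))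
      ... | inj₂ (inj₂ (here refl , ne)) = inj₂ (inj₁ (here (continued refl)))

  record Enumerates (b : Entry) (ps : List (List V)) : Set where
    field
      once  : Unique ps
      sound : All (Covers b) ps
      exact : ∀ {p} → Covers b p → p ∈ ps

  record EnumeratesAll (bs : List Entry) (ps : List (List V)) : Set where
    field
      once  : Unique ps
      sound : All (λ p → Solution p × Any (λ b → Extends (prefix b) p) bs) ps
      exact : ∀ {p} → Solution p → Any (λ b → Extends (prefix b) p) bs → p ∈ ps

  enumerates-[] : EnumeratesAll [] []
  enumerates-[] = record { once = [] ; sound = [] ; exact = λ _ () }

  enumerates-∷ : ∀ {b bs ps qs} → All (Separate b) bs →
                 Enumerates b ps → EnumeratesAll bs qs → EnumeratesAll (b ∷ bs) (ps ++ qs)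
  enumerates-∷ {b} {bs} {ps} {qs} sep E Es = record
    { once = Unique.++⁺ (Enumerates.once E) (EnumeratesAll.once Es) disjoint
    ; sound = All.++⁺ (All.map (λ (S , e) → S , here e) (Enumerates.sound E)) (All.map (λ (S , a) → S , there a) (EnumeratesAll.sound Es))
    ; exact = λ { S (here e) → ∈-++⁺ˡ (Enumerates.exact E (S , e)) ; S (there a) → ∈-++⁺ʳ ps (EnumeratesAll.exact Es S a) } }
    where
    disjoint : ∀ {p} → ¬ (p ∈ ps × p ∈ qs)
    disjoint (p∈ , p∈′) = clash sep (proj₂ (All.lookup (EnumeratesAll.sound Es) p∈′))
      where
      clash : ∀ {cs} → All (Separate b) cs → ¬ Any (λ b → Extends (prefix b) _) cs
      clash (separated sp ∷ _) (here e) = sp (proj₂ (All.lookup (Enumerates.sound E) p∈)) e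
      clash (_ ∷ sps) (there a) = clash sps a

  -- The carried path is listed in front; `not-Q` keeps it from recurring among the solutions of the
  -- branches.
  enumerates-entry : ∀ {b bs ps} → Solution (path b) → Branches (prefix b) (path b) bs → EnumeratesAll bs ps → Enumerates b (path b ∷ ps)
  enumerates-entry {b} {bs} {ps} SQ B E = record
    { once = All.tabulate new ∷ EnumeratesAll.once E
    ; sound = (SQ , continued refl) ∷ All.map (λ (S , a) → S , covered (inside B) a) (EnumeratesAll.sound E)
    ; exact = λ (S , e) → [ here , (λ a → there (EnumeratesAll.exact E S a)) ]′ (cover B S e) }
    where
    covered : ∀ {cs p} → All (Inside (prefix b)) cs → Any (λ b → Extends (prefix b) p) cs → Extends (prefix b) p
    covered (contained w ∷ _) (here e) = w e
    covered (_ ∷ ws) (there a) = covered ws a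
    new : ∀ {p} → p ∈ ps → path b ≢ p
    new p∈ refl = All.All¬⇒¬Any (not-Q B) (proj₂ (All.lookup (EnumeratesAll.sound E) p∈))

-- The program and its correctness.  The constants in the time bounds count
-- instructions of compiled code.

nᵣ sᵣ tᵣ pᵣ cᵣ xᵣ spᵣ lᵣ startᵣ iᵣ jᵣ kᵣ levᵣ bpᵣ uᵣ yᵣ : ℕ
nᵣ = 0
sᵣ = 1
tᵣ = 2
pᵣ = 3
cᵣ = 4
xᵣ = 5
spᵣ = 6
lᵣ = 7
startᵣ = 8
iᵣ = 9
jᵣ = 10
kᵣ = 11
levᵣ = 12
bpᵣ = 13
uᵣ = 14
yᵣ = 15

-- offA: where the adjacency list of a vertex begins in the input; flagA: 0 for a
-- vertex not yet reached, otherwise one more than its parent (1 for t); bagA: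
-- reached vertices to be processed; stackA: entries still to be expanded.
offA rankA flagA bagA pathA stackA : Array
offA   = zero
rankA  = suc zero
flagA  = suc (suc zero)
bagA   = suc (suc (suc zero))
pathA  = suc (suc (suc (suc zero)))
stackA = suc (suc (suc (suc (suc zero))))

increment decrement : ℕ → Cmd
increment x = x ← ! x ⊕ lit 1
decrement x = x ← ! x ⊖ lit 1

-- Tests are encoded by truncated subtraction: `1 ∸ m` negates, and `m ∸ n` vanishes exactly when
-- `m ≤ n`. Guards elsewhere in the program are built in the same way.
equal different : Exp → Exp → Exp
equal e f     = lit 1 ⊖ (e ⊖ f) ⊖ (f ⊖ e)
different e f = lit 1 ⊖ equal e f

pushTo : Array → ℕ → Exp → Cmd
pushTo k p e = k ‹ ! p ›← e ⨾ increment p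

forNeighbours : Exp → Cmd → Cmd
forNeighbours e body =
  pᵣ ← offA ‹ e › ⨾
  cᵣ ← input (! pᵣ) ⨾
  while (! cᵣ) (increment pᵣ ⨾ xᵣ ← input (! pᵣ) ⨾ decrement cᵣ ⨾ body)

visit : Cmd
visit =
  when (lit 1 ⊖ flagA ‹ ! xᵣ ›)
    (flagA ‹ ! xᵣ ›← ! uᵣ ⊕ lit 1 ⨾
     when (lit 1 ⊖ (! levᵣ ⊖ rankA ‹ ! xᵣ ›)) (pushTo bagA bpᵣ (! xᵣ)))

search : Cmd
search = while (! bpᵣ) (decrement bpᵣ ⨾ uᵣ ← bagA ‹ ! bpᵣ › ⨾ forNeighbours (! uᵣ) visit)

copying chaining : Cmd
copying  = while (! iᵣ ⊖ ! jᵣ) (pushTo stackA spᵣ (pathA ‹ ! jᵣ ›) ⨾ increment jᵣ)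
chaining = while (different (! yᵣ) (! tᵣ)) (pushTo stackA spᵣ (! yᵣ) ⨾ increment jᵣ ⨾ yᵣ ← flagA ‹ ! yᵣ › ⊖ lit 1)

-- The length of a chain of parents is known only after it has been followed, so it is pushed on top
-- of the vertices, where popping needs it early. `iᵣ + 1` is the length of the new prefix, which
-- includes `xᵣ`.
pushEntry : Cmd
pushEntry =
  jᵣ ← lit 0 ⨾
  copying ⨾
  yᵣ ← ! xᵣ ⨾
  chaining ⨾
  pushTo stackA spᵣ (! tᵣ) ⨾ increment jᵣ ⨾
  pushTo stackA spᵣ (! jᵣ) ⨾
  pushTo stackA spᵣ (! iᵣ ⊕ lit 1)

-- The vertex of the current path at position `iᵣ` gives no new entry, but it joins the bag, because
-- branches at earlier positions may run through it.
scan : Cmd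
scan =
  when (equal (rankA ‹ ! xᵣ ›) (! iᵣ)) (when (flagA ‹ ! xᵣ ›)
    (when (different (! xᵣ) (pathA ‹ ! iᵣ ›)) pushEntry ⨾ pushTo bagA bpᵣ (! xᵣ)))

-- Only positions from `startᵣ` on are varied: deviating earlier would leave the prefix of the entry
-- and belong to another one.
levels : Cmd
levels = while (! iᵣ ⊖ ! startᵣ)
  (decrement iᵣ ⨾ forNeighbours (pathA ‹ ! iᵣ ⊖ lit 1 ›) scan ⨾ levᵣ ← ! iᵣ ⨾ search)

initSearch : Exp → Cmd
initSearch e =
  kᵣ ← lit 0 ⨾
  while (! nᵣ ⊖ ! kᵣ) (rankA ‹ ! kᵣ ›← e ⨾ flagA ‹ ! kᵣ ›← lit 0 ⨾ increment kᵣ) ⨾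
  flagA ‹ ! tᵣ ›← lit 1 ⨾
  bpᵣ ← lit 0

ranking : Cmd
ranking =
  kᵣ ← ! lᵣ ⨾
  while (! kᵣ) (forNeighbours (pathA ‹ ! kᵣ ⊖ lit 1 ›) (rankA ‹ ! xᵣ ›← ! kᵣ) ⨾ decrement kᵣ) ⨾
  rankA ‹ ! sᵣ ›← lit 0

pop : Cmd
pop =
  decrement spᵣ ⨾ startᵣ ← stackA ‹ ! spᵣ › ⨾
  decrement spᵣ ⨾ lᵣ ← stackA ‹ ! spᵣ › ⨾
  jᵣ ← ! lᵣ ⨾
  while (! jᵣ) (decrement jᵣ ⨾ decrement spᵣ ⨾ pathA ‹ ! jᵣ ›← stackA ‹ ! spᵣ ›)

printPath : Cmd
printPath =
  jᵣ ← lit 0 ⨾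
  while (! lᵣ ⊖ ! jᵣ) (output (pathA ‹ ! jᵣ ›) ⨾ increment jᵣ)

expand : Cmd
expand = initSearch (! lᵣ ⊕ lit 1) ⨾ ranking ⨾ iᵣ ← ! lᵣ ⨾ levels

iteration : Cmd
iteration = pop ⨾ printPath ⨾ endOutput ⨾ expand

readInput : Cmd
readInput =
  nᵣ ← input (lit 0) ⨾ sᵣ ← input (lit 1) ⨾ tᵣ ← input (lit 2) ⨾
  pᵣ ← lit 3 ⨾ kᵣ ← lit 0 ⨾
  while (! nᵣ ⊖ ! kᵣ) (offA ‹ ! kᵣ ›← ! pᵣ ⨾ pᵣ ← ! pᵣ ⊕ lit 1 ⊕ input (! pᵣ) ⨾ increment kᵣ)

-- With rank 0 for `s` and 1 for all others, level 1 admits every vertex except `s`: the general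
-- search then gives `s` a parent without passing through it.
firstSearch : Cmd
firstSearch = initSearch (lit 1) ⨾ rankA ‹ ! sᵣ ›← lit 0 ⨾ pushTo bagA bpᵣ (! tᵣ) ⨾ levᵣ ← lit 1 ⨾ search

firstPath : Cmd
firstPath =
  firstSearch ⨾
  spᵣ ← lit 0 ⨾ iᵣ ← lit 0 ⨾ xᵣ ← ! sᵣ ⨾
  when (flagA ‹ ! sᵣ ›) pushEntry

enumeration : Cmd
enumeration = readInput ⨾ firstPath ⨾ while (! spᵣ) iteration

-- Lists stored in arrays.

Holds : (ℕ → ℕ) → ℕ → List ℕ → Set
Holds f a []       = ⊤
Holds f a (x ∷ xs) = f a ≡ x × Holds f (suc a) xs

-- The top of the stack comes first.
StackHolds : (ℕ → ℕ) → List ℕ → Set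
StackHolds f []       = ⊤
StackHolds f (x ∷ xs) = f (length xs) ≡ x × StackHolds f xs

stackHolds-above : ∀ f xs {i x} → length xs ≤ i → StackHolds f xs → StackHolds (f [ i ≔ x ]) xs
stackHolds-above f []       le h = tt
stackHolds-above f (y ∷ ys) le (e , h) = trans (upd-other f _ (<⇒≢ le)) e , stackHolds-above f ys (≤-trans (n≤1+n _) le) h

stackHolds-push : ∀ f xs x → StackHolds f xs → StackHolds (f [ length xs ≔ x ]) (x ∷ xs)
stackHolds-push f xs x h = upd-same f (length xs) x , stackHolds-above f xs ≤-refl h

stackHolds-suffix : ∀ f xs {ys} → StackHolds f (xs ʳ++ ys) → StackHolds f ys
stackHolds-suffix f []       h = h
stackHolds-suffix f (x ∷ xs) h = proj₂ (stackHolds-suffix f xs h)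

equal-yes : ∀ {m n} → m ≡ n → 1 ∸ (m ∸ n) ∸ (n ∸ m) ≡ 1
equal-yes {m} refl rewrite n∸n≡0 m = refl

equal-no : ∀ {m n} → m ≢ n → 1 ∸ (m ∸ n) ∸ (n ∸ m) ≡ 0
equal-no {zero}  {zero}  ne = ⊥-elim (ne refl)
equal-no {zero}  {suc n} ne = 0∸n≡0 n
equal-no {suc m} {zero}  ne = cong (_∸ 0) (0∸n≡0 m)
equal-no {suc m} {suc n} ne = equal-no {m} {n} (ne ∘ cong suc)

∸-zero : ∀ m → m ≢ 0 → 1 ∸ m ≡ 0
∸-zero zero    ne = ⊥-elim (ne refl)
∸-zero (suc m) _  = 0∸n≡0 m

-- Outputs and delays of traces.

record Emits (es : List Event) (q : List ℕ) : Set where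
  field
    emitted : ∀ ws rest → outputsFrom ws (es ++ rest) ≡ outputsFrom (ws ++ q) rest
    waited  : ∀ d rest → delaysFrom d (es ++ rest) ≡ delaysFrom (d + length es) rest
open Emits

outputsFrom-silent : ∀ ws rest → outputsFrom ws (silent ∷ rest) ≡ outputsFrom ws rest
outputsFrom-silent []       rest = refl
outputsFrom-silent (w ∷ ws) rest = refl

emits-[] : Emits [] []
emits-[] = record { emitted = λ ws rest → cong (λ q → outputsFrom q rest) (sym (++-identityʳ ws))
                  ; waited = λ d rest → cong (λ d → delaysFrom d rest) (sym (+-identityʳ d)) }

emits-silent : Emits [ silent ] []
emits-silent = record
  { emitted = λ ws rest → trans (outputsFrom-silent ws rest) (cong (λ q → outputsFrom q rest) (sym (++-identityʳ ws)))
  ; waited = λ d rest → cong (λ d → delaysFrom d rest) (+-comm 1 d) }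

emits-printed : ∀ w → Emits [ printed w ] [ w ]
emits-printed w = record { emitted = λ { [] rest → refl ; (_ ∷ _) rest → refl }
                         ; waited = λ d rest → cong (λ d → delaysFrom d rest) (+-comm 1 d) }

infixr 5 _emits-++_
_emits-++_ : ∀ {es es′ q q′} → Emits es q → Emits es′ q′ → Emits (es ++ es′) (q ++ q′)
_emits-++_ {es} {es′} {q} {q′} E E′ = record
  { emitted = λ ws rest → begin
      outputsFrom ws ((es ++ es′) ++ rest) ≡⟨ cong (outputsFrom ws) (++-assoc es es′ rest) ⟩
      outputsFrom ws (es ++ es′ ++ rest)   ≡⟨ emitted E ws (es′ ++ rest) ⟩
      outputsFrom (ws ++ q) (es′ ++ rest)  ≡⟨ emitted E′ (ws ++ q) rest ⟩
      outputsFrom ((ws ++ q) ++ q′) rest   ≡⟨ cong (λ q → outputsFrom q rest) (++-assoc ws q q′) ⟩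
      outputsFrom (ws ++ q ++ q′) rest     ∎
  ; waited = λ d rest → begin
      delaysFrom d ((es ++ es′) ++ rest)         ≡⟨ cong (delaysFrom d) (++-assoc es es′ rest) ⟩
      delaysFrom d (es ++ es′ ++ rest)           ≡⟨ waited E d (es′ ++ rest) ⟩
      delaysFrom (d + length es) (es′ ++ rest)   ≡⟨ waited E′ _ rest ⟩
      delaysFrom (d + length es + length es′) rest ≡⟨ cong (λ d → delaysFrom d rest) (+-assoc d _ _) ⟩
      delaysFrom (d + (length es + length es′)) rest ≡⟨ cong (λ m → delaysFrom (d + m) rest) (sym (length-++ es)) ⟩
      delaysFrom (d + length (es ++ es′)) rest   ∎ }
  where open ≡-Reasoning

emits-silents : ∀ n → Emits (silents n) []
emits-silents zero    = emits-[]
emits-silents (suc n) = emits-silent emits-++ emits-silents n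

-- A part of a trace in which q is completed after a further events, followed
-- by k events.
record Completes (es : List Event) (q : List ℕ) (a k : ℕ) : Set where
  field
    completed : ∀ ws rest → outputsFrom ws (es ++ rest) ≡ (ws ++ q) ∷ outputsFrom [] rest
    elapsed   : ∀ d rest → delaysFrom d (es ++ rest) ≡ suc (d + a) ∷ delaysFrom k rest
    duration  : length es ≡ suc (a + k)
open Completes

completes-finish : ∀ k → Completes ([ finished ] ++ silents k) [] 0 k
completes-finish k = record
  { completed = λ ws rest → trans (finish-now ws (silents k ++ rest)) (cong₂ _∷_ (sym (++-identityʳ ws)) (emitted (emits-silents k) [] rest))
  ; elapsed = λ d rest → cong₂ _∷_ (cong suc (sym (+-identityʳ d)))
      (trans (waited (emits-silents k) 0 rest) (cong (λ m → delaysFrom m rest) (length-replicate k)))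
  ; duration = cong suc (length-replicate k) }
  where
  finish-now : ∀ ws rest → outputsFrom ws (finished ∷ rest) ≡ ws ∷ outputsFrom [] rest
  finish-now []       rest = refl
  finish-now (_ ∷ _) rest = refl

infixr 5 _completes-++_
_completes-++_ : ∀ {es es′ q q′ a k} → Emits es q → Completes es′ q′ a k → Completes (es ++ es′) (q ++ q′) (length es + a) k
_completes-++_ {es} {es′} {q} {q′} {a} {k} E C = record
  { completed = λ ws rest → trans (cong (outputsFrom ws) (++-assoc es es′ rest)) (trans (emitted E ws (es′ ++ rest))
      (trans (completed C (ws ++ q) rest) (cong (_∷ outputsFrom [] rest) (++-assoc ws q q′))))
  ; elapsed = λ d rest → trans (cong (delaysFrom d) (++-assoc es es′ rest)) (trans (waited E d (es′ ++ rest))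
      (trans (elapsed C _ rest) (cong (λ m → suc m ∷ delaysFrom k rest) (+-assoc d _ a))))
  ; duration = trans (length-++ es) (trans (cong (length es +_) (duration C))
      (trans (+-suc (length es) (a + k)) (cong suc (sym (+-assoc (length es) a k))))) }

completes-silent : ∀ {es q a k} → Completes es q a k → Completes (es ++ [ silent ]) q a (suc k)
completes-silent {es} {q} {a} {k} C = record
  { completed = λ ws rest → trans (cong (outputsFrom ws) (++-assoc es _ rest)) (completed C ws (silent ∷ rest))
  ; elapsed = λ d rest → trans (cong (delaysFrom d) (++-assoc es _ rest)) (elapsed C d (silent ∷ rest))
  ; duration = trans (length-++ es) (trans (cong (_+ 1) (duration C)) (trans (+-comm _ 1) (cong suc (sym (+-suc a k))))) }

-- Traces in which the solutions qs are completed at distances of at most M + M,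
-- provided that at most M time passes before and after.
record Enumerating (M : ℕ) (es : List Event) (qs : List (List ℕ)) : Set where
  field
    outs : ∀ rest → outputsFrom [] (es ++ rest) ≡ qs ++ outputsFrom [] rest
    dels : ∀ {d} rest → d ≤ M → (∀ {d′} → d′ ≤ M → All (_≤ M + M) (delaysFrom d′ rest)) → All (_≤ M + M) (delaysFrom d (es ++ rest))
open Enumerating public

enumerating-[] : ∀ {M} → Enumerating M [] []
enumerating-[] = record { outs = λ _ → refl ; dels = λ rest le f → f le }

enumerating-++ : ∀ {M es es′ qs qs′} → Enumerating M es qs → Enumerating M es′ qs′ → Enumerating M (es ++ es′) (qs ++ qs′)
enumerating-++ {M} {es} {es′} {qs} {qs′} E E′ = record
  { outs = λ rest → trans (cong (outputsFrom []) (++-assoc es es′ rest)) (trans (outs E (es′ ++ rest))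
      (trans (cong (qs ++_) (outs E′ rest)) (sym (++-assoc qs qs′ _))))
  ; dels = λ {d} rest le f → subst (λ es → All (_≤ M + M) (delaysFrom d es)) (sym (++-assoc es es′ rest))
      (dels E (es′ ++ rest) le (λ le′ → dels E′ rest le′ f)) }

-- A delay is made of the rest of one iteration and the beginning of the next up to its output; each
-- of them is at most `M`.
enumerating-one : ∀ {M es q a k} → Completes es q a k → suc a ≤ M → k ≤ M → Enumerating M es [ q ]
enumerating-one {M} {a = a} C a≤ k≤ = record
  { outs = λ rest → completed C [] rest
  ; dels = λ {d} rest le f → subst (All (_≤ M + M)) (sym (elapsed C d rest))
      ((≤-trans (≤-reflexive (sym (+-suc d a))) (+-mono-≤ le a≤)) ∷ f k≤) }

total-ʳ++ : ∀ {A : Set} (w : A → ℕ) xs {ys} → total w (xs ʳ++ ys) ≡ total w xs + total w ys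
total-ʳ++ w []       = refl
total-ʳ++ w (x ∷ xs) {ys} = trans (total-ʳ++ w xs) (trans (sym (+-assoc (total w xs) (w x) _)) (cong (_+ total w ys) (+-comm (total w xs) (w x))))

total-drop : ∀ {A : Set} (w : A → ℕ) xs → total w (drop 1 xs) ≤ total w xs
total-drop w []       = z≤n
total-drop w (x ∷ xs) = m≤n+m _ (w x)

Holds-++ˡ : ∀ {f a} xs {ys} → Holds f a (xs ++ ys) → Holds f a xs
Holds-++ˡ []       h = tt
Holds-++ˡ (x ∷ xs) (e , h) = e , Holds-++ˡ xs h

Holds-++ʳ : ∀ {f a} xs {ys} → Holds f a (xs ++ ys) → Holds f (a + length xs) ys
Holds-++ʳ {f} {a} []       {ys} h = subst (λ a → Holds f a ys) (sym (+-identityʳ a)) h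
Holds-++ʳ {f} {a} (x ∷ xs) {ys} (e , h) = subst (λ a → Holds f a ys) (sym (+-suc a (length xs))) (Holds-++ʳ xs h)

holds-input : ∀ xs ys → Holds (λ i → fromMaybe 0 (at (xs ++ ys) i)) (length xs) ys
holds-input xs []       = tt
holds-input xs (y ∷ ys) = cong (fromMaybe 0) (at-++ xs) ,
  subst₂ (λ zs k → Holds (λ i → fromMaybe 0 (at zs i)) k ys) (++-assoc xs [ y ] ys) (trans (length-++ xs) (+-comm _ 1)) (holds-input (xs ++ [ y ]) ys)

CountsFrom : ∀ {n} → ℕ → List (Fin n) → Set
CountsFrom {n} k []       = k ≡ n
CountsFrom     k (v ∷ vs) = toℕ v ≡ k × CountsFrom (suc k) vs

counts-tabulate : ∀ {n} m (f : Fin m → Fin n) k → (∀ i → toℕ (f i) ≡ k + toℕ i) → k + m ≡ n → CountsFrom k (tabulate f)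
counts-tabulate zero    f k eq e = trans (sym (+-identityʳ k)) e
counts-tabulate (suc m) f k eq e = trans (eq zero) (+-identityʳ k) ,
  counts-tabulate m (f ∘ suc) (suc k) (λ i → trans (eq (suc i)) (+-suc k (toℕ i))) (trans (sym (+-suc k m)) e)

-- Loop invariants and running times.

module Algorithm (G : Graph) (s t : Vertex G) (s≢t : s ≢ t) (A : AdjacencyLists G) (base Bd : ℕ)
                 (base≤Bd : base ≤ Bd) (n<Bd : 3 + Graph.order G ≤ Bd) where
  open Graph G using (_~_; ~-sym; ~-irrefl; _~?_) renaming (order to n)
  open Searching G s t public
  open AdjacencyLists A renaming (once to nbrs-unique; exact to nbrs-exact; neighbours to nbrs)

  inp : ℕ → ℕ
  inp i = fromMaybe 0 (at (encode G A s t) i)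

  open Hoare base Bd inp public

  deg : V → ℕ
  deg v = length (nbrs v)

  weight : V → ℕ
  weight v = suc (deg v)

  -- `Wt`, the number of vertices plus the sum of the degrees, is the unit of linear time and also
  -- bounds the branches of one expansion. `E` bounds the words of a stack entry: two numbers and at
  -- most `n` vertices.
  Wt E : ℕ
  Wt = total weight (allFin n)
  E  = 2 + n

  record Located (off : ℕ → ℕ) (v : V) : Set where
    field
      degree-at : inp (off (toℕ v)) ≡ deg v
      nbrs-at   : Holds inp (suc (off (toℕ v))) (map toℕ (nbrs v))
      in-input  : off (toℕ v) + deg v < base
  open Located public

  -- Stated on components of the store, so that assignments to other variables leave the type
  -- unchanged up to evaluation and need no transport. The later invariants are parametrised in the
  -- same way.
  record Context′ (n′ s′ t′ : ℕ) (off : ℕ → ℕ) : Set where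
    field
      n-reg   : n′ ≡ n
      s-reg   : s′ ≡ toℕ s
      t-reg   : t′ ≡ toℕ t
      located : ∀ v → Located off v
  open Context′ public

  Context : Store → Set
  Context σ = Context′ (var σ nᵣ) (var σ sᵣ) (var σ tᵣ) (arr σ offA)

  context-kept : ∀ {c σ τ σ′} → Silently c σ τ σ′ →
    {_ : T (not (writesVar c nᵣ))} {_ : T (not (writesVar c sᵣ))} {_ : T (not (writesVar c tᵣ))} {_ : T (not (writesArr c offA))} →
    Context σ → Context σ′
  context-kept ex {a} {b} {c} {d} C
    rewrite kept ex nᵣ {a} | kept ex sᵣ {b} | kept ex tᵣ {c} | keptArr ex offA {d} = C

  nbrs⇒ : ∀ {u v} → v ∈ nbrs u → u ~ v
  nbrs⇒ {u} {v} = Equivalence.to (nbrs-exact u v)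

  nbrs⇐ : ∀ {u v} → u ~ v → v ∈ nbrs u
  nbrs⇐ {u} {v} = Equivalence.from (nbrs-exact u v)

  total-weight : ∀ {D} → Unique D → total weight D ≤ Wt
  total-weight u = total-⊆ weight u (λ {x} _ → ∈-allFin x)

  -- I todo τ σ: the neighbours in todo are still to be treated, and τ units
  -- of time have been spent in the body.
  module NeighbourLoop
      (body : Cmd) (keeps-p : T (not (writesVar body pᵣ))) (keeps-c : T (not (writesVar body cᵣ)))
      (I : List V → ℕ → Store → Set)
      (stable-p : ∀ {todo τ σ} m → I todo τ σ → I todo τ (setVar σ pᵣ m))
      (stable-x : ∀ {todo τ σ} m → I todo τ σ → I todo τ (setVar σ xᵣ m))
      (stable-c : ∀ {todo τ σ} m → I todo τ σ → I todo τ (setVar σ cᵣ m))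
      (each : ∀ {x todo τ σ} → var σ xᵣ ≡ toℕ x → I (x ∷ todo) τ σ →
              ∃₂ λ σ′ τ′ → Silently body σ τ′ σ′ × I todo (τ + τ′) σ′)
    where

    private
      guarded : Cmd
      guarded = increment pᵣ ⨾ xᵣ ← input (! pᵣ) ⨾ decrement cᵣ ⨾ body

      loop : ∀ todo {τ σ} → Holds inp (suc (var σ pᵣ)) (map toℕ todo) → var σ cᵣ ≡ length todo →
             var σ pᵣ + length todo < base → I todo τ σ →
             ∃₂ λ σ′ T → ∃ λ τ′ → Silently (while (! cᵣ) guarded) σ T σ′ × T + τ ≤ τ′ + (14 * length todo + 3) × I [] τ′ σ′
      loop [] {τ} _ c≡ _ i = _ , _ , τ , stop-s _ c≡ , linear (τ ∷ []) none (κ 3 ∔ # 0) (# 0 ∔ κ 3) , i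
      loop (x ∷ todo) {τ} {σ} (p≡ , h) c≡ lt i =
        let p = var σ pᵣ
            p+1≡ = +-comm p 1
            lt′ : suc p + length todo < base
            lt′ = subst (_< base) (+-suc p (length todo)) lt
            σ₁ = setVar (setVar (setVar σ pᵣ (p + 1)) xᵣ (inp (p + 1))) cᵣ (var σ cᵣ ∸ 1)
            p<base : p + 1 < base
            p<base = ≤-<-trans (subst (_≤ suc p + length todo) (sym p+1≡) (m≤m+n (suc p) _)) lt′
            x≡ : inp (p + 1) ≡ toℕ x
            x≡ = trans (cong inp p+1≡) p≡
            σ₂ , T₁ , ex₁ , i₁ = each {σ = σ₁} x≡ (stable-c _ (stable-x _ (stable-p _ i)))
            p₂ : var σ₂ pᵣ ≡ suc p
            p₂ = trans (kept ex₁ pᵣ {keeps-p}) p+1≡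
            c₂ : var σ₂ cᵣ ≡ length todo
            c₂ = trans (kept ex₁ cᵣ {keeps-c}) (cong (_∸ 1) c≡)
            σ₃ , T₂ , τ₃ , ex₂ , le , i₃ =
              loop todo (subst (λ a → Holds inp (suc a) (map toℕ todo)) (sym p₂) h) c₂
                   (subst (λ a → a + length todo < base) (sym p₂) lt′) i₁
        in σ₃ , _ , τ₃ ,
           loop-s _ (λ z → case trans (sym c≡) z of λ ())
             (assign-s (_ , _ , ≤-trans (<⇒≤ p<base) base≤Bd) ⨾ₛ assign-s (_ , p<base) ⨾ₛ assign-s _ ⨾ₛ ex₁) ex₂ ,
           linear (T₁ ∷ T₂ ∷ τ ∷ τ₃ ∷ length todo ∷ [])
             (hyp 1 (# 1 ∔ (# 2 ∔ # 0)) (# 3 ∔ (14 · # 4 ∔ κ 3)) le none)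
             (κ 3 ∔ (κ 4 ∔ (κ 3 ∔ (κ 4 ∔ # 0))) ∔ # 1 ∔ # 2) (# 3 ∔ (14 · (κ 1 ∔ # 4) ∔ κ 3)) ,
           i₃

    -- Only the overhead, 14 instructions per neighbour, is bounded here. The time of the body is
    -- the growth from `τ` to `τ′`, left to the invariant `I`, because a scan step that pushes a
    -- path is far dearer than others and has to be amortised.
    forNeighbours-correct : ∀ {e v τ σ} → Safe σ e → eval σ e ≡ toℕ v → (∀ v → Located (arr σ offA) v) → I (nbrs v) τ σ →
      ∃₂ λ σ′ T → ∃ λ τ′ → Silently (forNeighbours e body) σ T σ′ × T + τ ≤ τ′ + (14 * deg v + (14 + cost e)) × I [] τ′ σ′
    forNeighbours-correct {e} {v} {τ} {σ} safe e≡ loc i =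
      let a = arr σ offA (eval σ e)
          a≡ : a ≡ arr σ offA (toℕ v)
          a≡ = cong (arr σ offA) e≡
          σ₁ = setVar (setVar σ pᵣ a) cᵣ (inp a)
          a<base : a < base
          a<base = ≤-<-trans (≤-trans (≤-reflexive a≡) (m≤m+n _ _)) (in-input (loc v))
          σ₂ , T , τ′ , ex , le , i′ =
            loop (nbrs v) {σ = σ₁} (subst (λ a → Holds inp (suc a) (map toℕ (nbrs v))) (sym a≡) (nbrs-at (loc v)))
              (trans (cong inp a≡) (degree-at (loc v))) (subst (λ a → a + deg v < base) (sym a≡) (in-input (loc v)))
              (stable-c _ (stable-p _ i))
      in σ₂ , _ , τ′ , (assign-s safe ⨾ₛ assign-s (_ , a<base) ⨾ₛ ex) ,
         linear (T ∷ τ ∷ τ′ ∷ deg v ∷ cost e ∷ [])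
           (hyp 1 (# 0 ∔ # 1) (# 2 ∔ (14 · # 3 ∔ κ 3)) le none)
           (# 4 ∔ κ 7 ∔ κ 1 ∔ (κ 3 ∔ # 0) ∔ # 1) (# 2 ∔ (14 · # 3 ∔ (κ 14 ∔ # 4))) , i′

  module UniformNeighbourLoop
      (body : Cmd) (keeps-p : T (not (writesVar body pᵣ))) (keeps-c : T (not (writesVar body cᵣ)))
      (K : ℕ) (I : List V → Store → Set)
      (stable-p : ∀ {todo σ} m → I todo σ → I todo (setVar σ pᵣ m))
      (stable-x : ∀ {todo σ} m → I todo σ → I todo (setVar σ xᵣ m))
      (stable-c : ∀ {todo σ} m → I todo σ → I todo (setVar σ cᵣ m))
      (each : ∀ {x todo σ} → var σ xᵣ ≡ toℕ x → I (x ∷ todo) σ →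
              ∃₂ λ σ′ τ′ → Silently body σ τ′ σ′ × τ′ ≤ K × I todo σ′)
    where

    private
      each′ : ∀ M {x todo τ σ} → var σ xᵣ ≡ toℕ x → I (x ∷ todo) σ × τ + length (x ∷ todo) * K ≤ M →
              ∃₂ λ σ′ τ′ → Silently body σ τ′ σ′ × (I todo σ′ × (τ + τ′) + length todo * K ≤ M)
      each′ M {todo = todo} {τ} x≡ (i , le) =
        let σ′ , τ′ , ex , le′ , i′ = each x≡ i
        in σ′ , τ′ , ex , i′ ,
           linear (τ ∷ τ′ ∷ K ∷ length todo * K ∷ M ∷ [])
             (hyp 1 (# 0 ∔ (# 2 ∔ # 3)) (# 4) le (hyp 1 (# 1) (# 2) le′ none)) (# 0 ∔ # 1 ∔ # 3) (# 4)

    forNeighbours-uniform : ∀ {e v σ} → Safe σ e → eval σ e ≡ toℕ v → (∀ v → Located (arr σ offA) v) → I (nbrs v) σ →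
      ∃₂ λ σ′ T → Silently (forNeighbours e body) σ T σ′ × T ≤ deg v * K + (14 * deg v + (14 + cost e)) × I [] σ′
    forNeighbours-uniform {e} {v} {σ} safe e≡ loc i =
      let σ′ , T , τ , ex , le , (i′ , le′) = forNeighbours-correct {τ = 0} safe e≡ loc (i , ≤-refl)
      in σ′ , T , ex ,
         linear (T ∷ τ ∷ deg v ∷ deg v * K ∷ cost e ∷ [])
           (hyp 1 (# 0 ∔ κ 0) (# 1 ∔ (14 · # 2 ∔ (κ 14 ∔ # 4))) le (hyp 1 (# 1 ∔ κ 0) (# 3) le′ none))
           (# 0) (# 3 ∔ (14 · # 2 ∔ (κ 14 ∔ # 4))) , i′
      where
      open NeighbourLoop body keeps-p keeps-c (λ todo τ σ → I todo σ × τ + length todo * K ≤ deg v * K)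
        (λ m (i , le) → stable-p m i , le) (λ m (i , le) → stable-x m i , le) (λ m (i , le) → stable-c m i , le)
        (each′ (deg v * K))

  vertex-bound : ∀ (v : V) → toℕ v + 1 ≤ Bd
  vertex-bound v = ≤-trans (≤-trans (≤-reflexive (+-comm (toℕ v) 1)) (Fin.toℕ<n v)) (≤-trans (m≤n+m n 3) n<Bd)

  n≤Bd : n ≤ Bd
  n≤Bd = ≤-trans (m≤n+m n 3) n<Bd

  RankRep : (ℕ → ℕ) → (V → ℕ) → Set
  RankRep rank F = ∀ v → rank (toℕ v) ≡ F v

  record BagRep (bp : ℕ) (bag : ℕ → ℕ) (W : List V) : Set where
    constructor bagRep
    field
      bag-size : bp ≡ length W
      bag-elts : StackHolds bag (map toℕ W)
  open BagRep public

  bag-push : ∀ {bp bag W x m} → BagRep bp bag W → m ≡ toℕ x → BagRep (bp + 1) (bag [ bp ≔ m ]) (x ∷ W)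
  bag-push {W = W} {x} (bagRep refl h) refl = bagRep (+-comm _ 1)
    (subst (λ k → StackHolds (_ [ k ≔ toℕ x ]) (toℕ x ∷ map toℕ W)) (length-map toℕ W) (stackHolds-push _ (map toℕ W) (toℕ x) h))

  -- No vertex waits twice, so the bag never exceeds `n`.
  bag-room : ∀ {bp bag W} {x : V} → BagRep bp bag W → Unique (x ∷ W) → bp + 1 ≤ Bd
  bag-room {W = W} (bagRep refl _) u = ≤-trans (≤-trans (≤-reflexive (+-comm (length W) 1)) (unique-length u)) n≤Bd

  record VisitState (F : V → ℕ) (lev : ℕ) (D : List V) (u : V) (todo : List V)
                    (rank flags bag : ℕ → ℕ) (bp lev′ u′ : ℕ) : Set where
    field
      {waiting} : List V
      searching : Search F lev flags D [ u ] todo waiting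
      adjacent  : All (u ~_) todo
      ranks     : RankRep rank F
      bag-rep   : BagRep bp bag waiting
      lev-reg   : lev′ ≡ lev
      u-reg     : u′ ≡ toℕ u

  module Visiting (F : V → ℕ) (lev : ℕ) (D : List V) (u : V) where
    Visit : List V → Store → Set
    Visit todo σ = VisitState F lev D u todo (arr σ rankA) (arr σ flagA) (arr σ bagA) (var σ bpᵣ) (var σ levᵣ) (var σ uᵣ)

    visit-correct : ∀ {x todo σ} → var σ xᵣ ≡ toℕ x → Visit (x ∷ todo) σ →
      ∃₂ λ σ′ τ → Silently visit σ τ σ′ × τ ≤ 48 × Visit todo σ′
    visit-correct {x} {todo} {σ} x≡ I = cases (arr σ flagA (toℕ x) ≟ 0) (lev ≤? F x)
      where
      open VisitState I
      P = arr σ flagA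
      val : P (var σ xᵣ) ≡ P (toℕ x)
      val = cong P x≡
      rank-val : arr σ rankA (var σ xᵣ) ≡ F x
      rank-val = trans (cong (arr σ rankA) x≡) (ranks x)
      u~x = All.head adjacent
      flagP : P [ var σ xᵣ ≔ var σ uᵣ + 1 ] ≡ flag P x u
      flagP = cong₂ (λ a b → P [ a ≔ b ]) x≡ (trans (cong (_+ 1) u-reg) (+-comm (toℕ u) 1))
      safe-u : var σ uᵣ + 1 ≤ Bd
      safe-u = subst (λ m → m + 1 ≤ Bd) (sym u-reg) (vertex-bound u)
      cases : Dec (P (toℕ x) ≡ 0) → Dec (lev ≤ F x) → ∃₂ λ σ′ τ → Silently visit σ τ σ′ × τ ≤ 48 × Visit todo σ′
      cases (no fx) _ = _ , _ , unless-s _ (∸-zero _ (λ z → fx (trans (sym val) z))) , m≤m+n 12 36 ,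
        record { searching = skip-flagged fx searching ; adjacent = All.tail adjacent ; ranks = ranks
               ; bag-rep = bag-rep ; lev-reg = lev-reg ; u-reg = u-reg }
      cases (yes z) (no low) = _ , _ ,
        when-s _ (λ e → case trans (cong (1 ∸_) (sym (trans val z))) e of λ ())
          (store-s _ (_ , _ , safe-u) ⨾ₛ unless-s _ (∸-zero _ λ e → low (≤-trans (≤-reflexive (sym lev-reg))
             (≤-trans (m∸n≡0⇒m≤n e) (≤-reflexive rank-val))))) , m≤m+n 36 12 ,
        record { searching = subst (λ P → Search F lev P D [ u ] todo waiting) (sym flagP)
                               (visit-low u~x (λ f → f z) searching (≰⇒> low))
               ; adjacent = All.tail adjacent ; ranks = ranks ; bag-rep = bag-rep ; lev-reg = lev-reg ; u-reg = u-reg }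
      cases (yes z) (yes high) = _ , _ ,
        when-s _ (λ e → case trans (cong (1 ∸_) (sym (trans val z))) e of λ ())
          (store-s _ (_ , _ , safe-u) ⨾ₛ
           when-s _ (λ e → case trans (cong (1 ∸_) (sym (m≤n⇒m∸n≡0 (≤-trans (≤-reflexive lev-reg) (≤-trans high (≤-reflexive (sym rank-val))))))) e of λ ())
             (store-s _ _ ⨾ₛ assign-s (_ , _ , bag-room {bag = arr σ bagA} {x = x} bag-rep (unique-W S′)))) , ≤-refl ,
        record { searching = subst (λ P → Search F lev P D [ u ] todo (x ∷ waiting)) (sym flagP) S′
               ; adjacent = All.tail adjacent ; ranks = ranks
               ; bag-rep = bag-push bag-rep x≡ ; lev-reg = lev-reg ; u-reg = u-reg }
        where
        S′ = visit-high u~x (λ f → f z) searching high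

    open UniformNeighbourLoop visit _ _ 48 Visit (λ m i → i) (λ m i → i) (λ m i → i) visit-correct public

  -- The weight of the processed set is the potential: processing `u` takes at most
  -- `64 * (1 + deg u)`, namely 14 + 48 per neighbour and a constant. As `D` persists from level to
  -- level, all searches of an expansion together are linear. Fuel `n` suffices since `D` has no
  -- repetitions.
  search-correct : ∀ fuel {F lev D W σ} → n ≤ length D + fuel → Context σ → RankRep (arr σ rankA) F → var σ levᵣ ≡ lev →
    BagRep (var σ bpᵣ) (arr σ bagA) W → Search F lev (arr σ flagA) D [] [] W →
    ∃₂ λ σ′ T → ∃ λ D′ → Silently search σ T σ′ × T + 64 * total weight D ≤ 64 * total weight D′ + 3 ×
      BagRep (var σ′ bpᵣ) (arr σ′ bagA) [] × Search F lev (arr σ′ flagA) D′ [] [] []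
  search-correct _ {D = D} {[]} _ C R l≡ B@(bagRep z _) S =
    _ , _ , D , stop-s _ z , linear (64 * total weight D ∷ []) none (κ 3 ∔ # 0) (# 0 ∔ κ 3) , B , S
  search-correct zero {D = D} {u ∷ W} le C R l≡ B S =
    ⊥-elim (<⇒≱ (unique-length (unique-L (begin-visit nbrs⇐ S))) (subst (n ≤_) (+-identityʳ (length D)) le))
  search-correct (suc fuel) {F} {lev} {D} {u ∷ W} {σ} le C R l≡ (bagRep z (top , h)) S =
    let bp = var σ bpᵣ ∸ 1
        bp≡ : bp ≡ length W
        bp≡ = cong (_∸ 1) z
        m = arr σ bagA bp
        m≡ : m ≡ toℕ u
        m≡ = trans (cong (arr σ bagA) (trans bp≡ (sym (length-map toℕ W)))) top
        σ₁ = setVar (setVar σ bpᵣ bp) uᵣ m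
        σ₂ , T₁ , ex₁ , le₁ , I = forNeighbours-uniform {e = ! uᵣ} {u} {σ₁} _ m≡ (located C)
          record { searching = begin-visit nbrs⇐ S ; adjacent = All.tabulate nbrs⇒ ; ranks = R
                 ; bag-rep = bagRep bp≡ h ; lev-reg = l≡ ; u-reg = m≡ }
        open VisitState I
        σ₃ , T₂ , D′ , ex₂ , le₂ , B′ , S′ = search-correct fuel {F} {lev} {u ∷ D} {waiting} {σ₂}
          (subst (n ≤_) (+-suc (length D) fuel) le) (context-kept ex₁ C) ranks lev-reg bag-rep (end-visit searching)
    in σ₃ , _ , D′ , loop-s _ (λ e → case trans (sym z) e of λ ()) (assign-s _ ⨾ₛ assign-s _ ⨾ₛ ex₁) ex₂ ,
       linear (T₁ ∷ T₂ ∷ deg u ∷ deg u * 48 ∷ total weight D ∷ total weight D′ ∷ [])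
         (hyp 1 (# 0) (# 3 ∔ (14 · # 2 ∔ κ 15)) le₁
         (hyp 1 (# 1 ∔ 64 · (κ 1 ∔ # 2 ∔ # 4)) (64 · # 5 ∔ κ 3) le₂
         (hyp 1 (# 3) (48 · # 2) (≤-reflexive (*-comm (deg u) 48)) none)))
         (κ 3 ∔ (κ 4 ∔ (κ 9 ∔ # 0)) ∔ # 1 ∔ 64 · # 4) (64 · # 5 ∔ κ 3) ,
       B′ , S′
    where open Visiting F lev D u

  -- The stack of entries.

  record StackRep (sp : ℕ) (stack : ℕ → ℕ) (ws : List ℕ) : Set where
    constructor stackRep
    field
      stack-size : sp ≡ length ws
      stack-elts : StackHolds stack ws
  open StackRep public

  stack-push : ∀ {sp stack ws m m′} → m ≡ m′ → StackRep sp stack ws → StackRep (sp + 1) (stack [ sp ≔ m ]) (m′ ∷ ws)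
  stack-push refl (stackRep refl h) = stackRep (+-comm _ 1) (stackHolds-push _ _ _ h)

  reversedPath : Entry → List V
  reversedPath b = rest b ʳ++ prefix b

  -- The first two words, found first when popping, are the position from which
  -- the path may be changed and its length.
  words : Entry → List ℕ
  words b = length (prefix b) ∷ length (reversedPath b) ∷ map toℕ (reversedPath b)

  copy-correct : ∀ (e r : List V) {σ ws} → StackHolds (arr σ pathA) (map toℕ (e ʳ++ r)) → var σ iᵣ ≡ length (e ʳ++ r) →
    var σ jᵣ ≡ length r → StackRep (var σ spᵣ) (arr σ stackA) (map toℕ r ++ ws) → var σ spᵣ + length e ≤ Bd →
    ∃₂ λ σ′ T → Silently copying σ T σ′ ×
      T ≤ 29 * length e + 5 × var σ′ jᵣ ≡ length (e ʳ++ r) × StackRep (var σ′ spᵣ) (arr σ′ stackA) (map toℕ (e ʳ++ r) ++ ws) ×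
      var σ′ spᵣ ≡ var σ spᵣ + length e
  copy-correct [] r {σ} h i≡ j≡ st le = _ , _ , stop-s _ (trans (cong₂ _∸_ i≡ j≡) (n∸n≡0 (length r))) , ≤-refl , j≡ , st ,
    sym (+-identityʳ _)
  copy-correct (y ∷ e) r {σ} {ws} h i≡ j≡ st le =
    let y≡ : arr σ pathA (var σ jᵣ) ≡ toℕ y
        y≡ = trans (cong (arr σ pathA) (trans j≡ (sym (length-map toℕ r))))
               (proj₁ (stackHolds-suffix (arr σ pathA) (map toℕ e) (subst (StackHolds (arr σ pathA)) (map-ʳ++ toℕ e) h)))
        sp+1≤ : var σ spᵣ + 1 ≤ Bd
        sp+1≤ = linear (var σ spᵣ ∷ length e ∷ Bd ∷ []) (hyp 1 (# 0 ∔ (κ 1 ∔ # 1)) (# 2) le none) (# 0 ∔ κ 1) (# 2)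
        j≤sp : var σ jᵣ ≤ var σ spᵣ
        j≤sp = ≤-trans (≤-reflexive j≡) (≤-trans (≤-trans (≤-reflexive (sym (length-map toℕ r))) (m≤m+n _ _))
                 (≤-reflexive (trans (sym (length-++ (map toℕ r))) (sym (stack-size st)))))
        σ′ , T , ex , le′ , j′ , st′ , sp′ = copy-correct e (y ∷ r) {σ = setVar (setVar (setArr σ stackA (var σ spᵣ) (arr σ pathA (var σ jᵣ))) spᵣ (var σ spᵣ + 1)) jᵣ (var σ jᵣ + 1)}
          h i≡ (trans (+-comm _ 1) (cong suc j≡)) (stack-push y≡ st)
          (subst (_≤ Bd) (sym (+-assoc (var σ spᵣ) 1 (length e))) le)
    in σ′ , _ , loop-s _ (λ z → <⇒≱ (n<j j≡) (≤-trans (≤-reflexive (sym i≡)) (m∸n≡0⇒m≤n z)))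
         ((store-s _ _ ⨾ₛ assign-s (_ , _ , sp+1≤)) ⨾ₛ assign-s (_ , _ , ≤-trans (+-monoˡ-≤ 1 j≤sp) sp+1≤)) ex ,
       linear (T ∷ length e ∷ []) (hyp 1 (# 0) (29 · # 1 ∔ κ 5) le′ none) (κ 29 ∔ # 0) (29 · (κ 1 ∔ # 1) ∔ κ 5) ,
       j′ , st′ , trans sp′ (+-assoc (var σ spᵣ) 1 (length e))
    where
    n<j : ∀ {j} → j ≡ length r → j < length (e ʳ++ (y ∷ r))
    n<j refl = ≤-trans (m≤n+m _ (length e)) (≤-reflexive (sym (length-ʳ++ e)))

  -- The loop stops in front of `t`, whose flag holds no parent; `pushEntry` adds `t` afterwards.
  -- Hence `t` is split off from the reversed path in the conclusion.
  chain-correct : ∀ {y : V} (c r : List V) {σ ws} → ChordlessTo (y ∷ c) → Follows (arr σ flagA) (y ∷ c) → var σ yᵣ ≡ toℕ y → var σ tᵣ ≡ toℕ t →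
    var σ jᵣ ≡ length r → StackRep (var σ spᵣ) (arr σ stackA) (map toℕ r ++ ws) → var σ spᵣ + length c ≤ Bd →
    ∃₂ λ σ′ T → ∃ λ r′ → Silently chaining σ T σ′ ×
      T ≤ 41 * length c + 13 × c ʳ++ (y ∷ r) ≡ t ∷ r′ × var σ′ jᵣ ≡ length r′ ×
      StackRep (var σ′ spᵣ) (arr σ′ stackA) (map toℕ r′ ++ ws) × var σ′ spᵣ ≡ var σ spᵣ + length c
  chain-correct [] r {σ} [t] fo y≡ t≡ j≡ st le = _ , _ , r ,
    stop-s _ (cong (1 ∸_) (equal-yes (trans y≡ (sym t≡)))) , ≤-refl , refl , j≡ , st , sym (+-identityʳ _)
  chain-correct {y} (u ∷ c) r {σ} {ws} p@(prepend _ _ p′) (yu , fo) y≡ t≡ j≡ st le =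
    let sp+1≤ : var σ spᵣ + 1 ≤ Bd
        sp+1≤ = linear (var σ spᵣ ∷ length c ∷ Bd ∷ []) (hyp 1 (# 0 ∔ (κ 1 ∔ # 1)) (# 2) le none) (# 0 ∔ κ 1) (# 2)
        j≤sp : var σ jᵣ ≤ var σ spᵣ
        j≤sp = ≤-trans (≤-reflexive j≡) (≤-trans (≤-trans (≤-reflexive (sym (length-map toℕ r))) (m≤m+n _ _))
                 (≤-reflexive (trans (sym (length-++ (map toℕ r))) (sym (stack-size st)))))
        σ₁ = setVar (setVar (setVar (setArr σ stackA (var σ spᵣ) (var σ yᵣ)) spᵣ (var σ spᵣ + 1)) jᵣ (var σ jᵣ + 1)) yᵣ (arr σ flagA (var σ yᵣ) ∸ 1)
        σ′ , T , r′ , ex , le′ , eq , j′ , st′ , sp′ = chain-correct c (y ∷ r) {σ = σ₁} p′ fo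
          (cong (_∸ 1) (trans (cong (arr σ flagA) y≡) yu)) t≡ (trans (+-comm _ 1) (cong suc j≡)) (stack-push y≡ st)
          (subst (_≤ Bd) (sym (+-assoc (var σ spᵣ) 1 (length c))) le)
    in σ′ , _ , r′ ,
       loop-s _ (λ z → case trans (sym (cong (1 ∸_) (equal-no (λ e → not-t p (Fin.toℕ-injective (trans (sym y≡) (trans e t≡))))))) z of λ ())
         ((store-s _ _ ⨾ₛ assign-s (_ , _ , sp+1≤)) ⨾ₛ assign-s (_ , _ , ≤-trans (+-monoˡ-≤ 1 j≤sp) sp+1≤) ⨾ₛ assign-s _) ex ,
       linear (T ∷ length c ∷ []) (hyp 1 (# 0) (41 · # 1 ∔ κ 13) le′ none) (κ 41 ∔ # 0) (41 · (κ 1 ∔ # 1) ∔ κ 13) ,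
       eq , j′ , st′ , trans sp′ (+-assoc (var σ spᵣ) 1 (length c))

  -- Copying takes 29 instructions per vertex and chaining 41. Prefix and chain together form a path
  -- of at most `n` vertices, so the larger rate applies only once.
  push-correct : ∀ {x : V} {r c : List V} {σ ws} → StackHolds (arr σ pathA) (map toℕ r) → var σ iᵣ ≡ length r → var σ xᵣ ≡ toℕ x → var σ tᵣ ≡ toℕ t →
    ChordlessTo (x ∷ c) → Follows (arr σ flagA) (x ∷ c) → length (c ʳ++ (x ∷ r)) ≤ n →
    StackRep (var σ spᵣ) (arr σ stackA) ws → var σ spᵣ + E ≤ Bd →
    ∃₂ λ σ′ T → Silently pushEntry σ T σ′ × T ≤ 41 * n + 67 × StackRep (var σ′ spᵣ) (arr σ′ stackA) (words (entry (x ∷ r) c) ++ ws)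
  push-correct {x} {r} {c} {σ} {ws} h i≡ x≡ t≡ p fo len st room =
    case copy-correct (reverse r) [] {setVar σ jᵣ 0} {ws} (subst (λ r → StackHolds (arr σ pathA) (map toℕ r)) (sym r≡) h)
           (trans i≡ (cong length (sym r≡))) refl st room₁ of λ { (σ₁ , T₁ , ex₁ , le₁ , j₁ , st₁ , sp₁) →
    case chain-correct c r {setVar σ₁ yᵣ (var σ₁ xᵣ)} {ws} p
           (subst (λ f → Follows f (x ∷ c)) (sym (keptArr ex₁ flagA)) fo)
           (trans (kept ex₁ xᵣ) x≡) (trans (kept ex₁ tᵣ) t≡) (trans j₁ (cong length r≡))
           (subst (λ r → StackRep (var σ₁ spᵣ) (arr σ₁ stackA) (map toℕ r ++ ws)) r≡ st₁)
           (room-after-copy sp₁) of λ { (σ₂ , T₂ , r′ , ex₂ , le₂ , eq , j₂ , st₂ , sp₂) →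
    let i₂ = trans (kept ex₂ iᵣ) (trans (kept ex₁ iᵣ) i≡)
        t₂ = trans (kept ex₂ tᵣ) (trans (kept ex₁ tᵣ) t≡)
        len₃ = cong length (sym eq)
    in finish-push ex₁ le₁ ex₂ le₂ i₂ t₂ len₃ j₂ (room-after-chain sp₁ sp₂)
         (subst (λ l → StackRep (var σ₂ spᵣ + 1) (arr σ₂ stackA [ var σ₂ spᵣ ≔ var σ₂ tᵣ ]) (map toℕ l ++ ws)) (sym eq)
           (stack-push t₂ st₂)) } }
    where
    r≡ : reverse r ʳ++ [] ≡ r
    r≡ = reverse-involutive r
    len-r : length (reverse r) ≡ length r
    len-r = trans (length-ʳ++ r {[]}) (+-identityʳ (length r))
    total-len : length c + (1 + length r) ≤ n
    total-len = subst (_≤ n) (length-ʳ++ c) len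
    room₁ : var σ spᵣ + length (reverse r) ≤ Bd
    room₁ = linear (var σ spᵣ ∷ length (reverse r) ∷ length r ∷ length c ∷ n ∷ Bd ∷ [])
      (hyp 1 (# 1) (# 2) (≤-reflexive len-r) (hyp 1 (# 3 ∔ (κ 1 ∔ # 2)) (# 4) total-len (hyp 1 (# 0 ∔ (κ 2 ∔ # 4)) (# 5) room none)))
      (# 0 ∔ # 1) (# 5)
    room-after-copy : ∀ {sp₁} → sp₁ ≡ var σ spᵣ + length (reverse r) → sp₁ + length c ≤ Bd
    room-after-copy {sp₁} e = linear (var σ spᵣ ∷ length (reverse r) ∷ length r ∷ length c ∷ n ∷ Bd ∷ sp₁ ∷ [])
      (hyp 1 (# 1) (# 2) (≤-reflexive len-r) (hyp 1 (# 3 ∔ (κ 1 ∔ # 2)) (# 4) total-len (hyp 1 (# 0 ∔ (κ 2 ∔ # 4)) (# 5) room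
      (hyp 1 (# 6) (# 0 ∔ # 1) (≤-reflexive e) none))))
      (# 6 ∔ # 3) (# 5)
    room-after-chain : ∀ {sp₁ sp₂} → sp₁ ≡ var σ spᵣ + length (reverse r) → sp₂ ≡ sp₁ + length c → sp₂ + 3 ≤ Bd
    room-after-chain {sp₁} {sp₂} e₁ e₂ = linear (var σ spᵣ ∷ length (reverse r) ∷ length r ∷ length c ∷ n ∷ Bd ∷ sp₁ ∷ sp₂ ∷ [])
      (hyp 1 (# 1) (# 2) (≤-reflexive len-r) (hyp 1 (# 3 ∔ (κ 1 ∔ # 2)) (# 4) total-len (hyp 1 (# 0 ∔ (κ 2 ∔ # 4)) (# 5) room
      (hyp 1 (# 6) (# 0 ∔ # 1) (≤-reflexive e₁) (hyp 1 (# 7) (# 6 ∔ # 3) (≤-reflexive e₂) none)))))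
      (# 7 ∔ κ 3) (# 5)
    finish-push : ∀ {σ₁ T₁ σ₂ T₂} {l : ℕ} {ws′} → Silently copying (setVar σ jᵣ 0) T₁ σ₁ → T₁ ≤ 29 * length (reverse r) + 5 →
      Silently chaining (setVar σ₁ yᵣ (var σ₁ xᵣ)) T₂ σ₂ → T₂ ≤ 41 * length c + 13 →
      var σ₂ iᵣ ≡ length r → var σ₂ tᵣ ≡ toℕ t → 1 + l ≡ length (c ʳ++ (x ∷ r)) → var σ₂ jᵣ ≡ l → var σ₂ spᵣ + 3 ≤ Bd →
      StackRep (var σ₂ spᵣ + 1) (arr σ₂ stackA [ var σ₂ spᵣ ≔ var σ₂ tᵣ ]) ws′ →
      ∃₂ λ σ′ T → Silently pushEntry σ T σ′ × T ≤ 41 * n + 67 ×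
        StackRep (var σ′ spᵣ) (arr σ′ stackA) (suc (length r) ∷ length (c ʳ++ (x ∷ r)) ∷ ws′)
    finish-push {σ₁} {T₁} {σ₂} {T₂} ex₁ le₁ ex₂ le₂ i₂ t₂ len₃ j₂ room₂ st₂ =
      let sp = var σ₂ spᵣ
          shift : ∀ a → sp + (1 + a) ≤ Bd → (sp + 1) + a ≤ Bd
          shift a = subst (_≤ Bd) (sym (+-assoc sp 1 a))
          j+1≡ : var σ₂ jᵣ + 1 ≡ length (c ʳ++ (x ∷ r))
          j+1≡ = trans (+-comm _ 1) (trans (cong suc j₂) len₃)
          i+1≡ : var σ₂ iᵣ + 1 ≡ suc (length r)
          i+1≡ = trans (cong (_+ 1) i₂) (+-comm _ 1)
      in _ , _ ,
       (assign-s _ ⨾ₛ ex₁ ⨾ₛ assign-s _ ⨾ₛ ex₂ ⨾ₛ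
        (store-s _ _ ⨾ₛ assign-s (_ , _ , ≤-trans (+-monoʳ-≤ sp (s≤s z≤n)) room₂)) ⨾ₛ
        assign-s (_ , _ , ≤-trans (≤-reflexive j+1≡) (≤-trans len n≤Bd)) ⨾ₛ
        (store-s _ _ ⨾ₛ assign-s (_ , _ , shift 1 (≤-trans (+-monoʳ-≤ sp (s≤s (s≤s z≤n))) room₂))) ⨾ₛ
        (store-s _ (_ , _ , ≤-trans (≤-reflexive i+1≡) (≤-trans (m≤n+m (1 + length r) (length c)) (≤-trans total-len n≤Bd)))
         ⨾ₛ assign-s (_ , _ , subst (_≤ Bd) (sym (+-assoc (sp + 1) 1 1)) (shift 2 room₂)))) ,
       linear (T₁ ∷ T₂ ∷ length (reverse r) ∷ length r ∷ length c ∷ n ∷ [])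
         (hyp 1 (# 0) (29 · # 2 ∔ κ 5) le₁ (hyp 1 (# 1) (41 · # 4 ∔ κ 13) le₂ (hyp 29 (# 2) (# 3) (≤-reflexive len-r)
         (hyp 41 (# 4 ∔ (κ 1 ∔ # 3)) (# 5) total-len none))))
         (κ 2 ∔ (# 0 ∔ (κ 2 ∔ (# 1 ∔ (κ 13 ∔ (κ 4 ∔ (κ 13 ∔ κ 15))))))) (41 · # 5 ∔ κ 67) ,
       stack-push i+1≡ (stack-push j+1≡ st₂)

  allWords : List Entry → List ℕ
  allWords []       = []
  allWords (b ∷ bs) = words b ++ allWords bs

  solution-length : ∀ {p} → Solution p → length p ≤ n
  solution-length (_ , c) = unique-length (unique c)

  entry-length : ∀ b → Solution (path b) → length (reversedPath b) ≤ n
  entry-length b S = ≤-trans (≤-reflexive (trans (length-ʳ++ (rest b)) (trans (+-comm (length (rest b)) _) (sym (length-ʳ++ (prefix b))))))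
                             (solution-length S)

  words-length : ∀ b → Solution (path b) → length (words b) ≤ E
  words-length b S = s≤s (s≤s (≤-trans (≤-reflexive (length-map toℕ (reversedPath b))) (entry-length b S)))

  allWords-length : ∀ bs → All (Solution ∘ path) bs → length (allWords bs) ≤ length bs * E
  allWords-length []       []       = z≤n
  allWords-length (b ∷ bs) (S ∷ Ss) = ≤-trans (≤-reflexive (length-++ (words b))) (+-mono-≤ (words-length b S) (allWords-length bs Ss))

  pushTime : ℕ
  pushTime = 41 * n + 67

  module Scanning {F : V → ℕ} {P : ℕ → ℕ} {D : List V} {r₀ : V} {r₁ : List V} {q : V} {c₀ : List V}
                  (SQ : Solution ((r₀ ∷ r₁) ʳ++ (q ∷ c₀))) (R : Ranks F (r₀ ∷ r₁)) (R₁ : Ranks F r₁)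
                  (S : Search F (suc (length (r₀ ∷ r₁))) P D [] [] [])
                  (below : List ℕ) (room : length below + Wt * E ≤ Bd) (limit : ℕ) (limit≤ : limit ≤ Wt) (debt credit : ℕ) where
    private
      r = r₀ ∷ r₁
    open Level {c₀ = c₀} SQ R R₁ S

    -- `time-spent` amortises: each neighbour contributes 73, the time of a step on `q`, and each
    -- new branch adds `pushTime`. `credit` stands for the 73 per neighbour granted at the start,
    -- and `debt` for the pushes of earlier levels. In `few`, a neighbour yields at most one branch,
    -- which bounds the room on the stack.
    record ScanState (todo : List V) (τ : ℕ) (rank flags bag pathw stack : ℕ → ℕ) (bp sp i′ t′ : ℕ) : Set where
      field
        {waiting}   : List V
        {branches}  : List Entry
        scan-inv    : Scan F (length r) P todo waiting
        branch-inv  : Scanned todo branches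
        todo-unique : Unique todo
        flags≡      : flags ≡ P
        ranks       : RankRep rank F
        path-rep    : StackHolds pathw (map toℕ (q ∷ r))
        bag-rep     : BagRep bp bag waiting
        stack-rep   : StackRep sp stack (allWords branches ++ below)
        i-reg       : i′ ≡ length r
        t-reg′      : t′ ≡ toℕ t
        few         : length branches + length todo ≤ limit
        time-spent  : τ + 73 * length todo + debt ≤ credit + pushTime * length branches

    ScanI : List V → ℕ → Store → Set
    ScanI todo τ σ = ScanState todo τ (arr σ rankA) (arr σ flagA) (arr σ bagA) (arr σ pathA) (arr σ stackA)
                               (var σ bpᵣ) (var σ spᵣ) (var σ iᵣ) (var σ tᵣ)

    module _ {x : V} {todo : List V} {τ : ℕ} {σ : Store} (x≡ : var σ xᵣ ≡ toℕ x) (I : ScanI (x ∷ todo) τ σ) where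
      open ScanState I
      private
        Result : Set
        Result = ∃₂ λ σ′ τ′ → Silently scan σ τ′ σ′ × ScanI todo (τ + τ′) σ′

        rank-val : arr σ rankA (var σ xᵣ) ≡ F x
        rank-val = trans (cong (arr σ rankA) x≡) (ranks x)

        flag-val : arr σ flagA (var σ xᵣ) ≡ P (toℕ x)
        flag-val = trans (cong (arr σ flagA) x≡) (cong (_$ toℕ x) flags≡)

        q-val : arr σ pathA (var σ iᵣ) ≡ toℕ q
        q-val = trans (cong (arr σ pathA) (trans i-reg (sym (length-map toℕ r)))) (proj₁ path-rep)

        x∉todo : x ∉ todo
        x∉todo x∈ with todo-unique
        ... | x∉ ∷ _ = All.lookup x∉ x∈ refl

        unique-tail : Unique todo
        unique-tail with todo-unique
        ... | _ ∷ u = u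

        spend : ∀ {τ′} → τ′ ≤ 73 → (τ + τ′) + 73 * length todo + debt ≤ credit + pushTime * length branches
        spend {τ′} le = linear (τ ∷ τ′ ∷ length todo ∷ credit ∷ pushTime * length branches ∷ debt ∷ [])
          (hyp 1 (# 0 ∔ 73 · (κ 1 ∔ # 2) ∔ # 5) (# 3 ∔ # 4) time-spent (hyp 1 (# 1) (κ 73) le none)) (# 0 ∔ # 1 ∔ 73 · # 2 ∔ # 5) (# 3 ∔ # 4)

        fewer : length branches + length todo ≤ limit
        fewer = ≤-trans (+-monoʳ-≤ (length branches) (n≤1+n _)) few

        idle : ∀ {τ′} → τ′ ≤ 73 → ¬ (Flagged P x × F x ≡ length r) → ScanI todo (τ + τ′) σ
        idle le unfit = record
          { scan-inv = scan-skip unfit scan-inv ; branch-inv = scanned-skip (inj₂ unfit) branch-inv ; todo-unique = unique-tail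
          ; flags≡ = flags≡ ; ranks = ranks ; path-rep = path-rep ; bag-rep = bag-rep ; stack-rep = stack-rep
          ; i-reg = i-reg ; t-reg′ = t-reg′ ; few = fewer ; time-spent = spend le }

        module Taken (Fx : F x ≡ length r) (fx : Flagged P x) where
          scan′ : Scan F (length r) P todo (x ∷ waiting)
          scan′ = scan-take fx Fx x∉todo scan-inv

          guard₁ : eval σ (equal (rankA ‹ ! xᵣ ›) (! iᵣ)) ≢ 0
          guard₁ z = case trans (sym (equal-yes (trans rank-val (trans Fx (sym i-reg))))) z of λ ()

          guard₂ : eval σ (flagA ‹ ! xᵣ ›) ≢ 0
          guard₂ z = fx (trans (sym flag-val) z)

          room-in-bag : var σ bpᵣ + 1 ≤ Bd
          room-in-bag = bag-room {bag = arr σ bagA} {x = x} bag-rep (scan-unique scan′)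

          old : x ≡ q → Result
          old refl = _ , _ ,
            when-s _ guard₁ (when-s _ guard₂
              (unless-s _ (cong (1 ∸_) (equal-yes (trans x≡ (sym q-val)))) ⨾ₛ store-s _ _ ⨾ₛ assign-s (_ , _ , room-in-bag))) ,
            record { scan-inv = scan′ ; branch-inv = scanned-skip (inj₁ refl) branch-inv ; todo-unique = unique-tail
                   ; flags≡ = flags≡ ; ranks = ranks ; path-rep = path-rep ; bag-rep = bag-push bag-rep x≡ ; stack-rep = stack-rep
                   ; i-reg = i-reg ; t-reg′ = t-reg′ ; few = fewer ; time-spent = spend ≤-refl }

          new : x ≢ q → Result
          new x≢q =
            case chain S fx of λ { (c , p , fo , al) →
            let Sx = branch-solution fx Fx p al
                b  = entry (x ∷ r) c
            in case push-correct {x} {r} {c} {σ} (proj₂ path-rep) i-reg x≡ t-reg′ p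
                 (subst (λ f → Follows f (x ∷ c)) (sym flags≡) fo) (entry-length b Sx) stack-rep room-to-push of λ { (σ₁ , T , ex , le , st) →
               _ , _ ,
               when-s _ guard₁ (when-s _ guard₂
                 (when-s _ (λ z → case trans (sym (cong (1 ∸_) (equal-no (λ e → x≢q (Fin.toℕ-injective (trans (sym x≡) (trans e q-val))))))) z of λ ()) ex
                  ⨾ₛ store-s _ _ ⨾ₛ assign-s (_ , _ , subst (λ m → m + 1 ≤ Bd) (sym (kept ex bpᵣ)) room-in-bag))) ,
               record
                 { scan-inv = scan′ ; branch-inv = scanned-take x≢q x∉todo Sx branch-inv ; todo-unique = unique-tail
                 ; flags≡ = trans (keptArr ex flagA) flags≡
                 ; ranks = subst (λ f → RankRep f F) (sym (keptArr ex rankA)) ranks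
                 ; path-rep = subst (λ f → StackHolds f (map toℕ (q ∷ r))) (sym (keptArr ex pathA)) path-rep
                 ; bag-rep = bag-push (subst₂ (λ m f → BagRep m f waiting) (sym (kept ex bpᵣ)) (sym (keptArr ex bagA)) bag-rep)
                                      (trans (kept ex xᵣ) x≡)
                 ; stack-rep = subst (StackRep _ _) (sym (++-assoc (words b) (allWords branches) below)) st
                 ; i-reg = trans (kept ex iᵣ) i-reg ; t-reg′ = trans (kept ex tᵣ) t-reg′
                 ; few = subst (_≤ limit) (+-suc (length branches) (length todo)) few
                 ; time-spent = time-new le } } }
            where
            room-to-push : var σ spᵣ + E ≤ Bd
            room-to-push = begin
              var σ spᵣ + E ≡⟨ cong (_+ E) (stack-size stack-rep) ⟩
              length (allWords branches ++ below) + E ≡⟨ cong (_+ E) (length-++ (allWords branches)) ⟩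
              length (allWords branches) + length below + E ≤⟨ +-monoˡ-≤ E (+-monoˡ-≤ (length below) (allWords-length branches (sc-solutions branch-inv))) ⟩
              length branches * E + length below + E ≡⟨ cong (_+ E) (+-comm (length branches * E) (length below)) ⟩
              length below + length branches * E + E ≡⟨ +-assoc (length below) _ E ⟩
              length below + (length branches * E + E) ≡⟨ cong (length below +_) (+-comm (length branches * E) E) ⟩
              length below + suc (length branches) * E
                ≤⟨ +-monoʳ-≤ (length below) (*-monoˡ-≤ E (≤-trans (≤-trans (m≤m+n (suc (length branches)) (length todo))
                     (≤-trans (≤-reflexive (sym (+-suc (length branches) (length todo)))) few)) limit≤)) ⟩
              length below + Wt * E ≤⟨ room ⟩
              Bd ∎
              where open ≤-Reasoning

            time-new : ∀ {T} → T ≤ pushTime → (τ + (24 + (9 + (26 + T + 13)))) + 73 * length todo + debt ≤ credit + pushTime * suc (length branches)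
            time-new {T} le = ≤-trans
              (linear (τ ∷ T ∷ length todo ∷ credit ∷ pushTime * length branches ∷ pushTime ∷ debt ∷ [])
                (hyp 1 (# 0 ∔ 73 · (κ 1 ∔ # 2) ∔ # 6) (# 3 ∔ # 4) time-spent (hyp 1 (# 1) (# 5) le none))
                (# 0 ∔ (κ 24 ∔ (κ 9 ∔ (κ 26 ∔ # 1 ∔ κ 13))) ∔ 73 · # 2 ∔ # 6) (# 3 ∔ (# 5 ∔ # 4)))
              (≤-reflexive (cong (credit +_) (sym (*-suc pushTime (length branches)))))

      scan-correct : Result
      scan-correct with F x ≟ length r
      ... | no F≢ = _ , _ , unless-s _ (equal-no (λ e → F≢ (trans (sym rank-val) (trans e i-reg)))) ,
                    idle (m≤m+n 25 48) (F≢ ∘ proj₂)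
      ... | yes Fx with P (toℕ x) ≟ 0
      ...   | yes z = _ , _ ,
                    when-s _ (λ z → case trans (sym (equal-yes (trans rank-val (trans Fx (sym i-reg))))) z of λ ())
                      (unless-s _ (trans flag-val z)) , idle (m≤m+n 34 39) (λ f → proj₁ f z)
      ...   | no fx with x Fin.≟ q
      ...     | yes e = Taken.old Fx fx e
      ...     | no ne = Taken.new Fx fx ne

    open NeighbourLoop scan _ _ ScanI (λ m i → i) (λ m i → i) (λ m i → i) scan-correct public

  levelBody : Cmd
  levelBody = decrement iᵣ ⨾ forNeighbours (pathA ‹ ! iᵣ ⊖ lit 1 ›) scan ⨾ levᵣ ← ! iᵣ ⨾ search

  module Levels (F : V → ℕ) (start : ℕ) (below : List ℕ) (room : length below + Wt * E ≤ Bd) where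

    -- In `few`, the branches found are charged to the path vertices whose neighbours have been
    -- scanned. Position `i` scans the vertex before it, so those still to come are `drop 1 cur`.
    record LevelState (cur d D : List V) (bs : List Entry) (σ : Store) : Set where
      field
        context    : Context σ
        solution   : Solution (cur ʳ++ d)
        ranked     : AllRanks F cur
        ranks      : RankRep (arr σ rankA) F
        path-rep   : StackHolds (arr σ pathA) (map toℕ cur)
        i-reg      : var σ iᵣ ≡ length cur
        start-reg  : var σ startᵣ ≡ start
        bag-rep    : BagRep (var σ bpᵣ) (arr σ bagA) []
        searched   : Search F (length cur) (arr σ flagA) D [] [] []
        branch-inv : Branches cur (cur ʳ++ d) bs
        stack-rep  : StackRep (var σ spᵣ) (arr σ stackA) (allWords bs ++ below)
        few        : length bs + total weight (drop 1 cur) ≤ Wt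

    potential : List V → List Entry → ℕ
    potential D bs = 64 * total weight D + pushTime * length bs

    -- Growth of `potential` pays for the search and for the pushes; what remains is the scan of the
    -- neighbours of `r₀`, with 87 = 14 + 73 for each of them.
    level-correct : ∀ {q r₀ r₁ d D bs σ} → LevelState (q ∷ r₀ ∷ r₁) d D bs σ →
      ∃₂ λ σ′ T → ∃₂ λ D′ bs′ → Silently levelBody σ T σ′ × LevelState (r₀ ∷ r₁) (q ∷ d) D′ bs′ σ′ ×
        T + potential D bs ≤ potential D′ bs′ + (87 * deg r₀ + 33)
    level-correct {q} {r₀} {r₁} {d} {D} {bs} {σ} L =
      case forNeighbours-correct {e = pathA ‹ ! iᵣ ⊖ lit 1 ›} {r₀} {0} {setVar σ iᵣ (var σ iᵣ ∸ 1)} _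
             (trans (cong (λ i → arr σ pathA (i ∸ 1 ∸ 1)) i-reg)
               (trans (cong (arr σ pathA) (sym (length-map toℕ r₁))) (proj₁ (proj₂ path-rep))))
             (located context)
             (record { scan-inv = scan-start nbrs⇐ ; branch-inv = scanned-start nbrs⇐ branch-inv ; todo-unique = nbrs-unique r₀
                     ; flags≡ = refl ; ranks = ranks ; path-rep = path-rep ; bag-rep = bag-rep ; stack-rep = stack-rep
                     ; i-reg = cong (_∸ 1) i-reg ; t-reg′ = t-reg context ; few = ≤-refl ; time-spent = ≤-refl })
      of λ { (σ₂ , T₁ , τ , ex₁ , le₁ , I) → after-scan ex₁ le₁ I }
      where
      open LevelState L
      r = r₀ ∷ r₁
      few′ : length bs + (weight r₀ + total weight r₁) ≤ Wt
      few′ = few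
      limit : ℕ
      limit = length bs + deg r₀
      limit≤ : limit ≤ Wt
      limit≤ = linear (length bs ∷ deg r₀ ∷ total weight r₁ ∷ Wt ∷ []) (hyp 1 (# 0 ∔ (κ 1 ∔ # 1 ∔ # 2)) (# 3) few′ none) (# 0 ∔ # 1) (# 3)
      R₁ : Ranks F r₁
      R₁ = allRanks-head r₁ (proj₂ (proj₂ ranked))
      R : Ranks F r
      R = proj₁ (proj₂ ranked)
      open Level {c₀ = d} solution R R₁ searched
      open Scanning {c₀ = d} solution R R₁ searched below room limit limit≤ (pushTime * length bs) (73 * deg r₀)

      after-scan : ∀ {T₁ τ σ₂} → Silently (forNeighbours (pathA ‹ ! iᵣ ⊖ lit 1 ›) scan) (setVar σ iᵣ (var σ iᵣ ∸ 1)) T₁ σ₂ →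
        T₁ + 0 ≤ τ + (14 * deg r₀ + 24) → ScanI [] τ σ₂ →
        ∃₂ λ σ′ T → ∃₂ λ D′ bs′ → Silently levelBody σ T σ′ × LevelState r (q ∷ d) D′ bs′ σ′ ×
          T + potential D bs ≤ potential D′ bs′ + (87 * deg r₀ + 33)
      after-scan {T₁} {τ} {σ₂} ex₁ le₁ I =
        case search-correct n {F} {length r} {D} {I.waiting} {setVar σ₂ levᵣ (var σ₂ iᵣ)} (m≤n+m n (length D))
               (context-kept ex₁ context) I.ranks I.i-reg I.bag-rep
               (subst (λ P → Search F (length r) P D [] [] I.waiting) (sym I.flags≡) (end-scan searched I.scan-inv))
        of λ { (σ₄ , T₂ , D′ , ex₂ , le₂ , B , S) →
          σ₄ , _ , D′ , I.branches ,
          (assign-s _ ⨾ₛ ex₁ ⨾ₛ assign-s _ ⨾ₛ ex₂) ,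
          record
            { context = context-kept ex₂ (context-kept ex₁ context)
            ; solution = solution ; ranked = proj₂ ranked
            ; ranks = subst (λ f → RankRep f F) (sym (keptArr ex₂ rankA)) I.ranks
            ; path-rep = subst (λ f → StackHolds f (map toℕ r)) (sym (keptArr ex₂ pathA)) (proj₂ I.path-rep)
            ; i-reg = trans (kept ex₂ iᵣ) I.i-reg
            ; start-reg = trans (kept ex₂ startᵣ) (trans (kept ex₁ startᵣ) start-reg)
            ; bag-rep = B ; searched = S ; branch-inv = scanned-end I.branch-inv
            ; stack-rep = subst₂ (λ m f → StackRep m f (allWords I.branches ++ below)) (sym (kept ex₂ spᵣ)) (sym (keptArr ex₂ stackA)) I.stack-rep
            ; few = linear (length bs ∷ deg r₀ ∷ total weight r₁ ∷ Wt ∷ length I.branches ∷ [])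
                (hyp 1 (# 0 ∔ (κ 1 ∔ # 1 ∔ # 2)) (# 3) few′ (hyp 1 (# 4 ∔ κ 0) (# 0 ∔ # 1) I.few none)) (# 4 ∔ # 2) (# 3) } ,
          linear (T₁ ∷ T₂ ∷ τ ∷ deg r₀ ∷ total weight D ∷ total weight D′ ∷ pushTime * length bs ∷ pushTime * length I.branches ∷ [])
            (hyp 1 (# 0 ∔ κ 0) (# 2 ∔ (14 · # 3 ∔ κ 24)) le₁
            (hyp 1 (# 1 ∔ 64 · # 4) (64 · # 5 ∔ κ 3) le₂
            (hyp 1 (# 2 ∔ κ 0 ∔ # 6) (73 · # 3 ∔ # 7) I.time-spent none)))
            (κ 4 ∔ (# 0 ∔ (κ 2 ∔ # 1)) ∔ (64 · # 4 ∔ # 6)) (64 · # 5 ∔ # 7 ∔ (87 · # 3 ∔ κ 33)) }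
        where module I = ScanState I

    LevelsResult : List V → List V → List V → List V → List Entry → Store → Set
    LevelsResult cur d rp D bs σ = ∃₂ λ σ′ T → ∃₂ λ D′ bs′ → ∃ λ d′ → Silently levels σ T σ′ × LevelState rp d′ D′ bs′ σ′ ×
        T + potential D bs ≤ potential D′ bs′ + (87 * total weight (drop 1 cur) + 5) × rp ʳ++ d′ ≡ cur ʳ++ d

    levels-step : ∀ {q r₀ r₁ rp d D bs σ} → start < length (q ∷ r₀ ∷ r₁) → LevelState (q ∷ r₀ ∷ r₁) d D bs σ →
      (∀ {D bs σ} → LevelState (r₀ ∷ r₁) (q ∷ d) D bs σ → LevelsResult (r₀ ∷ r₁) (q ∷ d) rp D bs σ) → LevelsResult (q ∷ r₀ ∷ r₁) d rp D bs σ
    levels-step {q} {r₀} {r₁} {D = D} {bs} {σ} lt L continue =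
      case level-correct L of λ { (σ₁ , T₁ , D₁ , bs₁ , ex₁ , L₁ , le₁) →
      case continue L₁ of λ { (σ₂ , T₂ , D₂ , bs₂ , d₂ , ex₂ , L₂ , le₂ , Q≡) →
        σ₂ , _ , D₂ , bs₂ , d₂ ,
        loop-s _ (λ z → <⇒≱ lt (≤-trans (≤-reflexive (sym i-reg)) (≤-trans (m∸n≡0⇒m≤n z) (≤-reflexive start-reg)))) ex₁ ex₂ , L₂ ,
        linear (T₁ ∷ T₂ ∷ potential D bs ∷ potential D₁ bs₁ ∷ potential D₂ bs₂ ∷ deg r₀ ∷ total weight r₁ ∷ [])
          (hyp 1 (# 0 ∔ # 2) (# 3 ∔ (87 · # 5 ∔ κ 33)) le₁ (hyp 1 (# 1 ∔ # 3) (# 4 ∔ (87 · # 6 ∔ κ 5)) le₂ none))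
          (κ 5 ∔ # 0 ∔ # 1 ∔ # 2) (# 4 ∔ (87 · (κ 1 ∔ # 5 ∔ # 6) ∔ κ 5)) , Q≡ } }
      where open LevelState L

    levels-correct : ∀ rc {r₀ r₁ d D bs σ} → start ≡ length (r₀ ∷ r₁) → LevelState (rc ++ r₀ ∷ r₁) d D bs σ →
      LevelsResult (rc ++ r₀ ∷ r₁) d (r₀ ∷ r₁) D bs σ
    levels-correct [] {r₀} {r₁} {d} {D} {bs} {σ} refl L = σ , _ , D , bs , d ,
      stop-s _ (m≤n⇒m∸n≡0 (≤-trans (≤-reflexive i-reg) (≤-reflexive (sym start-reg)))) , L ,
      linear (potential D bs ∷ total weight r₁ ∷ []) none (κ 5 ∔ # 0) (# 0 ∔ (87 · # 1 ∔ κ 5)) , refl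
      where open LevelState L
    -- One level needs two leading vertices, the second being the one scanned; here it comes from
    -- the fixed prefix.
    levels-correct (q ∷ []) refl L = levels-step ≤-refl L (levels-correct [] refl)
    levels-correct (q ∷ a ∷ rc) {r₀} {r₁} refl L = levels-step longer-list L (levels-correct (a ∷ rc) refl)
      where
      longer-list : length (r₀ ∷ r₁) < length (q ∷ a ∷ rc ++ r₀ ∷ r₁)
      longer-list = s≤s (≤-trans (m≤n+m (length (r₀ ∷ r₁)) (length rc)) (≤-trans (≤-reflexive (sym (length-++ rc))) (n≤1+n _)))

  module _ {e : Exp} (m l : ℕ) (cheap : cost e ≤ 3) (value : ∀ {σ} → var σ lᵣ ≡ l → Safe σ e × eval σ e ≡ m) where

    init-loop : ∀ k {σ} → var σ nᵣ ≡ n → var σ lᵣ ≡ l → var σ kᵣ + k ≡ n →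
      (∀ i → i < var σ kᵣ → arr σ rankA i ≡ m × arr σ flagA i ≡ 0) →
      ∃₂ λ σ′ T → Silently (while (! nᵣ ⊖ ! kᵣ) (rankA ‹ ! kᵣ ›← e ⨾ flagA ‹ ! kᵣ ›← lit 0 ⨾ increment kᵣ)) σ T σ′ ×
        T ≤ 29 * k + 5 × (∀ i → i < n → arr σ′ rankA i ≡ m × arr σ′ flagA i ≡ 0)
    init-loop zero {σ} n≡ l≡ k≡ filled = σ , _ ,
      stop-s _ (trans (cong₂ _∸_ n≡ (trans (sym (+-identityʳ _)) k≡)) (n∸n≡0 n)) , ≤-refl ,
      λ i lt → filled i (≤-trans lt (≤-reflexive (trans (sym k≡) (+-identityʳ _))))
    init-loop (suc k) {σ} n≡ l≡ k≡ filled =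
      case init-loop k {σ₁} n≡ l≡ (trans (+-assoc (var σ kᵣ) 1 k) k≡) filled₁ of λ { (σ′ , T , ex , le , all) →
        σ′ , _ ,
        loop-s _ (λ z → <⇒≱ k<n (≤-trans (≤-reflexive (sym n≡)) (m∸n≡0⇒m≤n z)))
          (store-s _ (proj₁ (value l≡)) ⨾ₛ store-s _ _ ⨾ₛ assign-s (_ , _ , ≤-trans (≤-reflexive (+-comm (var σ kᵣ) 1)) (≤-trans k<n n≤Bd))) ex ,
        linear (T ∷ k ∷ cost e ∷ []) (hyp 1 (# 0) (29 · # 1 ∔ κ 5) le (hyp 1 (# 2) (κ 3) cheap none))
          (κ 5 ∔ (κ 7 ∔ (# 2 ∔ κ 1) ∔ (κ 9 ∔ κ 4)) ∔ # 0) (29 · (κ 1 ∔ # 1) ∔ κ 5) , all }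
      where
      k<n : var σ kᵣ < n
      k<n = ≤-trans (s≤s (m≤m+n (var σ kᵣ) k)) (≤-reflexive (trans (sym (+-suc (var σ kᵣ) k)) k≡))
      σ₁ : Store
      σ₁ = setVar (setArr (setArr σ rankA (var σ kᵣ) (eval σ e)) flagA (var σ kᵣ) 0) kᵣ (var σ kᵣ + 1)
      filled₁ : ∀ i → i < var σ kᵣ + 1 → arr σ₁ rankA i ≡ m × arr σ₁ flagA i ≡ 0
      filled₁ i lt with i ≟ var σ kᵣ
      ... | yes refl = trans (upd-same (arr σ rankA) (var σ kᵣ) _) (proj₂ (value l≡)) , upd-same (arr σ flagA) (var σ kᵣ) 0
      ... | no ne =
        let a , b = filled i (≤∧≢⇒< (≤-pred (≤-trans lt (≤-reflexive (+-comm (var σ kᵣ) 1)))) ne)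
        in trans (upd-other (arr σ rankA) _ ne) a , trans (upd-other (arr σ flagA) _ ne) b

    initSearch-correct : ∀ {σ} → Context σ → var σ lᵣ ≡ l →
      ∃₂ λ σ′ T → Silently (initSearch e) σ T σ′ × T ≤ 29 * n + 18 × RankRep (arr σ′ rankA) (λ _ → m) ×
        Flagged (arr σ′ flagA) t × (∀ v → v ≢ t → ¬ Flagged (arr σ′ flagA) v) × BagRep (var σ′ bpᵣ) (arr σ′ bagA) []
    initSearch-correct {σ} C l≡ =
      case init-loop n {setVar σ kᵣ 0} (n-reg C) l≡ refl (λ _ ()) of λ { (σ₁ , T , ex , le , filled) →
        let t≡ : var σ₁ tᵣ ≡ toℕ t
            t≡ = trans (kept ex tᵣ) (t-reg C)
        in setVar (setArr σ₁ flagA (var σ₁ tᵣ) 1) bpᵣ 0 , _ , (assign-s _ ⨾ₛ ex ⨾ₛ store-s _ _ ⨾ₛ assign-s _) ,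
           linear (T ∷ n ∷ []) (hyp 1 (# 0) (29 · # 1 ∔ κ 5) le none) (κ 2 ∔ (# 0 ∔ (κ 9 ∔ κ 2))) (29 · # 1 ∔ κ 18) ,
           (λ v → proj₁ (filled (toℕ v) (Fin.toℕ<n v))) , flag-t (arr σ₁ flagA) t≡ ,
           no-flag (arr σ₁ flagA) t≡ (λ v → proj₂ (filled (toℕ v) (Fin.toℕ<n v))) , bagRep refl tt }
      where
      flag-t : ∀ f {i} → i ≡ toℕ t → Flagged (f [ i ≔ 1 ]) t
      flag-t f refl z = case trans (sym (upd-same f (toℕ t) 1)) z of λ ()
      no-flag : ∀ f {i} → i ≡ toℕ t → (∀ v → f (toℕ v) ≡ 0) → ∀ v → v ≢ t → ¬ Flagged (f [ i ≔ 1 ]) v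
      no-flag f refl zeros v v≢t fv = fv (trans (upd-other f 1 (v≢t ∘ Fin.toℕ-injective)) (zeros v))

  -- Ranking, popping and expanding.

  module Ranking (q : V) (k : ℕ) (g : V → ℕ) where
    g′ : V → ℕ
    g′ v = if does (q ~? v) then k else g v

    record RankState (todo : List V) (rank : ℕ → ℕ) (k′ : ℕ) : Set where
      constructor rankState
      field
        to-rank : All (q ~_) todo
        ranked  : ∀ v → v ∉ todo → rank (toℕ v) ≡ g′ v
        k-reg   : k′ ≡ k

    rank-one : ∀ {x todo σ} → var σ xᵣ ≡ toℕ x → RankState (x ∷ todo) (arr σ rankA) (var σ kᵣ) →
      ∃₂ λ σ′ T → Silently (rankA ‹ ! xᵣ ›← ! kᵣ) σ T σ′ × T ≤ 9 × RankState todo (arr σ′ rankA) (var σ′ kᵣ)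
    rank-one {x} {todo} {σ} x≡ (rankState (q~x ∷ adj) R k≡) = _ , _ , store-s _ _ , ≤-refl , rankState adj ranked′ k≡
      where
      ranked′ : ∀ v → v ∉ todo → (arr σ rankA [ var σ xᵣ ≔ var σ kᵣ ]) (toℕ v) ≡ g′ v
      ranked′ v v∉ with v Fin.≟ x
      ... | yes refl = trans (subst (λ i → (arr σ rankA [ var σ xᵣ ≔ var σ kᵣ ]) i ≡ var σ kᵣ) x≡ (upd-same (arr σ rankA) (var σ xᵣ) _))
                             (trans k≡ (sym (cong (λ b → if b then k else g x) (dec-true (q ~? x) q~x))))
      ... | no v≢x = trans (upd-other (arr σ rankA) _ (λ e → v≢x (Fin.toℕ-injective (trans e x≡))))
                           (R v λ { (here e) → v≢x e ; (there v∈) → v∉ v∈ })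

    open UniformNeighbourLoop (rankA ‹ ! xᵣ ›← ! kᵣ) _ _ 9 (λ todo σ → RankState todo (arr σ rankA) (var σ kᵣ))
      (λ m i → i) (λ m i → i) (λ m i → i) rank-one public

    start-ranking : ∀ {rank} → RankRep rank g → RankState (nbrs q) rank k
    start-ranking R = rankState (All.tabulate nbrs⇒)
      (λ v v∉ → trans (R v) (sym (cong (λ b → if b then k else g v) (dec-false (q ~? v) (v∉ ∘ nbrs⇐))))) refl

  rankLoop : Cmd
  rankLoop = while (! kᵣ) (forNeighbours (pathA ‹ ! kᵣ ⊖ lit 1 ›) (rankA ‹ ! xᵣ ›← ! kᵣ) ⨾ decrement kᵣ)

  -- Each pass over the neighbours of a path vertex is one unfolding of `first`.
  rankLoop-correct : ∀ r {g σ} → Context σ → StackHolds (arr σ pathA) (map toℕ r) → var σ kᵣ ≡ length r → RankRep (arr σ rankA) g →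
    ∃₂ λ σ′ T → Silently rankLoop σ T σ′ × T ≤ 31 * total weight r + 3 × RankRep (arr σ′ rankA) (first r g)
  rankLoop-correct [] {σ = σ} C h k≡ R = σ , _ , stop-s _ k≡ , ≤-refl , R
  rankLoop-correct (q ∷ r) {g} {σ} C (top , h) k≡ R =
    case forNeighbours-uniform {pathA ‹ ! kᵣ ⊖ lit 1 ›} {q} {σ} _
           (trans (cong (arr σ pathA) (trans (cong (_∸ 1) k≡) (sym (length-map toℕ r)))) top) (located C)
           (subst (RankState (nbrs q) (arr σ rankA)) (sym k≡) (start-ranking R)) of λ { (σ₁ , T₁ , ex₁ , le₁ , rankState _ R₁ k₁) →
    case rankLoop-correct r {g′} {setVar σ₁ kᵣ (var σ₁ kᵣ ∸ 1)} (context-kept ex₁ C) (subst (λ f → StackHolds f (map toℕ r)) (sym (keptArr ex₁ pathA)) h)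
           (cong (_∸ 1) k₁) (λ v → R₁ v λ ()) of λ { (σ₂ , T₂ , ex₂ , le₂ , R₂) →
      σ₂ , _ , loop-s _ (λ z → case trans (sym k≡) z of λ ()) (ex₁ ⨾ₛ assign-s _) ex₂ ,
      linear (T₁ ∷ T₂ ∷ deg q ∷ deg q * 9 ∷ total weight r ∷ [])
        (hyp 1 (# 0) (# 3 ∔ (14 · # 2 ∔ κ 24)) le₁ (hyp 1 (# 1) (31 · # 4 ∔ κ 3) le₂ (hyp 1 (# 3) (9 · # 2) (≤-reflexive (*-comm (deg q) 9)) none)))
        (κ 3 ∔ (# 0 ∔ κ 4) ∔ # 1) (31 · (κ 1 ∔ # 2 ∔ # 4) ∔ κ 3) , R₂ } }
    where open Ranking q (suc (length r)) g

  ranking-correct : ∀ r {σ} → Context σ → StackHolds (arr σ pathA) (map toℕ r) → var σ lᵣ ≡ length r → RankRep (arr σ rankA) (λ _ → suc (length r)) →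
    ∃₂ λ σ′ T → Silently ranking σ T σ′ × T ≤ 31 * total weight r + 14 × AllRanks (λ v → arr σ′ rankA (toℕ v)) r
  ranking-correct r {σ} C h l≡ R =
    case rankLoop-correct r {λ _ → suc (length r)} {setVar σ kᵣ (var σ lᵣ)} C h l≡ R of λ { (σ₁ , T , ex , le , R₁) →
      let s≡ : var σ₁ sᵣ ≡ toℕ s
          s≡ = trans (kept ex sᵣ) (s-reg C)
      in _ , _ , (assign-s _ ⨾ₛ ex ⨾ₛ store-s _ _) ,
         linear (T ∷ total weight r ∷ []) (hyp 1 (# 0) (31 · # 1 ∔ κ 3) le none) (κ 2 ∔ (# 0 ∔ κ 9)) (31 · # 1 ∔ κ 14) ,
         allRanks-first r (λ _ → suc (length r))
           (subst (λ i → (arr σ₁ rankA [ i ≔ 0 ]) (toℕ s) ≡ 0) (sym s≡) (upd-same (arr σ₁ rankA) (toℕ s) 0))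
           (λ {v} v≢s → trans (upd-other (arr σ₁ rankA) 0 (λ e → v≢s (Fin.toℕ-injective (trans e s≡)))) (R₁ v))
           (λ _ → ≤-refl) }

  popLoop : Cmd
  popLoop = while (! jᵣ) (decrement jᵣ ⨾ decrement spᵣ ⨾ pathA ‹ ! jᵣ ›← stackA ‹ ! spᵣ ›)

  -- The path is restored from its last position down. The final clause says that later passes leave
  -- the positions already filled alone, which the induction needs for the top one.
  popLoop-correct : ∀ (r : List V) {ws σ} → var σ jᵣ ≡ length r → StackRep (var σ spᵣ) (arr σ stackA) (map toℕ r ++ ws) →
    ∃₂ λ σ′ T → Silently popLoop σ T σ′ × T ≤ 27 * length r + 3 × StackRep (var σ′ spᵣ) (arr σ′ stackA) ws ×
      StackHolds (arr σ′ pathA) (map toℕ r) × (∀ i → length r ≤ i → arr σ′ pathA i ≡ arr σ pathA i)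
  popLoop-correct [] {σ = σ} j≡ st = σ , _ , stop-s _ j≡ , ≤-refl , st , tt , λ _ _ → refl
  popLoop-correct (q ∷ r) {ws} {σ} j≡ (stackRep sp≡ (top , h)) =
    case popLoop-correct r {ws} {σ₁} j≡′ (stackRep (cong (_∸ 1) sp≡) h) of λ { (σ′ , T , ex , le , st , h′ , above) →
      σ′ , _ , loop-s _ (λ z → case trans (sym j≡) z of λ ()) (assign-s _ ⨾ₛ assign-s _ ⨾ₛ store-s _ _) ex ,
      linear (T ∷ length r ∷ []) (hyp 1 (# 0) (27 · # 1 ∔ κ 3) le none) (κ 27 ∔ # 0) (27 · (κ 1 ∔ # 1) ∔ κ 3) ,
      st ,
      (trans (above _ (≤-reflexive (sym (length-map toℕ r)))) (trans (cong (arr σ₁ pathA) (trans (length-map toℕ r) (sym j≡′)))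
        (trans (upd-same (arr σ pathA) (var σ jᵣ ∸ 1) _) (trans (cong (arr σ stackA) (cong (_∸ 1) sp≡)) top))) , h′) ,
      λ i lt → trans (above i (≤-trans (n≤1+n _) lt)) (upd-other (arr σ pathA) _ (λ e → <⇒≢ lt (sym (trans e j≡′)))) }
    where
    j≡′ : var σ jᵣ ∸ 1 ≡ length r
    j≡′ = cong (_∸ 1) j≡
    σ₁ : Store
    σ₁ = setArr (setVar (setVar σ jᵣ (var σ jᵣ ∸ 1)) spᵣ (var σ spᵣ ∸ 1)) pathA (var σ jᵣ ∸ 1) (arr σ stackA (var σ spᵣ ∸ 1))

  pop-correct : ∀ {a} (r : List V) {ws σ} → StackRep (var σ spᵣ) (arr σ stackA) (a ∷ length r ∷ map toℕ r ++ ws) →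
    ∃₂ λ σ′ T → Silently pop σ T σ′ × T ≤ 27 * length r + 31 × StackRep (var σ′ spᵣ) (arr σ′ stackA) ws ×
      StackHolds (arr σ′ pathA) (map toℕ r) × var σ′ lᵣ ≡ length r × var σ′ startᵣ ≡ a
  pop-correct {a} r {ws} {σ} (stackRep sp≡ (top₁ , top₂ , h)) =
    case popLoop-correct r {ws} {σ₁} l≡ (stackRep sp-2≡ h) of λ { (σ′ , T , ex , le , st , h′ , _) →
      σ′ , _ , (assign-s _ ⨾ₛ assign-s _ ⨾ₛ assign-s _ ⨾ₛ assign-s _ ⨾ₛ assign-s _ ⨾ₛ ex) ,
      linear (T ∷ length r ∷ []) (hyp 1 (# 0) (27 · # 1 ∔ κ 3) le none) (κ 28 ∔ # 0) (27 · # 1 ∔ κ 31) ,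
      st , h′ , trans (kept ex lᵣ) l≡ ,
      trans (kept ex startᵣ) (trans (cong (arr σ stackA) (cong (_∸ 1) sp≡)) top₁) }
    where
    sp-2≡ : var σ spᵣ ∸ 1 ∸ 1 ≡ length (map toℕ r ++ ws)
    sp-2≡ = cong (λ i → i ∸ 1 ∸ 1) sp≡
    l≡ : arr σ stackA (var σ spᵣ ∸ 1 ∸ 1) ≡ length r
    l≡ = trans (cong (arr σ stackA) sp-2≡) top₂
    σ₁ : Store
    σ₁ = setVar (setVar (setVar (setVar (setVar σ spᵣ (var σ spᵣ ∸ 1)) startᵣ (arr σ stackA (var σ spᵣ ∸ 1))) spᵣ (var σ spᵣ ∸ 1 ∸ 1))
           lᵣ (arr σ stackA (var σ spᵣ ∸ 1 ∸ 1))) jᵣ (arr σ stackA (var σ spᵣ ∸ 1 ∸ 1))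

  n≤Wt : n ≤ Wt
  n≤Wt = ≤-trans (≤-reflexive (sym (length-tabulate {n = n} id))) (length≤ (allFin n))
    where
    length≤ : ∀ xs → length xs ≤ total weight xs
    length≤ []       = z≤n
    length≤ (x ∷ xs) = s≤s (≤-trans (length≤ xs) (m≤n+m _ (deg x)))

  -- The vertex before `t` witnesses a smaller rank, so at the level of the full length the search
  -- is still idle; this is where the levels begin.
  t-rank : ∀ {F} cur → Solution (cur ʳ++ []) → AllRanks F cur → F t < length cur
  t-rank (q ∷ r) S R with suffix r (proj₂ S)
  ... | [t] with predecessor r {[]} S
  ...   | inj₁ a = s≤s (rank⇐ (allRanks-head r (proj₂ R)) (s≢t ∘ sym) a)
  ...   | inj₂ refl = ⊥-elim (s≢t refl)

  reversedPath≡ : ∀ b → reverse (rest b) ++ prefix b ≡ reversedPath b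
  reversedPath≡ b = sym (ʳ++-defn (rest b))

  path≡ : ∀ b → reversedPath b ʳ++ [] ≡ path b
  path≡ b = trans (cong (_ʳ++ []) (sym (reversedPath≡ b)))
    (trans (++-ʳ++ (reverse (rest b))) (cong (prefix b ʳ++_) (reverse-involutive (rest b))))

  reversed-weight : ∀ b → Solution (path b) → total weight (reversedPath b) ≤ Wt
  reversed-weight b S = ≤-trans (≤-reflexive (trans (sym (+-identityʳ _)) (trans (sym (total-ʳ++ weight (reversedPath b))) (cong (total weight) (path≡ b)))))
    (total-weight (unique (proj₂ S)))

  record Popped (b : Entry) (ws : List ℕ) (σ : Store) : Set where
    field
      context   : Context σ
      path-rep  : StackHolds (arr σ pathA) (map toℕ (reversedPath b))
      l-reg     : var σ lᵣ ≡ length (reversedPath b)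
      start-reg : var σ startᵣ ≡ length (prefix b)
      stack-rep : StackRep (var σ spᵣ) (arr σ stackA) ws

  Expanded : Cmd → Entry → List ℕ → Store → Set
  Expanded c b ws σ = ∃₂ λ σ′ T → ∃ λ bs → Silently c σ T σ′ × T ≤ 211 * Wt + 39 + pushTime * length bs × Context σ′ ×
      Branches (prefix b) (path b) bs × StackRep (var σ′ spᵣ) (arr σ′ stackA) (allWords bs ++ ws) × length bs ≤ Wt

  -- 211 = 29 + 31 + 64 + 87: initialising, ranking, processing vertices and scanning neighbours of
  -- the path. The vertices of the path are distinct, so each part is bounded by `Wt`.
  expand-correct : ∀ {r₀ r₁ c ws σ} → let b = entry (r₀ ∷ r₁) c in Solution (path b) → length ws + Wt * E ≤ Bd → Popped b ws σ →
    Expanded expand b ws σ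
  expand-correct {r₀} {r₁} {c} {ws} {σ} S room I =
    case initSearch-correct {e = ! lᵣ ⊕ lit 1} (suc (length rQ)) (length rQ) ≤-refl (λ {σ} → value {σ}) {σ} context l-reg of λ { (σ₁ , T₁ , ex₁ , le₁ , R₁ , ft , ¬f , B₁) →
    let h₁ = subst (λ f → StackHolds f (map toℕ rQ)) (sym (keptArr ex₁ pathA)) path-rep
        l₁ = trans (kept ex₁ lᵣ) l-reg
    in case ranking-correct rQ {σ₁} (context-kept ex₁ context) h₁ l₁ R₁ of λ { (σ₂ , T₂ , ex₂ , le₂ , R₂) →
    case levels-from {σ₂} R₂ (context-kept ex₂ (context-kept ex₁ context))
           (subst (λ f → StackHolds f (map toℕ rQ)) (sym (keptArr ex₂ pathA)) h₁)
           (trans (kept ex₂ lᵣ) l₁)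
           (trans (kept ex₂ startᵣ) (trans (kept ex₁ startᵣ) start-reg))
           (subst₂ (λ m f → BagRep m f []) (sym (kept ex₂ bpᵣ)) (sym (keptArr ex₂ bagA)) B₁)
           (subst (λ P → Flagged P t) (sym (keptArr ex₂ flagA)) ft)
           (λ v v≢t → subst (λ P → ¬ Flagged P v) (sym (keptArr ex₂ flagA)) (¬f v v≢t))
           (subst₂ (λ m f → StackRep m f ws) (sym (trans (kept ex₂ spᵣ) (kept ex₁ spᵣ))) (sym (trans (keptArr ex₂ stackA) (keptArr ex₁ stackA))) stack-rep)
    of λ { (σ₃ , T₃ , bs , ex₃ , le₃ , C₃ , Br , st , few) →
      σ₃ , _ , bs , (ex₁ ⨾ₛ ex₂ ⨾ₛ assign-s _ ⨾ₛ ex₃) ,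
      linear (T₁ ∷ T₂ ∷ T₃ ∷ n ∷ total weight rQ ∷ Wt ∷ pushTime * length bs ∷ [])
        (hyp 1 (# 0) (29 · # 3 ∔ κ 18) le₁ (hyp 1 (# 1) (31 · # 4 ∔ κ 14) le₂ (hyp 1 (# 2) (151 · # 5 ∔ κ 5 ∔ # 6) le₃
        (hyp 29 (# 3) (# 5) n≤Wt (hyp 31 (# 4) (# 5) (reversed-weight b S) none)))))
        (# 0 ∔ (# 1 ∔ (κ 2 ∔ # 2))) (211 · # 5 ∔ κ 39 ∔ # 6) ,
      C₃ , Br , st , few } } }
    where
    b = entry (r₀ ∷ r₁) c
    rQ = reversedPath b
    open Popped I
    value : ∀ {σ} → var σ lᵣ ≡ length rQ → Safe σ (! lᵣ ⊕ lit 1) × var σ lᵣ + 1 ≡ suc (length rQ)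
    value {σ} e = (_ , _ , ≤-trans (≤-reflexive e′) (≤-trans (s≤s (entry-length b S)) (≤-trans (m≤n+m (suc n) 2) n<Bd))) , e′
      where
      e′ : var σ lᵣ + 1 ≡ suc (length rQ)
      e′ = trans (+-comm _ 1) (cong suc e)
    rc = reverse c
    rQ≡ : rc ++ r₀ ∷ r₁ ≡ rQ
    rQ≡ = reversedPath≡ b
    Q≡ : (rc ++ r₀ ∷ r₁) ʳ++ [] ≡ path b
    Q≡ = trans (cong (_ʳ++ []) rQ≡) (path≡ b)
    levels-from : ∀ {σ} → AllRanks (λ v → arr σ rankA (toℕ v)) rQ → Context σ → StackHolds (arr σ pathA) (map toℕ rQ) →
      var σ lᵣ ≡ length rQ → var σ startᵣ ≡ suc (length r₁) → BagRep (var σ bpᵣ) (arr σ bagA) [] → Flagged (arr σ flagA) t →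
      (∀ v → v ≢ t → ¬ Flagged (arr σ flagA) v) → StackRep (var σ spᵣ) (arr σ stackA) ws →
      ∃₂ λ σ′ T → ∃ λ bs → Silently levels (setVar σ iᵣ (var σ lᵣ)) T σ′ × T ≤ 151 * Wt + 5 + pushTime * length bs × Context σ′ ×
        Branches (prefix b) (path b) bs × StackRep (var σ′ spᵣ) (arr σ′ stackA) (allWords bs ++ ws) × length bs ≤ Wt
    levels-from {σ} R C h l≡ start≡ B ft ¬f st =
      case levels-correct rc {r₀} {r₁} {[]} {[]} {[]} {setVar σ iᵣ (var σ lᵣ)} refl (record
             { context = C ; solution = SQ ; ranked = R′ ; ranks = λ _ → refl
             ; path-rep = subst (λ r → StackHolds (arr σ pathA) (map toℕ r)) (sym rQ≡) h
             ; i-reg = trans l≡ (cong length (sym rQ≡)) ; start-reg = start≡ ; bag-rep = B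
             ; searched = idle-search (length (rc ++ r₀ ∷ r₁)) ft (λ {v} → ¬f v) (t-rank (rc ++ r₀ ∷ r₁) SQ R′)
             ; branch-inv = no-branches SQ refl (≤-trans (s≤s z≤n) (≤-trans (m≤n+m _ (length rc)) (≤-reflexive (sym (length-++ rc)))))
             ; stack-rep = st
             ; few = weight≤ })
      of λ { (σ′ , T , D , bs , d′ , ex , L , le , Q≡′) →
        σ′ , T , bs , ex ,
        linear (T ∷ potential [] [] ∷ total weight D ∷ pushTime * length bs ∷ total weight (drop 1 (rc ++ r₀ ∷ r₁)) ∷ Wt ∷ [])
          (hyp 1 (# 0 ∔ # 1) (64 · # 2 ∔ # 3 ∔ (87 · # 4 ∔ κ 5)) le (hyp 64 (# 2) (# 5) (total-weight (unique-L (LevelState.searched L)))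
          (hyp 87 (# 4) (# 5) weight≤ none)))
          (# 0) (151 · # 5 ∔ κ 5 ∔ # 3) ,
        LevelState.context L ,
        subst (λ Q → Branches (r₀ ∷ r₁) Q bs) (trans Q≡′ Q≡) (LevelState.branch-inv L) ,
        LevelState.stack-rep L , ≤-trans (m≤m+n (length bs) _) (LevelState.few L) }
      where
      open Levels (λ v → arr σ rankA (toℕ v)) (suc (length r₁)) ws room
      SQ : Solution ((rc ++ r₀ ∷ r₁) ʳ++ [])
      SQ = subst Solution (sym Q≡) S
      R′ : AllRanks (λ v → arr σ rankA (toℕ v)) (rc ++ r₀ ∷ r₁)
      R′ = subst (AllRanks _) (sym rQ≡) R
      weight≤ : total weight (drop 1 (rc ++ r₀ ∷ r₁)) ≤ Wt
      weight≤ = ≤-trans (total-drop weight (rc ++ r₀ ∷ r₁)) (≤-trans (≤-reflexive (cong (total weight) rQ≡)) (reversed-weight b S))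

  printLoop : Cmd
  printLoop = while (! lᵣ ⊖ ! jᵣ) (output (pathA ‹ ! jᵣ ›) ⨾ increment jᵣ)

  print-correct : ∀ (e r : List V) {σ} → StackHolds (arr σ pathA) (map toℕ (e ʳ++ r)) → var σ lᵣ ≡ length (e ʳ++ r) → var σ jᵣ ≡ length r →
    length (e ʳ++ r) ≤ n →
    ∃₂ λ σ′ es → Exec printLoop σ es σ′ × Emits es (map toℕ e) × length es ≤ 18 * length e + 5
  print-correct [] r {σ} h l≡ j≡ le = σ , _ , while-stop _ (trans (cong₂ _∸_ l≡ j≡) (n∸n≡0 (length r))) , emits-silents 5 , ≤-refl
  print-correct (y ∷ e) r {σ} h l≡ j≡ le =
    case print-correct e (y ∷ r) {setVar σ jᵣ (var σ jᵣ + 1)} h l≡ (trans (+-comm _ 1) (cong suc j≡)) le of λ { (σ′ , es , ex , em , len) →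
      σ′ , _ ,
      while-step _ (λ z → <⇒≱ j<l (m∸n≡0⇒m≤n z)) (output _ ⨾ assigned (_ , _ , ≤-trans (≤-reflexive (+-comm _ 1)) (≤-trans j<l (≤-trans (≤-reflexive l≡) (≤-trans le n≤Bd))))) ex ,
      subst (λ x → Emits ((silents 4 ++ ((silents 8 ++ [ printed x ]) ++ silents 4) ++ [ silent ]) ++ es) (map toℕ (y ∷ e))) (sym y≡)
        ((emits-silents 4 emits-++ ((emits-silents 8 emits-++ emits-printed (toℕ y)) emits-++ emits-silents 4) emits-++ emits-silent) emits-++ em) ,
      linear (length es ∷ length e ∷ []) (hyp 1 (# 0) (18 · # 1 ∔ κ 5) len none) (κ 18 ∔ # 0) (18 · (κ 1 ∔ # 1) ∔ κ 5) }
    where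
    y≡ : arr σ pathA (var σ jᵣ) ≡ toℕ y
    y≡ = trans (cong (arr σ pathA) (trans j≡ (sym (length-map toℕ r))))
           (proj₁ (stackHolds-suffix (arr σ pathA) (map toℕ e) (subst (StackHolds (arr σ pathA)) (map-ʳ++ toℕ e) h)))
    j<l : var σ jᵣ < var σ lᵣ
    j<l = ≤-trans (≤-reflexive (cong suc j≡)) (≤-trans (m≤n+m _ (length e)) (≤-reflexive (trans (sym (length-ʳ++ e)) (sym l≡))))

  -- 256 = 211 + 27 + 18, for expanding, popping and printing. The pushes are accounted for
  -- separately.
  iterationTime : ℕ
  iterationTime = 256 * Wt + 79

  Iterated : Entry → List ℕ → Store → Set
  Iterated b ws σ = ∃₂ λ σ′ es → ∃₂ λ bs a → ∃ λ k → Exec iteration σ es σ′ × Completes es (map toℕ (path b)) a k ×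
      suc a + k ≤ iterationTime + pushTime * length bs × Context σ′ ×
      Branches (prefix b) (path b) bs × StackRep (var σ′ spᵣ) (arr σ′ stackA) (allWords bs ++ ws) × length bs ≤ Wt

  iteration-correct : ∀ {r₀ r₁ c ws σ} → let b = entry (r₀ ∷ r₁) c in Solution (path b) → length ws + Wt * E ≤ Bd → Context σ →
    StackRep (var σ spᵣ) (arr σ stackA) (words b ++ ws) → Iterated b ws σ
  iteration-correct {r₀} {r₁} {c} {ws} {σ} S room C st =
    case pop-correct (reversedPath b) {ws} {σ} st of λ { (σ₁ , T₁ , ex₁ , le₁ , st₁ , h₁ , l₁ , start₁) →
    case print-correct (path b) [] {setVar σ₁ jᵣ 0} (subst (λ r → StackHolds (arr σ₁ pathA) (map toℕ r)) (sym rev≡) h₁)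
           (trans l₁ (cong length (sym rev≡))) refl (≤-trans (≤-reflexive (cong length rev≡)) (entry-length b S)) of λ { (σ₂ , es₂ , ex₂ , em , le₂) →
    case expand-correct {r₀} {r₁} {c} {ws} {σ₂} S room (record
           { context = context-after ex₂ (context-kept ex₁ C)
           ; path-rep = subst (λ f → StackHolds f (map toℕ (reversedPath b))) (sym (arr-kept ex₂ pathA _)) h₁
           ; l-reg = trans (var-kept ex₂ lᵣ _) l₁ ; start-reg = trans (var-kept ex₂ startᵣ _) start₁
           ; stack-rep = subst₂ (λ m f → StackRep m f ws) (sym (var-kept ex₂ spᵣ _)) (sym (arr-kept ex₂ stackA _)) st₁ })
    of λ { (σ₃ , T₃ , bs , ex₃ , le₃ , C₃ , Br , st₃ , few) →
      σ₃ , _ , bs , _ , T₃ ,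
      (execution ex₁ ⨾ (assigned _ ⨾ ex₂) ⨾ endOutput ⨾ execution ex₃) ,
      subst (λ q → Completes (silents T₁ ++ (silents 2 ++ es₂) ++ [ finished ] ++ silents T₃) q _ T₃) (++-identityʳ (map toℕ (path b)))
        (emits-silents T₁ completes-++ (emits-silents 2 emits-++ em) completes-++ completes-finish T₃) ,
      linear (T₁ ∷ length (silents T₁) ∷ length es₂ ∷ T₃ ∷ length (reversedPath b) ∷ length (path b) ∷ n ∷ Wt ∷ pushTime * length bs ∷ [])
        (hyp 1 (# 0) (27 · # 4 ∔ κ 31) le₁ (hyp 1 (# 1) (# 0) (≤-reflexive (length-replicate T₁))
        (hyp 1 (# 2) (18 · # 5 ∔ κ 5) le₂ (hyp 1 (# 3) (211 · # 7 ∔ κ 39 ∔ # 8) le₃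
        (hyp 27 (# 4) (# 6) (entry-length b S) (hyp 18 (# 5) (# 6) (solution-length S) (hyp 45 (# 6) (# 7) n≤Wt none)))))))
        (κ 1 ∔ (# 1 ∔ (κ 2 ∔ # 2 ∔ κ 0)) ∔ # 3) (256 · # 7 ∔ κ 79 ∔ # 8) ,
      C₃ , Br , st₃ , few } } }
    where
    b = entry (r₀ ∷ r₁) c
    rev≡ : path b ʳ++ [] ≡ reversedPath b
    rev≡ = trans (cong (_ʳ++ []) (sym (path≡ b))) (reverse-involutive (reversedPath b))
    context-after : ∀ {σ es σ′} → Exec printLoop σ es σ′ → Context σ → Context σ′
    context-after {σ} ex C rewrite var-kept ex nᵣ _ | var-kept ex sᵣ _ | var-kept ex tᵣ _ | arr-kept ex offA _ = C

  mainLoop : Cmd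
  mainLoop = while (! spᵣ) iteration

  -- An execution of the main loop from σ may begin with the events es and
  -- continue from σ′.
  record Reaches (σ : Store) (es : List Event) (σ′ : Store) : Set where
    constructor reaches
    field resume : ∀ {es′ σ″} → Exec mainLoop σ′ es′ σ″ → Exec mainLoop σ (es ++ es′) σ″
  open Reaches public

  reaches-refl : ∀ {σ} → Reaches σ [] σ
  reaches-refl = reaches λ ex → ex

  reaches-trans : ∀ {σ σ′ σ″ es es′} → Reaches σ es σ′ → Reaches σ′ es′ σ″ → Reaches σ (es ++ es′) σ″
  reaches-trans {es = es} {es′} R R′ = reaches λ {es″} ex → exact (sym (++-assoc es es′ es″)) (resume R (resume R′ ex))

  -- Each solution pays for its own iteration and for having been pushed.
  solutionTime delayBound : ℕ
  solutionTime = iterationTime + 3 + pushTime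
  delayBound   = iterationTime + 3 + pushTime * Wt

  -- `charge` is the number of entries processed. The time for pushing them was spent in an earlier
  -- iteration but stands on the left here, because their own solutions pay for it.
  Processed : (List (List V) → Set) → List ℕ → Store → ℕ → Set
  Processed Enum ws σ charge = ∃₂ λ σ′ es → ∃ λ ps → Reaches σ es σ′ × Enum ps × Enumerating delayBound es (map (map toℕ) ps) ×
    length es + pushTime * charge ≤ solutionTime * length ps × Context σ′ × StackRep (var σ′ spᵣ) (arr σ′ stackA) ws

  record Pending (fuel : ℕ) (b : Entry) : Set where
    field
      solution : Solution (path b)
      nonempty : 0 < length (prefix b)
      fuelled  : n < length (prefix b) + fuel
  open Pending public

  -- The stack makes the loop act as a recursion: the descendants of `b` are all treated before `ws`
  -- is touched. Fuel is the number of generations left: prefixes get longer and never exceed `n`.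
  -- Each generation leaves at most `Wt` entries of `E` words waiting, whence the room
  -- `Wt * E * fuel`.
  process    : ∀ fuel b {ws σ} → Pending fuel b → length ws + Wt * E * fuel ≤ Bd → Context σ →
               StackRep (var σ spᵣ) (arr σ stackA) (words b ++ ws) → Processed (Enumerates b) ws σ 1
  processAll : ∀ fuel bs {ws σ} → All (Pending fuel) bs → AllPairs Separate bs → length ws + length bs * E + Wt * E * fuel ≤ Bd → Context σ →
               StackRep (var σ spᵣ) (arr σ stackA) (allWords bs ++ ws) → Processed (EnumeratesAll bs) ws σ (length bs)

  process zero b P _ _ _ = ⊥-elim (<⇒≱ (fuelled P) (≤-trans (≤-reflexive (+-identityʳ _))
    (≤-trans (≤-trans (m≤n+m _ (length (rest b))) (≤-reflexive (sym (length-ʳ++ (rest b))))) (entry-length b (solution P)))))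
  process (suc fuel) (entry [] c) P _ _ _ = ⊥-elim (<⇒≱ (nonempty P) z≤n)
  process (suc fuel) b@(entry (r₀ ∷ r₁) c) {ws} {σ} P room C st =
    case iteration-correct {r₀} {r₁} {c} {ws} {σ} (solution P) room-now C st of λ { (σ₁ , es₁ , bs , a , k , ex₁ , comp , len₁ , C₁ , Br , st₁ , few) →
    case processAll fuel bs {ws} {σ₁} (pending (solutions Br) (longer Br)) (separate Br) (room-below few) C₁ st₁
    of λ { (σ₂ , es₂ , ps , re , en , tr , len₂ , C₂ , st₂) →
      σ₂ , _ , path b ∷ ps ,
      reaches-trans (reaches λ ex → while-step _ (λ z → case trans (sym z) (stack-size st) of λ ()) ex₁ ex) re ,
      enumerates-entry (solution P) Br en ,
      enumerating-++ (enumerating-one (emits-silents 2 completes-++ completes-silent comp) (bound-a len₁ few) (bound-k len₁ few)) tr ,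
      time-bound es₁ es₂ comp len₁ len₂ , C₂ , st₂ } }
    where
    room-now : length ws + Wt * E ≤ Bd
    room-now = ≤-trans (+-monoʳ-≤ (length ws) (≤-trans (m≤m+n (Wt * E) (Wt * E * fuel)) (≤-reflexive (sym (*-suc (Wt * E) fuel))))) room
    room-below : ∀ {m} → m ≤ Wt → length ws + m * E + Wt * E * fuel ≤ Bd
    room-below {m} le = ≤-trans (≤-reflexive (+-assoc (length ws) (m * E) _)) (≤-trans (+-monoʳ-≤ (length ws)
      (≤-trans (+-monoˡ-≤ _ (*-monoˡ-≤ E le)) (≤-reflexive (sym (*-suc (Wt * E) fuel))))) room)
    pending : ∀ {bs} → All (Solution ∘ path) bs → All (λ b′ → length (r₀ ∷ r₁) < length (prefix b′)) bs → All (Pending fuel) bs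
    pending []       []       = []
    pending {b′ ∷ _} (S ∷ Ss) (l ∷ ls) = record { solution = S ; nonempty = ≤-trans (s≤s z≤n) l
      ; fuelled = ≤-trans (fuelled P) (≤-trans (≤-reflexive (+-suc (length (r₀ ∷ r₁)) fuel)) (+-monoˡ-≤ fuel l)) } ∷ pending Ss ls
    push-bound : ∀ {m} → m ≤ Wt → pushTime * m ≤ pushTime * Wt
    push-bound = *-monoʳ-≤ pushTime
    bound-a : ∀ {a k m} → suc a + k ≤ iterationTime + pushTime * m → m ≤ Wt → suc (2 + a) ≤ delayBound
    bound-a {a} {k} {m} le few = linear (a ∷ k ∷ iterationTime ∷ pushTime * m ∷ pushTime * Wt ∷ [])
      (hyp 1 (κ 1 ∔ # 0 ∔ # 1) (# 2 ∔ # 3) le (hyp 1 (# 3) (# 4) (push-bound few) none)) (κ 3 ∔ # 0) (# 2 ∔ κ 3 ∔ # 4)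
    bound-k : ∀ {a k m} → suc a + k ≤ iterationTime + pushTime * m → m ≤ Wt → suc k ≤ delayBound
    bound-k {a} {k} {m} le few = linear (a ∷ k ∷ iterationTime ∷ pushTime * m ∷ pushTime * Wt ∷ [])
      (hyp 1 (κ 1 ∔ # 0 ∔ # 1) (# 2 ∔ # 3) le (hyp 1 (# 3) (# 4) (push-bound few) none)) (κ 1 ∔ # 1) (# 2 ∔ κ 3 ∔ # 4)
    time-bound : ∀ es₁ es₂ {q a k m l} → Completes es₁ q a k → suc a + k ≤ iterationTime + pushTime * m →
      length es₂ + pushTime * m ≤ solutionTime * l →
      length ((silents 2 ++ es₁ ++ [ silent ]) ++ es₂) + pushTime * 1 ≤ solutionTime * suc l
    time-bound es₁ es₂ {q} {a} {k} {m} {l} comp le₁ le₂ =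
      ≤-trans (≤-reflexive (cong₂ _+_ (trans (length-++ (silents 2 ++ es₁ ++ [ silent ])) (cong (λ z → suc (suc z) + length es₂)
          (trans (length-++ es₁) (cong (_+ 1) (duration comp))))) (*-identityʳ pushTime)))
      (≤-trans (linear (a ∷ k ∷ length es₂ ∷ iterationTime ∷ pushTime ∷ pushTime * m ∷ solutionTime * l ∷ [])
        (hyp 1 (κ 1 ∔ # 0 ∔ # 1) (# 3 ∔ # 5) le₁ (hyp 1 (# 2 ∔ # 5) (# 6) le₂ none))
        (κ 2 ∔ (κ 1 ∔ (# 0 ∔ # 1) ∔ κ 1) ∔ # 2 ∔ # 4) (# 3 ∔ κ 3 ∔ # 4 ∔ # 6))
      (≤-reflexive (sym (*-suc solutionTime l))))

  processAll fuel [] {ws} {σ} _ _ _ C st = σ , [] , [] , reaches-refl , enumerates-[] , enumerating-[] ,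
    ≤-reflexive (trans (*-zeroʳ pushTime) (sym (*-zeroʳ solutionTime))) , C , st
  processAll fuel (b ∷ bs) {ws} {σ} (P ∷ Ps) (sep ∷ seps) room C st =
    case process fuel b {allWords bs ++ ws} {σ} P room-first C (subst (StackRep _ _) (++-assoc (words b) (allWords bs) ws) st)
    of λ { (σ₁ , es₁ , ps₁ , re₁ , en₁ , tr₁ , len₁ , C₁ , st₁) →
    case processAll fuel bs {ws} {σ₁} Ps seps room-rest C₁ st₁ of λ { (σ₂ , es₂ , ps₂ , re₂ , en₂ , tr₂ , len₂ , C₂ , st₂) →
      σ₂ , _ , ps₁ ++ ps₂ , reaches-trans re₁ re₂ , enumerates-∷ sep en₁ en₂ ,
      subst (Enumerating delayBound (es₁ ++ es₂)) (sym (map-++ (map toℕ) ps₁ ps₂)) (enumerating-++ tr₁ tr₂) ,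
      time-bound es₁ es₂ ps₁ ps₂ len₁ len₂ , C₂ , st₂ } }
    where
    room-first : length (allWords bs ++ ws) + Wt * E * fuel ≤ Bd
    room-first = linear (length (allWords bs ++ ws) ∷ length ws ∷ length bs * E ∷ E ∷ Wt * E * fuel ∷ Bd ∷ length (allWords bs) ∷ [])
      (hyp 1 (# 1 ∔ (# 3 ∔ # 2) ∔ # 4) (# 5) room
      (hyp 1 (# 0) (# 6 ∔ # 1) (≤-reflexive (length-++ (allWords bs)))
      (hyp 1 (# 6) (# 2) (allWords-length bs (All.map solution Ps)) none))) (# 0 ∔ # 4) (# 5)
    room-rest : length ws + length bs * E + Wt * E * fuel ≤ Bd
    room-rest = ≤-trans (+-monoˡ-≤ _ (+-monoʳ-≤ (length ws) (m≤n+m (length bs * E) E))) room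
    time-bound : ∀ es₁ es₂ (ps₁ ps₂ : List (List V)) → length es₁ + pushTime * 1 ≤ solutionTime * length ps₁ →
      length es₂ + pushTime * length bs ≤ solutionTime * length ps₂ →
      length (es₁ ++ es₂) + pushTime * suc (length bs) ≤ solutionTime * length (ps₁ ++ ps₂)
    time-bound es₁ es₂ ps₁ ps₂ le₁ le₂ =
      ≤-trans (≤-reflexive (cong₂ _+_ (length-++ es₁) (*-suc pushTime (length bs))))
      (≤-trans (linear (length es₁ ∷ length es₂ ∷ pushTime * 1 ∷ pushTime ∷ pushTime * length bs ∷ solutionTime * length ps₁ ∷ solutionTime * length ps₂ ∷ [])
        (hyp 1 (# 0 ∔ # 2) (# 5) le₁ (hyp 1 (# 1 ∔ # 4) (# 6) le₂ (hyp 1 (# 3) (# 2) (≤-reflexive (sym (*-identityʳ pushTime))) none)))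
        (# 0 ∔ # 1 ∔ (# 3 ∔ # 4)) (# 5 ∔ # 6))
      (≤-reflexive (trans (sym (*-distribˡ-+ solutionTime (length ps₁) (length ps₂))) (cong (solutionTime *_) (sym (length-++ ps₁))))))

  -- Reading the input and finding a first path.

  block : V → List ℕ
  block v = deg v ∷ map toℕ (nbrs v)

  readLoop : Cmd
  readLoop = while (! nᵣ ⊖ ! kᵣ) (offA ‹ ! kᵣ ›← ! pᵣ ⨾ pᵣ ← ! pᵣ ⊕ lit 1 ⊕ input (! pᵣ) ⨾ increment kᵣ)

  -- The blocks of the input have different lengths, so where the next one begins is known only from
  -- the degree just read.
  readLoop-correct : ∀ vs {σ} → var σ nᵣ ≡ n → CountsFrom (var σ kᵣ) vs → Holds inp (var σ pᵣ) (concatMap block vs) →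
    var σ pᵣ + length (concatMap block vs) ≤ base → (∀ v → toℕ v < var σ kᵣ → Located (arr σ offA) v) →
    ∃₂ λ σ′ T → Silently readLoop σ T σ′ × T ≤ 25 * length vs + 5 × (∀ v → Located (arr σ′ offA) v)
  readLoop-correct [] {σ} n≡ k≡ _ _ loc = σ , _ , stop-s _ (trans (cong₂ _∸_ n≡ k≡) (n∸n≡0 n)) , ≤-refl ,
    λ v → loc v (≤-trans (Fin.toℕ<n v) (≤-reflexive (sym k≡)))
  readLoop-correct (u ∷ vs) {σ} n≡ (k≡ , counts) (d≡ , h) room loc =
    case readLoop-correct vs {σ₁} n≡ (subst (λ k → CountsFrom k vs) (+-comm 1 k) counts)
           (subst (λ p → Holds inp p (concatMap block vs)) next≡ (Holds-++ʳ (map toℕ (nbrs u)) h)) room₁ loc₁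
    of λ { (σ′ , T , ex , le , all) →
      σ′ , _ , loop-s _ (λ z → <⇒≱ k<n (≤-trans (≤-reflexive (sym n≡)) (m∸n≡0⇒m≤n z)))
        (store-s _ _ ⨾ₛ assign-s ((_ , _ , ≤-trans (≤-reflexive (+-comm p 1)) (≤-trans p<base base≤Bd)) , (_ , p<base) , ≤-trans (m+n≤o⇒m≤o _ room₁) base≤Bd) ⨾ₛ
         assign-s (_ , _ , ≤-trans (≤-reflexive (+-comm k 1)) (≤-trans k<n n≤Bd))) ex ,
      linear (T ∷ length vs ∷ []) (hyp 1 (# 0) (25 · # 1 ∔ κ 5) le none) (κ 25 ∔ # 0) (25 · (κ 1 ∔ # 1) ∔ κ 5) , all }
    where
    p k : ℕ
    p = var σ pᵣ
    k = var σ kᵣ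
    σ₁ : Store
    σ₁ = setVar (setVar (setArr σ offA k p) pᵣ (p + 1 + inp p)) kᵣ (k + 1)
    k<n : k < n
    k<n = ≤-trans (≤-reflexive (cong suc (sym k≡))) (Fin.toℕ<n u)
    len≡ : length (map toℕ (nbrs u) ++ concatMap block vs) ≡ deg u + length (concatMap block vs)
    len≡ = trans (length-++ (map toℕ (nbrs u))) (cong (_+ length (concatMap block vs)) (length-map toℕ (nbrs u)))
    next≡ : suc p + length (map toℕ (nbrs u)) ≡ p + 1 + inp p
    next≡ = cong₂ _+_ (+-comm 1 p) (trans (length-map toℕ (nbrs u)) (sym d≡))
    room₁ : p + 1 + inp p + length (concatMap block vs) ≤ base
    room₁ = linear (p ∷ inp p ∷ deg u ∷ length (concatMap block vs) ∷ base ∷ length (map toℕ (nbrs u) ++ concatMap block vs) ∷ [])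
      (hyp 1 (# 0 ∔ (κ 1 ∔ # 5)) (# 4) room (hyp 1 (# 2 ∔ # 3) (# 5) (≤-reflexive (sym len≡)) (hyp 1 (# 1) (# 2) (≤-reflexive d≡) none)))
      (# 0 ∔ κ 1 ∔ # 1 ∔ # 3) (# 4)
    p+deg<base : p + deg u < base
    p+deg<base = linear (p ∷ inp p ∷ deg u ∷ length (concatMap block vs) ∷ base ∷ [])
      (hyp 1 (# 0 ∔ κ 1 ∔ # 1 ∔ # 3) (# 4) room₁ (hyp 1 (# 2) (# 1) (≤-reflexive (sym d≡)) none)) (κ 1 ∔ (# 0 ∔ # 2)) (# 4)
    p<base : p < base
    p<base = ≤-<-trans (m≤m+n p (deg u)) p+deg<base
    loc₁ : ∀ v → toℕ v < k + 1 → Located (arr σ offA [ k ≔ p ]) v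
    loc₁ v lt with toℕ v ≟ k
    ... | yes e with Fin.toℕ-injective (trans e (sym k≡))
    ...   | refl = record
      { degree-at = trans (cong inp off≡) d≡
      ; nbrs-at = subst (λ a → Holds inp (suc a) (map toℕ (nbrs u))) (sym off≡) (Holds-++ˡ (map toℕ (nbrs u)) h)
      ; in-input = subst (λ a → a + deg u < base) (sym off≡) p+deg<base }
      where
      off≡ : (arr σ offA [ k ≔ p ]) (toℕ u) ≡ p
      off≡ = subst (λ i → (arr σ offA [ k ≔ p ]) i ≡ p) (sym k≡) (upd-same (arr σ offA) k p)
    loc₁ v lt | no ne = record
      { degree-at = trans (cong inp off≡) (degree-at L)
      ; nbrs-at = subst (λ a → Holds inp (suc a) (map toℕ (nbrs v))) (sym off≡) (nbrs-at L)
      ; in-input = subst (λ a → a + deg v < base) (sym off≡) (in-input L) }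
      where
      L = loc v (≤∧≢⇒< (≤-pred (≤-trans lt (≤-reflexive (+-comm k 1)))) ne)
      off≡ : (arr σ offA [ k ≔ p ]) (toℕ v) ≡ arr σ offA (toℕ v)
      off≡ = upd-other (arr σ offA) p ne

  readInput-correct : ∀ {σ} → length (encode G A s t) ≤ base →
    ∃₂ λ σ′ T → Silently readInput σ T σ′ × T ≤ 25 * n + 18 × Context σ′
  readInput-correct {σ} fits =
    case holds-input [] (encode G A s t) of λ { (n≡ , s≡ , t≡ , h) →
    case readLoop-correct (allFin n) {σ₁} n≡ (counts-tabulate n id 0 (λ _ → refl) refl) h fits (λ _ ()) of λ { (σ′ , T , ex , le , all) →
      σ′ , _ ,
      (assign-s (_ , ≤-trans (s≤s z≤n) fits) ⨾ₛ assign-s (_ , ≤-trans (s≤s (s≤s z≤n)) fits) ⨾ₛ assign-s (_ , ≤-trans (s≤s (s≤s (s≤s z≤n))) fits) ⨾ₛ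
       assign-s _ ⨾ₛ assign-s _ ⨾ₛ ex) ,
      linear (T ∷ length (allFin n) ∷ n ∷ []) (hyp 1 (# 0) (25 · # 1 ∔ κ 5) le (hyp 25 (# 1) (# 2) (≤-reflexive (length-tabulate {n = n} id)) none))
        (κ 13 ∔ # 0) (25 · # 2 ∔ κ 18) ,
      record { n-reg = trans (kept ex nᵣ) n≡ ; s-reg = trans (kept ex sᵣ) s≡ ; t-reg = trans (kept ex tᵣ) t≡ ; located = all } } }
    where
    σ₁ : Store
    σ₁ = setVar (setVar (setVar (setVar (setVar σ nᵣ (inp 0)) sᵣ (inp 1)) tᵣ (inp 2)) pᵣ 3) kᵣ 0

  data FirstPath (σ : Store) : Set where
    found : ∀ {c} → Solution (s ∷ c) → StackRep (var σ spᵣ) (arr σ stackA) (words (entry [ s ] c) ++ []) → FirstPath σ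
    none  : var σ spᵣ ≡ 0 → (∀ {p} → ¬ Solution p) → FirstPath σ

  solution-s : ∀ {p} → Solution p → ∃ λ c → p ≡ s ∷ c
  solution-s {_ ∷ c} (refl , _) = c , refl

  record FirstSearch (σ : Store) : Set where
    field
      {reached} : List V
      {rank-of} : V → ℕ
      searched  : Search rank-of 1 (arr σ flagA) reached [] [] []
      rank-1    : ∀ {v} → v ≢ s → rank-of v ≡ 1

  firstSearch-correct : ∀ {σ} → Context σ → ∃₂ λ σ′ T → Silently firstSearch σ T σ′ × T ≤ 29 * n + 64 * Wt + 45 × Context σ′ × FirstSearch σ′
  firstSearch-correct {σ} C =
    case initSearch-correct {e = lit 1} 1 (var σ lᵣ) (s≤s z≤n) (λ _ → _ , refl) {σ} C refl of λ { (σ₁ , T₁ , ex₁ , le₁ , R₁ , ft , ¬f , B₁) →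
    after-init ex₁ le₁ (context-kept ex₁ C) R₁ ft ¬f B₁ }
    where
    after-init : ∀ {σ₁ T₁} → Silently (initSearch (lit 1)) σ T₁ σ₁ → T₁ ≤ 29 * n + 18 → Context σ₁ → RankRep (arr σ₁ rankA) (λ _ → 1) →
      Flagged (arr σ₁ flagA) t → (∀ v → v ≢ t → ¬ Flagged (arr σ₁ flagA) v) → BagRep (var σ₁ bpᵣ) (arr σ₁ bagA) [] →
      ∃₂ λ σ′ T → Silently firstSearch σ T σ′ × T ≤ 29 * n + 64 * Wt + 45 × Context σ′ × FirstSearch σ′
    after-init {σ₁} {T₁} ex₁ le₁ C₁ R₁ ft ¬f B₁ =
      case search-correct n {F} {1} {[]} {[ t ]} {σ₂} ≤-refl C₁ (λ _ → refl) refl (bag-push {bag = arr σ₁ bagA} B₁ (t-reg C₁))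
           (start-search 1 ft (λ {v} → ¬f v) (≤-reflexive (sym (F≡ (s≢t ∘ sym))))) of λ { (σ₃ , T₃ , D , ex₃ , le₃ , _ , S) →
        σ₃ , _ ,
        (ex₁ ⨾ₛ store-s _ _ ⨾ₛ (store-s _ _ ⨾ₛ assign-s (_ , _ , bag-room {bag = arr σ₁ bagA} {x = t} B₁ ([] ∷ []))) ⨾ₛ assign-s _ ⨾ₛ ex₃) ,
        linear (T₁ ∷ T₃ ∷ n ∷ total weight D ∷ Wt ∷ [])
          (hyp 1 (# 0) (29 · # 2 ∔ κ 18) le₁ (hyp 1 (# 1 ∔ κ 0) (64 · # 3 ∔ κ 3) le₃
          (hyp 64 (# 3) (# 4) (total-weight (unique-L S)) none)))
          (# 0 ∔ (κ 9 ∔ (κ 13 ∔ (κ 2 ∔ # 1)))) (29 · # 2 ∔ 64 · # 4 ∔ κ 45) ,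
        context-kept ex₃ C₁ , record { searched = S ; rank-1 = F≡ } }
      where
      F : V → ℕ
      F v = (arr σ₁ rankA [ var σ₁ sᵣ ≔ 0 ]) (toℕ v)
      F≡ : ∀ {v} → v ≢ s → F v ≡ 1
      F≡ {v} v≢s = trans (upd-other (arr σ₁ rankA) 0 (λ e → v≢s (Fin.toℕ-injective (trans e (s-reg C₁))))) (R₁ v)
      σ₂ : Store
      σ₂ = setVar (setVar (setArr (setArr σ₁ rankA (var σ₁ sᵣ) 0) bagA (var σ₁ bpᵣ) (var σ₁ tᵣ)) bpᵣ (var σ₁ bpᵣ + 1)) levᵣ 1

  firstPath-correct : ∀ {σ} → Context σ → ∃₂ λ σ′ T → Silently firstPath σ T σ′ × T ≤ 70 * n + 64 * Wt + 127 × Context σ′ × FirstPath σ′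
  firstPath-correct {σ} C =
    case firstSearch-correct {σ} C of λ { (σ₁ , T₁ , ex₁ , le₁ , C₁ , I) → after-search ex₁ le₁ C₁ I }
    where
    -- A solution visits `s` only at its start, so all its other vertices have rank 1 and the search
    -- would have flagged `s`.
    unreachable : ∀ {F P D} → Search F 1 P D [] [] [] → (∀ {v} → v ≢ s → F v ≡ 1) → P (toℕ s) ≡ 0 → ∀ {p} → ¬ Solution p
    unreachable S F≡ z Sp with solution-s Sp
    ... | c , refl = reachable-flagged S (All.tabulate (λ {w} w∈ → ≤-reflexive (sym (F≡ (ne w∈))))) (proj₂ Sp) z
      where
      ne : ∀ {w} → w ∈ c → w ≢ s
      ne w∈ refl with unique (proj₂ Sp)
      ... | s∉ ∷ _ = All.lookup s∉ w∈ refl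

    after-search : ∀ {σ₁ T₁} → Silently firstSearch σ T₁ σ₁ → T₁ ≤ 29 * n + 64 * Wt + 45 → Context σ₁ → FirstSearch σ₁ →
      ∃₂ λ σ′ T → Silently firstPath σ T σ′ × T ≤ 70 * n + 64 * Wt + 127 × Context σ′ × FirstPath σ′
    after-search {σ₁} {T₁} ex₁ le₁ C₁ I with arr σ₁ flagA (toℕ s) ≟ 0
    ... | yes z = _ , _ ,
      (ex₁ ⨾ₛ assign-s _ ⨾ₛ assign-s _ ⨾ₛ assign-s _ ⨾ₛ unless-s _ (trans s-flag z)) ,
      linear (T₁ ∷ n ∷ Wt ∷ []) (hyp 1 (# 0) (29 · # 1 ∔ 64 · # 2 ∔ κ 45) le₁ none) (# 0 ∔ (κ 2 ∔ (κ 2 ∔ (κ 2 ∔ κ 10)))) (70 · # 1 ∔ 64 · # 2 ∔ κ 127) ,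
      C₁ , none refl (unreachable (FirstSearch.searched I) (FirstSearch.rank-1 I) z)
      where
      s-flag : arr σ₁ flagA (var σ₁ sᵣ) ≡ arr σ₁ flagA (toℕ s)
      s-flag = cong (arr σ₁ flagA) (s-reg C₁)
    ... | no fs =
      case chain (FirstSearch.searched I) fs of λ { (c , p , fo , _) →
      case push-correct {s} {[]} {c} {setVar (setVar (setVar σ₁ spᵣ 0) iᵣ 0) xᵣ (var σ₁ sᵣ)} {[]} tt refl (s-reg C₁) (t-reg C₁) p fo
             (entry-length (entry [ s ] c) (refl , p)) (stackRep refl tt) (≤-trans (n≤1+n _) n<Bd)
      of λ { (σ₄ , T₄ , ex₄ , le₄ , st) →
        σ₄ , _ , (ex₁ ⨾ₛ assign-s _ ⨾ₛ assign-s _ ⨾ₛ assign-s _ ⨾ₛ when-s _ (λ z → fs (trans (sym s-flag) z)) ex₄) ,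
        linear (T₁ ∷ T₄ ∷ n ∷ Wt ∷ [])
          (hyp 1 (# 0) (29 · # 2 ∔ 64 · # 3 ∔ κ 45) le₁ (hyp 1 (# 1) (41 · # 2 ∔ κ 67) le₄ none))
          (# 0 ∔ (κ 2 ∔ (κ 2 ∔ (κ 2 ∔ (κ 9 ∔ # 1))))) (70 · # 2 ∔ 64 · # 3 ∔ κ 127) ,
        context-kept ex₄ C₁ , found (refl , p) st } }
      where
      s-flag : arr σ₁ flagA (var σ₁ sᵣ) ≡ arr σ₁ flagA (toℕ s)
      s-flag = cong (arr σ₁ flagA) (s-reg C₁)

  record Solved (σ : Store) : Set where
    field
      {final}    : Store
      {events}   : List Event
      {paths}    : List (List V)
      before     : ℕ
      -- The three trailing events are the failing test of the main loop.
      whole-run  : Exec enumeration σ (silents before ++ events ++ silents 3) final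
      soon       : before ≤ 95 * n + 64 * Wt + 145
      enumerates : IsEnumeration G s t paths
      trace      : Enumerating delayBound events (map (map toℕ) paths)
      quick      : length events ≤ solutionTime * length paths

  enumeration-correct : ∀ σ → length (encode G A s t) ≤ base → Wt * E * n ≤ Bd → Solved σ
  enumeration-correct σ fits room =
    case readInput-correct {σ} fits of λ { (σ₁ , T₁ , ex₁ , le₁ , C₁) →
    case firstPath-correct {σ₁} C₁ of λ { (σ₂ , T₂ , ex₂ , le₂ , C₂ , fp) →
    let soon′ : T₁ + T₂ ≤ 95 * n + 64 * Wt + 145
        soon′ = linear (T₁ ∷ T₂ ∷ n ∷ Wt ∷ []) (hyp 1 (# 0) (25 · # 2 ∔ κ 18) le₁ (hyp 1 (# 1) (70 · # 2 ∔ 64 · # 3 ∔ κ 127) le₂ none))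
          (# 0 ∔ # 1) (95 · # 2 ∔ 64 · # 3 ∔ κ 145)
        run : ∀ {es σ′} → Exec mainLoop σ₂ es σ′ → Exec enumeration σ (silents (T₁ + T₂) ++ es) σ′
        run {es} ex = exact (trans (sym (++-assoc (silents T₁) (silents T₂) es)) (cong (_++ es) (silents-+ T₁)))
          (Silently.execution ex₁ ⨾ Silently.execution ex₂ ⨾ ex)
    in finish-up soon′ run C₂ fp } }
    where
    finish-up : ∀ {σ₂ T} → T ≤ 95 * n + 64 * Wt + 145 → (∀ {es σ′} → Exec mainLoop σ₂ es σ′ → Exec enumeration σ (silents T ++ es) σ′) →
      Context σ₂ → FirstPath σ₂ → Solved σ
    finish-up {T = T} le run C (none z no-solution) = record
      { before = T ; whole-run = run (while-stop _ z) ; soon = le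
      ; enumerates = record { once = [] ; exact = λ p → mk⇔ (λ ()) (λ cp → ⊥-elim (no-solution (Equivalence.from (solution⇔ p) cp))) }
      ; trace = enumerating-[] ; quick = z≤n }
    finish-up {σ₂} {T} le run C (found {c} Ss st) =
      case process n (entry [ s ] c) {[]} {σ₂} (record { solution = Ss ; nonempty = ≤-refl ; fuelled = ≤-refl }) room C st of λ { (σ₃ , es , ps , re , en , tr , len , C₃ , st₃) →
      record
        { before = T ; whole-run = run (resume re (while-stop _ (stack-size st₃))) ; soon = le
        ; enumerates = record
          { once = Enumerates.once en
          ; exact = λ p → mk⇔ (λ p∈ → Equivalence.to (solution⇔ p) (proj₁ (All.lookup (Enumerates.sound en) p∈)))
                               (λ cp → let S = Equivalence.from (solution⇔ p) cp in Enumerates.exact en (S , continued (proj₂ (solution-s S)))) }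
        ; trace = tr ; quick = m+n≤o⇒m≤o (length es) len } }

-- The arrays start at n + n * n + 3, a bound on the length of the input that can
-- be computed from its first word n before anything is written to the memory.
baseCode : Program
baseCode =
    load 3 0
  ∷ load 5 0
  ∷ load 1 0
  ∷ const 7 1
  ∷ add 1 1 3
  ∷ sub 5 5 7
  ∷ jumpIf 5 4
  ∷ const 7 3
  ∷ add 1 1 7
  ∷ []

machineCode : Cmd → Program
machineCode c = baseCode ++ compile 9 c ++ [ halt ]

-- Registers 3, 5 and 7 are temporaries, so the variables still hold 0 when the compiled code
-- starts.
record Booting (a k n m : ℕ) (reg : ℕ → ℕ) : Set where
  field
    at-0 : reg 0 ≡ 0
    at-1 : reg 1 ≡ a
    at-3 : reg 3 ≡ n
    at-5 : reg 5 ≡ k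
    at-7 : reg 7 ≡ m
    vars : ∀ x → reg (varReg x) ≡ 0

untouched-1 : ∀ f {m} x → f (varReg x) ≡ 0 → (f [ 1 ≔ m ]) (varReg x) ≡ 0
untouched-1 f x e = trans (upd-other f _ (λ eq → <⇒≢ (2≤varReg x) (sym eq))) e

untouched-tmp : ∀ d f {m} x → f (varReg x) ≡ 0 → (f [ tmpReg d ≔ m ]) (varReg x) ≡ 0
untouched-tmp d f x e = trans (upd-other f _ (varReg≢tmpReg x d)) e

module Boot (c : Cmd) (n W : ℕ) (mem : ℕ → ℕ) (mem-0 : mem 0 ≡ suc n) (fits : suc n + suc n * suc n + 3 ≤ W) where
  P : Program
  P = machineCode c

  -- Multiplication by repeated addition. The loop tests after its body, so its counter has to start
  -- positive, as the order of a graph with a vertex is.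
  boot-loop : ∀ k {a reg} → Booting a (suc k) (suc n) 1 reg → a + suc k * suc n ≤ W → suc k ≤ W →
    ∃ λ reg′ → Steps W P ⟨ 4 , reg , mem ⟩ (silents (suc k * 3)) ⟨ 7 , reg′ , mem ⟩ × Booting (a + suc k * suc n) 0 (suc n) 1 reg′
  boot-loop k {a} {reg} B le k≤ with k
  ... | zero = reg₂ ,
        (step-add refl (cong₂ _+_ at-1 at-3) le₁ then step-sub {x = 0} refl (cong₂ _∸_ at-5 at-7) z≤n then step-fallthrough {r = 5} {l = 4} refl refl then done) ,
        record { at-0 = at-0 ; at-1 = sym (cong (a +_) (+-identityʳ (suc n))) ; at-3 = at-3 ; at-5 = refl ; at-7 = at-7
               ; vars = λ x → untouched-tmp 1 reg₁ x (untouched-1 reg x (vars x)) }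
        where
        open Booting B
        reg₁ = reg [ 1 ≔ a + suc n ]
        reg₂ = reg₁ [ 5 ≔ 0 ]
        le₁ : a + suc n ≤ W
        le₁ = subst (_≤ W) (cong (a +_) (+-identityʳ (suc n))) le
  ... | suc j =
        case boot-loop j {a + suc n} {reg₂}
               (record { at-0 = at-0 ; at-1 = refl ; at-3 = at-3 ; at-5 = refl ; at-7 = at-7
                       ; vars = λ x → untouched-tmp 1 reg₁ x (untouched-1 reg x (vars x)) })
               (subst (_≤ W) (sym (+-assoc a (suc n) _)) le) (≤-trans (n≤1+n _) k≤) of λ { (reg′ , ss , B′) →
          reg′ ,
          (step-add refl (cong₂ _+_ at-1 at-3) (≤-trans (+-monoʳ-≤ a (m≤m+n (suc n) _)) le) then
           step-sub {x = suc j} refl (cong₂ _∸_ at-5 at-7) (≤-trans (n≤1+n _) k≤) then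
           step-jumpIf {r = 5} {l = 4} refl (λ ()) then ss) ,
          subst (λ b → Booting b 0 (suc n) 1 reg′) (+-assoc a (suc n) _) B′ }
        where
        open Booting B
        reg₁ = reg [ 1 ≔ a + suc n ]
        reg₂ = reg₁ [ 5 ≔ suc j ]

  bootTime : ℕ
  bootTime = 4 + (suc n * 3 + 2)

  boot : ∃ λ reg → Steps W P ⟨ 0 , (λ _ → 0) , mem ⟩ (silents bootTime) ⟨ 9 , reg , mem ⟩ ×
    reg 0 ≡ 0 × reg 1 ≡ suc n + suc n * suc n + 3 × (∀ x → reg (varReg x) ≡ 0)
  boot =
    case boot-loop n {suc n} {reg₄} (record { at-0 = refl ; at-1 = refl ; at-3 = refl ; at-5 = refl ; at-7 = refl
             ; vars = λ x → untouched-tmp 2 reg₃ x (untouched-1 reg₂ x (untouched-tmp 1 reg₁ x (untouched-tmp 0 (λ _ → 0) x refl))) })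
           (≤-trans (m≤m+n _ 3) fits) n≤W of λ { (reg₅ , ss , B) →
      let reg₆ = reg₅ [ 7 ≔ 3 ]
          reg₇ = reg₆ [ 1 ≔ suc n + suc n * suc n + 3 ]
          open Booting B
      in reg₇ ,
      retarget (trans (cong (silents 4 ++_) (silents-+ (suc n * 3))) (silents-+ 4 {suc n * 3 + 2})) refl
        ((step-load refl mem-0 n≤W then step-load refl mem-0 n≤W then step-load refl mem-0 n≤W then
          step-const refl (≤-trans (s≤s z≤n) n≤W) then done)
         followedBy ss followedBy
         (step-const refl (≤-trans (m≤n+m 3 (suc n + suc n * suc n)) fits) then step-add {a = 1} {b = 7} refl (cong (_+ 3) at-1) fits then done)) ,
      at-0 , refl , λ x → untouched-1 reg₆ x (untouched-tmp 2 reg₅ x (vars x)) }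
    where
    n≤W : suc n ≤ W
    n≤W = ≤-trans (m≤m+n (suc n) _) (≤-trans (m≤m+n _ 3) fits)
    reg₁ = (λ _ → 0) [ 3 ≔ suc n ]
    reg₂ = reg₁ [ 5 ≔ suc n ]
    reg₃ = reg₂ [ 1 ≔ suc n ]
    reg₄ = reg₃ [ 7 ≔ 1 ]

  code-at : CodeAt P 9 (compile 9 c) × at P (9 + codeSize c) ≡ just halt
  code-at with codeAt-++ P 9 (compile 9 c) (length-compile 9 c)
                 (subst (λ is → CodeAt (baseCode ++ is) 9 (compile 9 c ++ [ halt ])) (++-identityʳ (compile 9 c ++ [ halt ]))
                   (codeAt-middle baseCode (compile 9 c ++ [ halt ]) []))
  ... | code , (h , _) = code , h

  module _ (Bd : ℕ) (mem≤Bd : ∀ i → mem i ≤ Bd) (8≤Bd : 8 ≤ Bd) where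
    base : ℕ
    base = suc n + suc n * suc n + 3
    open Semantics base Bd mem

    -- The arrays begin with whatever the memory holds at their cells.
    run-machine : ∀ {es σ} → octuple Bd + base + 8 ≤ W →
      Exec c (store (λ _ → 0) (λ k i → mem (cell base i k))) es σ →
      Run W (machineCode c) ⟨ 0 , (λ _ → 0) , mem ⟩ (silents bootTime ++ es ++ [ silent ])
    run-machine big ex =
      case boot of λ { (reg , ss , z , b , vs) →
      case correct ex (proj₁ code-at) (record { zero-reg = z ; base-reg = b ; vars = vs ; arrs = λ _ _ → refl ; inps = λ _ _ → refl
             ; var-bound = λ _ → z≤n ; arr-bound = λ _ _ → mem≤Bd _ }) of λ { (reg′ , mem′ , ss′ , _) →
        run-steps ss (run-steps ss′ (stop (step-halt {W} {P} {9 + codeSize c} {reg′} {mem′} (proj₂ code-at)))) } }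
      where open Correctness W mem≤Bd 8≤Bd big P

-- The sum of the degrees.

module Handshake (G : Graph) (A : AdjacencyLists G) where
  open Graph G using (_~_; ~-sym; ~-irrefl; _~?_; edges) renaming (order to n)
  open AdjacencyLists A renaming (once to nbrs-unique; exact to nbrs-exact; neighbours to nbrs)

  darts : List (Fin n) → List (Fin n × Fin n)
  darts []       = []
  darts (v ∷ vs) = map (v ,_) (nbrs v) ++ darts vs

  darts-length : ∀ vs → length vs + length (darts vs) ≡ total (λ v → suc (length (nbrs v))) vs
  darts-length []       = refl
  darts-length (v ∷ vs) = cong suc (begin
    length vs + length (map (v ,_) (nbrs v) ++ darts vs)
      ≡⟨ cong (length vs +_) (trans (length-++ (map (v ,_) (nbrs v))) (cong (_+ length (darts vs)) (length-map (v ,_) (nbrs v)))) ⟩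
    length vs + (length (nbrs v) + length (darts vs)) ≡⟨ +-assoc (length vs) _ _ ⟨
    length vs + length (nbrs v) + length (darts vs)   ≡⟨ cong (_+ length (darts vs)) (+-comm (length vs) _) ⟩
    length (nbrs v) + length vs + length (darts vs)   ≡⟨ +-assoc (length (nbrs v)) _ _ ⟩
    length (nbrs v) + (length vs + length (darts vs)) ≡⟨ cong (length (nbrs v) +_) (darts-length vs) ⟩
    length (nbrs v) + total (λ v → suc (length (nbrs v))) vs ∎)
    where open ≡-Reasoning

  darts-∈ : ∀ vs {u w} → (u , w) ∈ darts vs → u ∈ vs × u ~ w
  darts-∈ (v ∷ vs) {u} {w} p∈ with ∈-++⁻ (map (v ,_) (nbrs v)) p∈
  ... | inj₂ q∈ = let a , b = darts-∈ vs q∈ in there a , b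
  ... | inj₁ q∈ with ∈-map⁻ (v ,_) q∈
  ...   | _ , x∈ , refl = here refl , Equivalence.to (nbrs-exact v w) x∈

  darts-unique : ∀ {vs} → Unique vs → Unique (darts vs)
  darts-unique []       = []
  darts-unique {v ∷ vs} (v∉ ∷ u) = Unique.++⁺ (Unique.map⁺ (λ { refl → refl }) (nbrs-unique v)) (darts-unique u) disjoint
    where
    disjoint : ∀ {p} → ¬ (p ∈ map (v ,_) (nbrs v) × p ∈ darts vs)
    disjoint (p∈ , q∈) with ∈-map⁻ (v ,_) p∈
    ... | _ , _ , refl = All.lookup v∉ (proj₁ (darts-∈ vs q∈)) refl

  darts⊆edges : ∀ {p} → p ∈ darts (allFin n) → p ∈ edges ++ map swap edges
  darts⊆edges {u , w} p∈ with darts-∈ (allFin n) p∈ | Fin.<-cmp u w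
  ... | _ , u~w | tri< u<w _ _ = ∈-++⁺ˡ (∈-filter⁺ (λ (u , v) → (u Fin.<? v) ×-dec (u ~? v)) (∈-cartesianProduct⁺ (∈-allFin u) (∈-allFin w)) (u<w , u~w))
  ... | _ , u~w | tri≈ _ refl _ = ⊥-elim (~-irrefl refl u~w)
  ... | _ , u~w | tri> _ _ w<u = ∈-++⁺ʳ edges (∈-map⁺ swap (∈-filter⁺ (λ (u , v) → (u Fin.<? v) ×-dec (u ~? v)) (∈-cartesianProduct⁺ (∈-allFin w) (∈-allFin u)) (w<u , ~-sym u~w)))

  -- The pairs of a vertex and a neighbour are distinct, and each is an edge in one of its two
  -- orientations.
  total-degrees : total (λ v → suc (length (nbrs v))) (allFin n) ≤ 2 * size G
  total-degrees = begin
    total (λ v → suc (length (nbrs v))) (allFin n) ≡⟨ darts-length (allFin n) ⟨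
    length (allFin n) + length (darts (allFin n))  ≤⟨ +-mono-≤ (≤-reflexive (length-tabulate {n = n} id)) few-darts ⟩
    n + (length edges + length edges)              ≤⟨ linear (n ∷ length edges ∷ []) none (# 0 ∔ (# 1 ∔ # 1)) (2 · (# 0 ∔ # 1)) ⟩
    2 * size G                                     ∎
    where
    open ≤-Reasoning
    few-darts : length (darts (allFin n)) ≤ length edges + length edges
    few-darts = begin
      length (darts (allFin n))              ≡⟨ total-1 (darts (allFin n)) ⟨
      total (λ _ → 1) (darts (allFin n))     ≤⟨ total-⊆ (λ _ → 1) (darts-unique (Unique.allFin⁺ n)) darts⊆edges ⟩
      total (λ _ → 1) (edges ++ map swap edges) ≡⟨ total-1 (edges ++ map swap edges) ⟩
      length (edges ++ map swap edges)       ≡⟨ trans (length-++ edges) (cong (length edges +_) (length-map swap edges)) ⟩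
      length edges + length edges            ∎

bounded-words : ∀ {m} xs → All (_≤ m) xs → ∀ i → fromMaybe 0 (at xs i) ≤ m
bounded-words []       _        zero    = z≤n
bounded-words []       _        (suc i) = z≤n
bounded-words (x ∷ xs) (h ∷ _)  zero    = h
bounded-words (x ∷ xs) (_ ∷ hs) (suc i) = bounded-words xs hs i

successor : ∀ {k} → Fin k → ∃ λ m → k ≡ suc m
successor {suc k} _ = k , refl

-- Bounds in terms of the size of the graph.

module Bounds (G : Graph) (s t : Vertex G) (s≢t : s ≢ t) (A : AdjacencyLists G) (m : ℕ) (order≡ : Graph.order G ≡ suc m) where
  open Graph G using () renaming (order to n)
  open AdjacencyLists A renaming (once to nbrs-unique; exact to nbrs-exact; neighbours to nbrs)

  base S : ℕ
  base = suc m + suc m * suc m + 3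
  S    = size G

  Wt : ℕ
  Wt = total (λ v → suc (length (nbrs v))) (allFin n)

  -- A sum of everything that has to fit: positions in the input, the stack with `n` generations of
  -- `Wt` entries, and 11 + `n` for the requirements 3 + `n` and 8.
  Bd : ℕ
  Bd = base + Wt * (2 + n) * n + (11 + n)

  base≤Bd : base ≤ Bd
  base≤Bd = ≤-trans (m≤m+n base _) (m≤m+n _ (11 + n))

  n<Bd : 3 + n ≤ Bd
  n<Bd = ≤-trans (+-monoˡ-≤ n (m≤m+n 3 8)) (m≤n+m (11 + n) (base + Wt * (2 + n) * n))

  8≤Bd : 8 ≤ Bd
  8≤Bd = ≤-trans (m≤m+n 8 (3 + n)) (m≤n+m (11 + n) (base + Wt * (2 + n) * n))

  open Algorithm G s t s≢t A base Bd base≤Bd n<Bd hiding (Wt)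

  n≤S : n ≤ S
  n≤S = m≤m+n n _

  1≤S : 1 ≤ S
  1≤S = ≤-trans (≤-trans (s≤s z≤n) (≤-reflexive (sym order≡))) n≤S

  Wt≤ : Wt ≤ 2 * S
  Wt≤ = Handshake.total-degrees G A

  1≤Wt : 1 ≤ Wt
  1≤Wt = ≤-trans (≤-trans (s≤s z≤n) (≤-reflexive (sym order≡))) n≤Wt

  blocks-length : ∀ vs → length (concatMap block vs) ≡ total (λ v → suc (length (nbrs v))) vs
  blocks-length []       = refl
  blocks-length (v ∷ vs) = cong suc (trans (length-++ (map toℕ (nbrs v))) (cong₂ _+_ (length-map toℕ (nbrs v)) (blocks-length vs)))

  Wt≤n+n² : ∀ vs → total (λ v → suc (length (nbrs v))) vs ≤ length vs + length vs * n
  Wt≤n+n² []       = z≤n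
  Wt≤n+n² (v ∷ vs) = s≤s (≤-trans (+-mono-≤ (unique-length (nbrs-unique v)) (Wt≤n+n² vs))
    (linear (n ∷ length vs ∷ length vs * n ∷ []) none (# 0 ∔ (# 1 ∔ # 2)) (# 1 ∔ (# 0 ∔ # 2))))

  fits : length (encode G A s t) ≤ base
  fits = ≤-trans (≤-reflexive (cong (3 +_) (blocks-length (allFin n)))) (≤-trans (+-monoʳ-≤ 3 (Wt≤n+n² (allFin n)))
    (≤-trans (≤-reflexive (+-comm 3 _)) (≤-reflexive (cong (λ k → k + 3) (cong₂ _+_ len≡ (cong₂ _*_ len≡ order≡))))))
    where
    len≡ : length (allFin n) ≡ suc m
    len≡ = trans (length-tabulate {n = n} id) order≡

  words≤ : ∀ i → inp i ≤ Bd
  words≤ i = ≤-trans (bounded-words (encode G A s t) (≤-refl ∷ <⇒≤ (Fin.toℕ<n s) ∷ <⇒≤ (Fin.toℕ<n t) ∷ blocks (allFin n)) i)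
               (≤-trans (m≤n+m n 3) n<Bd)
    where
    blocks : ∀ vs → All (_≤ n) (concatMap block vs)
    blocks []       = []
    blocks (v ∷ vs) = unique-length (nbrs-unique v) ∷ All.++⁺ (All.map⁺ (All.tabulate (λ {w} _ → <⇒≤ (Fin.toℕ<n w)))) (blocks vs)

  abstract
    solved : Solved (store (λ _ → 0) (λ k i → inp (cell base i k)))
    solved = enumeration-correct _ fits (≤-trans (m≤n+m (Wt * E * n) base) (m≤m+n _ (11 + n)))

  open Solved solved

  1≤C : 1 ≤ S ^ 3
  1≤C = ^-monoʳ-≤ S {{>-nonZero 1≤S}} {0} {3} z≤n

  S≤Q : S ≤ S ^ 2
  S≤Q = ≤-trans (≤-reflexive (sym (*-identityʳ S))) (^-monoʳ-≤ S {{>-nonZero 1≤S}} {1} {2} (s≤s z≤n))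

  Q≤C : S ^ 2 ≤ S ^ 3
  Q≤C = ^-monoʳ-≤ S {{>-nonZero 1≤S}} {2} {3} (s≤s (s≤s z≤n))

  square : S * S ≡ S ^ 2
  square = cong (S *_) (sym (*-identityʳ S))

  -- Addresses reach about `8 * Bd + base`. With `Bd` at most 23 cubes of the size and `base` at
  -- most `Bd`, the required total is at most 9 * 23 + 8 = 215 cubes.
  word : ℕ
  word = 250 * S ^ 3

  Bd≤ : Bd ≤ 23 * S ^ 3
  Bd≤ = linear (suc m ∷ suc m * suc m ∷ Wt * E * n ∷ n ∷ S ∷ S ^ 2 ∷ S ^ 3 ∷ [])
    (hyp 1 (# 0) (# 3) (≤-reflexive (sym order≡)) (hyp 1 (# 1) (# 5) m²≤ (hyp 1 (# 2) (6 · # 6) volume (hyp 2 (# 3) (# 4) n≤S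
    (hyp 2 (# 4) (# 5) S≤Q (hyp 3 (# 5) (# 6) Q≤C (hyp 14 (κ 1) (# 6) 1≤C none)))))))
    (# 0 ∔ # 1 ∔ κ 3 ∔ # 2 ∔ (κ 11 ∔ # 3)) (23 · # 6)
    where
    m²≤ : suc m * suc m ≤ S ^ 2
    m²≤ = ≤-trans (≤-reflexive (cong₂ _*_ (sym order≡) (sym order≡))) (≤-trans (*-mono-≤ n≤S n≤S) (≤-reflexive square))
    E≤ : E ≤ 3 * S
    E≤ = linear (n ∷ S ∷ []) (hyp 1 (# 0) (# 1) n≤S (hyp 2 (κ 1) (# 1) 1≤S none)) (κ 2 ∔ # 0) (3 · # 1)
    volume : Wt * E * n ≤ 6 * S ^ 3
    volume = ≤-trans (*-mono-≤ (*-mono-≤ Wt≤ E≤) n≤S)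
      (≤-reflexive (solve 1 (λ x → (con 2 :* x) :* (con 3 :* x) :* x := con 6 :* (x :* (x :* (x :* con 1)))) refl S))
      where open +-*-Solver using (solve; _:=_; _:*_; con)

  big : octuple Bd + base + 8 ≤ word
  big = ≤-trans (+-monoˡ-≤ 8 (+-mono-≤ (≤-reflexive (octuple≡ Bd)) base≤Bd))
    (linear (Bd * 8 ∷ Bd ∷ S ^ 3 ∷ []) (hyp 1 (# 0) (8 · # 1) (≤-reflexive (*-comm Bd 8)) (hyp 9 (# 1) (23 · # 2) Bd≤ (hyp 8 (κ 1) (# 2) 1≤C none)))
      (# 0 ∔ # 1 ∔ κ 8) (250 · # 2))
  base≤word : base ≤ word
  base≤word = ≤-trans (≤-trans (m≤n+m base (octuple Bd)) (m≤m+n _ 8)) big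

  module Booted = Boot enumeration m word inp order≡ base≤word

  trace-of : List Event → List Event
  -- Four trailing events: the last test of the main loop takes three, and the halt is one.
  trace-of es = silents (Booted.bootTime + before) ++ es ++ silents 4

  machine-run : Run word (machineCode enumeration) (initial (encode G A s t)) (trace-of events)
  machine-run = subst (Run word (machineCode enumeration) (initial (encode G A s t))) eq
    (Booted.run-machine Bd words≤ 8≤Bd {es = silents before ++ events ++ silents 3} {σ = final} big whole-run)
    where
    boot = Booted.bootTime
    open ≡-Reasoning
    eq : silents boot ++ (silents before ++ events ++ silents 3) ++ [ silent ] ≡ trace-of events
    eq = begin
      silents boot ++ (silents before ++ events ++ silents 3) ++ [ silent ]
        ≡⟨ cong (silents boot ++_) (++-assoc (silents before) (events ++ silents 3) [ silent ]) ⟩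
      silents boot ++ silents before ++ (events ++ silents 3) ++ [ silent ]
        ≡⟨ cong (λ es → silents boot ++ silents before ++ es) (++-assoc events (silents 3) [ silent ]) ⟩
      silents boot ++ silents before ++ events ++ silents 4
        ≡⟨ ++-assoc (silents boot) (silents before) (events ++ silents 4) ⟨
      (silents boot ++ silents before) ++ events ++ silents 4
        ≡⟨ cong (_++ events ++ silents 4) (silents-+ boot) ⟩
      trace-of events ∎

  machine-outputs : outputs (trace-of events) ≡ map (map toℕ) paths
  machine-outputs = begin
    outputsFrom [] (silents (Booted.bootTime + before) ++ events ++ silents 4)
      ≡⟨ Emits.emitted (emits-silents (Booted.bootTime + before)) [] (events ++ silents 4) ⟩
    outputsFrom [] (events ++ silents 4)   ≡⟨ outs trace (silents 4) ⟩
    map (map toℕ) paths ++ []              ≡⟨ ++-identityʳ _ ⟩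
    map (map toℕ) paths                    ∎
    where open ≡-Reasoning

  boot≡ : Booted.bootTime ≤ 3 * n + 6
  boot≡ = linear (suc m ∷ suc m * 3 ∷ n ∷ []) (hyp 1 (# 1) (3 · # 0) (≤-reflexive (*-comm (suc m) 3)) (hyp 3 (# 0) (# 2) (≤-reflexive (sym order≡)) none))
    (κ 4 ∔ (# 1 ∔ κ 2)) (3 · # 2 ∔ κ 6)

  N : ℕ
  N = length paths ⊔ 1

  -- At most 702 times the size per solution, and 381 times the size for booting, the first path and
  -- halting. The latter is spent even without solutions, hence the maximum with 1.
  machine-time : time (trace-of events) ≤ 1100 * (S * N)
  machine-time = begin
    length (trace-of events)
      ≡⟨ trans (length-++ (silents (Booted.bootTime + before))) (cong₂ _+_ (length-replicate (Booted.bootTime + before)) (length-++ events)) ⟩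
    Booted.bootTime + before + (length events + 4)
      ≤⟨ +-monoʳ-≤ (Booted.bootTime + before) (+-monoˡ-≤ 4 (≤-trans quick (*-mono-≤ per-solution (m≤m⊔n (length paths) 1)))) ⟩
    Booted.bootTime + before + (702 * S * N + 4)
      ≤⟨ linear (Booted.bootTime ∷ before ∷ n ∷ Wt ∷ S ∷ 702 * S * N ∷ S * N ∷ [])
           (hyp 1 (# 0) (3 · # 2 ∔ κ 6) boot≡ (hyp 1 (# 1) (95 · # 2 ∔ 64 · # 3 ∔ κ 145) soon (hyp 98 (# 2) (# 4) n≤S (hyp 64 (# 3) (2 · # 4) Wt≤
           (hyp 155 (κ 1) (# 4) 1≤S (hyp 381 (# 4) (# 6) S≤SN (hyp 1 (# 5) (702 · # 6) (≤-reflexive (*-assoc 702 S N)) none)))))))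
           (# 0 ∔ # 1 ∔ (# 5 ∔ κ 4)) (1100 · # 6) ⟩
    1100 * (S * N) ∎
    where
    open ≤-Reasoning
    S≤SN : S ≤ S * N
    S≤SN = ≤-trans (≤-reflexive (sym (*-identityʳ S))) (*-monoʳ-≤ S (m≤n⊔m (length paths) 1))
    per-solution : solutionTime ≤ 702 * S
    per-solution = linear (Wt ∷ n ∷ S ∷ []) (hyp 256 (# 0) (2 · # 2) Wt≤ (hyp 41 (# 1) (# 2) n≤S (hyp 149 (κ 1) (# 2) 1≤S none)))
      (256 · # 0 ∔ κ 79 ∔ κ 3 ∔ (41 · # 1 ∔ κ 67)) (702 · # 2)

  delays≤ : delayBound + delayBound ≤ 1700 * S ^ 2
  delays≤ = linear (Wt ∷ pushTime * Wt ∷ S ∷ S ^ 2 ∷ [])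
    (hyp 512 (# 0) (2 · # 2) Wt≤ (hyp 2 (# 1) (216 · # 3) pushes≤ (hyp 1188 (# 2) (# 3) S≤Q (hyp 164 (κ 1) (# 2) 1≤S none))))
    (256 · # 0 ∔ κ 79 ∔ κ 3 ∔ # 1 ∔ (256 · # 0 ∔ κ 79 ∔ κ 3 ∔ # 1)) (1700 · # 3)
    where
    pushes≤ : pushTime * Wt ≤ 216 * S ^ 2
    pushes≤ = ≤-trans (*-mono-≤ (linear (n ∷ S ∷ []) (hyp 41 (# 0) (# 1) n≤S (hyp 67 (κ 1) (# 1) 1≤S none)) (41 · # 0 ∔ κ 67) (108 · # 1)) Wt≤)
      (≤-reflexive (solve 1 (λ x → (con 108 :* x) :* (con 2 :* x) := con 216 :* (x :* (x :* con 1))) refl S))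
      where open +-*-Solver using (solve; _:=_; _:*_; con)

  -- The preparation takes at most `delayBound`, so the wait for the first output is bounded like
  -- any other delay: by one such span before the iteration and one up to its output.
  machine-delays : All (_≤ 1700 * S ^ 2) (delays (trace-of events))
  machine-delays = All.map (λ le → ≤-trans le delays≤)
    (subst (All (_≤ delayBound + delayBound)) (sym (Emits.waited (emits-silents pre) 0 (events ++ silents 4)))
      (dels trace (silents 4) pre≤ (λ {d} le → at-end d le ∷ [])))
    where
    pre = Booted.bootTime + before
    pre≤ : length (silents pre) ≤ delayBound
    pre≤ = ≤-trans (≤-reflexive (length-replicate pre)) (linear (Booted.bootTime ∷ before ∷ n ∷ Wt ∷ pushTime * Wt ∷ [])
      (hyp 1 (# 0) (3 · # 2 ∔ κ 6) boot≡ (hyp 1 (# 1) (95 · # 2 ∔ 64 · # 3 ∔ κ 145) soon (hyp 98 (# 2) (# 3) n≤Wt (hyp 94 (κ 1) (# 3) 1≤Wt none))))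
      (# 0 ∔ # 1) (256 · # 3 ∔ κ 79 ∔ κ 3 ∔ # 4))
    at-end : ∀ d → d ≤ delayBound → suc (suc (suc (suc d))) ≤ delayBound + delayBound
    at-end d le = linear (d ∷ delayBound ∷ 256 * Wt ∷ pushTime * Wt ∷ [])
      (hyp 1 (# 0) (# 1) le (hyp 1 (# 2 ∔ κ 79 ∔ κ 3 ∔ # 3) (# 1) ≤-refl none)) (κ 4 ∔ # 0) (# 1 ∔ # 1)

  machine-enumerates : ∃ λ (es : List Event) → ∃ λ (ps : List (List (Vertex G))) →
    Run word (machineCode enumeration) (initial (encode G A s t)) es
    × outputs es ≡ map (map toℕ) ps
    × IsEnumeration G s t ps
    × time es ≤ 1100 * (S * (length ps ⊔ 1))
    × All (_≤ 1700 * S ^ 2) (delays es)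
  machine-enumerates = trace-of events , paths , machine-run , machine-outputs , enumerates , machine-time , machine-delays

theorem1 : ∃ λ (P : Program) →
    ∃ λ (a : ℕ) → ∃ λ (i : ℕ) →
    ∃ λ (b : ℕ) →
    ∃ λ (c : ℕ) → ∃ λ (k : ℕ) →
    (G : Graph) (s t : Vertex G) → s ≢ t → (A : AdjacencyLists G) →
    ∃ λ (es : List Event) →
    ∃ λ (ps : List (List (Vertex G))) →
    Run (a * size G ^ i) P (initial (encode G A s t)) es
    × outputs es ≡ map (map toℕ) ps
    × IsEnumeration G s t ps
    × time es ≤ b * (size G * (length ps ⊔ 1))
    × All (_≤ c * size G ^ k) (delays es)
theorem1 = machineCode enumeration , 250 , 3 , 1100 , 1700 , 2 , λ G s t s≢t A →
  -- The vertex `s` makes the order positive, as the boot loop requires.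
  case successor s of λ { (m , order≡) →
  Bounds.machine-enumerates G s t s≢t A m order≡ }
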